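{- There exist positive real constants $T, c, C'$ and $q_0$ such that for every prime power $q \ge q_0$ and every set $U \subseteq \mathbb{F}_q^3$ with $|U| \ge Tq$, there is a collection $\mathcal{H}_U \subseteq \mathcal{S}_4(U)$ such that (i) $|\mathcal{H}_U| \ge c\,|U|^4/q$, and (ii) $\Delta_i(\mathcal{H}_U) \le C'\, |U|^{4-i} / q^{1-\frac{i-1}{3}}$ for every integer $i \in \{1,2,3\}$.
   Context: $\mathbb{F}_q$ is the finite field with $q$ elements and $\mathbb{F}_q^3$ is the $3$-dimensional affine space over it. A $k$-flat is a $k$-dimensional affine subspace. For $U \subseteq \mathbb{F}_q^3$, $\mathcal{S}_4(U)$ is the collection of all $4$-element subsets of $U$ that are contained in some $2$-flat (affine plane) of $\mathbb{F}_q^3$. A collection $\mathcal{H} \subseteq \mathcal{S}_4(U)$ is viewed as a $4$-uniform hypergraph with vertex set $U$. $|\mathcal{H}|$ denotes its number of edges. For $S \subseteq U$, $d_{\mathcal{H}}(S)$ is the number of edges of $\mathcal{H}$ containing $S$, and $\Delta_i(\mathcal{H})$ is the maximum of $d_{\mathcal{H}}(S)$ over all $S \subseteq U$ with $|S| = i$. -}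

module Defs where

open import Algebra.Apartness.Bundles using (HeytingField; HeytingCommutativeRing)
open import Algebra.Bundles using (CommutativeRing)
import Algebra.Definitions.RawSemiring as RawSemiringDefinitions
import Algebra.Properties.Monoid.Sum as MonoidSum
open import Data.Fin.Base using (Fin; zero; suc; combine; finToFun; funToFin)
open import Data.Fin.Properties using (funToFin-finToFin; finToFun-funToFin)
open import Data.Fin.Subset using (Subset; inside; outside; _∈_; _⊆_; ∣_∣)
open import Data.Fin.Subset.Properties using (_⊆?_)
import Data.Integer.Base as ℤ
open import Data.List.Base using (List; []; _∷_; _++_; map; filter; length)
open import Data.List.Extrema.Nat using (max)
import Data.Nat.Base as ℕ
open import Data.Nat.Base using (ℕ; zero; suc)
open import Data.Nat.Primality using (Prime)
import Data.Nat.Properties as ℕ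
open import Data.Product.Base using (Σ-syntax; ∃-syntax; _×_)
open import Data.Rational.Base using (ℚ; _/_; _*_; _≤_; +-*-rawSemiring)
open import Data.Vec.Base using ([]; _∷_)
open import Data.Vec.Functional using (Vector)
open import Function.Bundles using (Inverse)
open import Level using (0ℓ) renaming (suc to lsuc)
open import Relation.Binary.PropositionalEquality using (_≡_; cong₂; refl; trans; sym; setoid)
open import Relation.Nullary.Decidable using (_×-dec_)

PrimePower : ℕ → Set
PrimePower q = ∃[ p ] ∃[ k ] (Prime p × 1 ℕ.≤ k × q ≡ p ℕ.^ k)

-- On a finite carrier equality is decidable, and the tight apartness of a
-- Heyting field is then just the negation of equality.
record FiniteField (q : ℕ) : Set (lsuc 0ℓ) where
  field
    heytingField : HeytingField 0ℓ 0ℓ 0ℓ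

  commutativeRing : CommutativeRing 0ℓ 0ℓ
  commutativeRing =
    HeytingCommutativeRing.commutativeRing
      (HeytingField.heytingCommutativeRing heytingField)

  field
    enumeration : Inverse (CommutativeRing.setoid commutativeRing) (setoid (Fin q))

funToFin-cong : ∀ {m n} {f g : Fin m → Fin n} → (∀ j → f j ≡ g j) → funToFin f ≡ funToFin g
funToFin-cong {zero}  eq = refl
funToFin-cong {suc m} eq = cong₂ combine (eq zero) (funToFin-cong (λ j → eq (suc j)))

module AffineSpace {q : ℕ} (F : FiniteField q) (d : ℕ) where
  open FiniteField F using (commutativeRing; enumeration)
  open CommutativeRing commutativeRing
    using (Carrier; _≈_; 0#)
    renaming (_+_ to _+ᶠ_; _*_ to _*ᶠ_; trans to ≈-trans)
  open MonoidSum (CommutativeRing.+-monoid commutativeRing) using (sum)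
  open Inverse enumeration using (to; from; to-cong; from-cong; strictlyInverseˡ; strictlyInverseʳ)

  Point : Set
  Point = Vector Carrier d

  infix 4 _≋_
  _≋_ : Point → Point → Set
  x ≋ y = ∀ j → x j ≈ y j

  combination : ∀ {k} → Vector Carrier k → Vector Point k → Point
  combination t v j = sum (λ l → t l *ᶠ v l j)

  LinearlyIndependent : ∀ {k} → Vector Point k → Set
  LinearlyIndependent v =
    ∀ t → combination t v ≋ (λ _ → 0#) → ∀ l → t l ≈ 0#

  record Flat (k : ℕ) : Set where
    field
      origin      : Point
      direction   : Vector Point k
      independent : LinearlyIndependent direction

  infix 4 _∈ᶠ_
  _∈ᶠ_ : ∀ {k} → Point → Flat k → Set
  x ∈ᶠ A = ∃[ t ] (x ≋ λ j → origin j +ᶠ combination t direction j)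
    where open Flat A

  -- The q ^ d points are numbered through their coordinates, so that sets of
  -- points are given by Subset (q ^ d).
  point : Fin (q ℕ.^ d) → Point
  point a j = from (finToFun a j)

  index : Point → Fin (q ℕ.^ d)
  index x = funToFin (λ j → to (x j))

  point-index : ∀ x → point (index x) ≋ x
  point-index x j =
    ≈-trans (from-cong (finToFun-funToFin (λ l → to (x l)) j)) (strictlyInverseʳ (x j))

  point-injective : ∀ a b → point a ≋ point b → a ≡ b
  point-injective a b eq =
    trans (sym (funToFin-finToFin {d} a))
      (trans (funToFin-cong {d} coordinates) (funToFin-finToFin {d} b))
    where
    coordinates : ∀ j → finToFun {q} {d} a j ≡ finToFun b j
    coordinates j =
      trans (sym (strictlyInverseˡ _)) (trans (to-cong (eq j)) (strictlyInverseˡ _))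

  PointSet : Set
  PointSet = Subset (q ℕ.^ d)

  InSomeFlat : ℕ → PointSet → Set
  InSomeFlat k S = Σ[ A ∈ Flat k ] (∀ {a} → a ∈ S → point a ∈ᶠ A)

  𝒮₄ : PointSet → PointSet → Set
  𝒮₄ U S = S ⊆ U × ∣ S ∣ ≡ 4 × InSomeFlat 2 S

subsets : ∀ n → List (Subset n)
subsets zero    = [] ∷ []
subsets (suc n) = map (inside ∷_) (subsets n) ++ map (outside ∷_) (subsets n)

-- A hypergraph is given by a list of edges. This counts with multiplicity, so
-- it is the degree only when the list has no duplicates.
degree : ∀ {n} → List (Subset n) → Subset n → ℕ
degree H S = length (filter (S ⊆?_) H)

-- The default 0 only matters when i exceeds the size of U.
Δ : ∀ {n} → Subset n → ℕ → List (Subset n) → ℕ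
Δ {n} U i H =
  max 0 (map (degree H) (filter (λ S → (S ⊆? U) ×-dec (∣ S ∣ ℕ.≟ i)) (subsets n)))

fromℕ : ℕ → ℚ
fromℕ n = ℤ.+ n / 1

open RawSemiringDefinitions +-*-rawSemiring public using () renaming (_^_ to _^ℚ_)

-- x ≤ y / n^(1/3) for n > 0, with the (in general irrational) cube root
-- cleared by cubing, which preserves and reflects the order.
infix 4 _≤_/∛_
_≤_/∛_ : ℚ → ℚ → ℕ → Set
x ≤ y /∛ n = (x ^ℚ 3) * fromℕ n ≤ y ^ℚ 3

{-# OPTIONS --safe #-}

-- Put N = |U| and k ≈ N / 128q, and call a line rich if it holds at least 8k
-- points of U. Only nonvertical planes and lines are considered: planes that are
-- graphs over the first two coordinates, and the lines in them.
--
-- If fewer than q² / 4 lines are rich, then by Chebyshev's inequality most of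
-- the planes contain 64k points of U and no rich line. In each of them choose
-- 64k points and take all quadruples of these with no three on a line. A point
-- lies in q² planes, two points in at most q, and three points not on a line in
-- at most one, so the three degrees are O(q²k³), O(qk²) and O(k).
--
-- Otherwise take about q² rich lines. A point on at least 2q of them is rare: by
-- the Cauchy–Schwarz inequality such points account for O(q²) incidences, so at
-- least half of the lines keep 4k points each of which lies on fewer than 2q of
-- the lines. Take quadruples a, b, c, d with a, b on one line and c, d on another
-- that meets the first in a chosen point x. There are too many of them by a
-- factor of k; they are thinned out by numbering the points of each line and asking
-- that the positions of a, b and x satisfy b = a + x + k. Then any two of
-- a, b, x determine the third, and the same degree bounds hold.

module Submission where

-- The target N⁴/q is reached by about q³ planes with about N/q points each. What forbids taking all
-- their quadruples is collinearity: a line lies in up to q of the planes, so three points on one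
-- line could lie in q times too many edges. Dropping such triples costs a constant factor only
-- while no line of the plane holds a fixed share of its chosen points, and this is the role of the
-- threshold 8k against 64k. In the opposite case the rich lines themselves supply the edges, and
-- the obstacle moves to the points: the number of selected lines through a point enters the first
-- two degrees as a factor, so points on more than O(q) of them have to go. Both constructions give
-- Δ_i = O(N^(4-i)/q) for all three i, which is stronger than the claim for i = 2 and 3. With N
-- between 128qk and 256qk these bounds are the q²k³, qk² and k of the overview. Graphs over two
-- coordinates are named by triples of field elements without any normalization, every point lies on
-- exactly q² of them, and their coefficients serve directly as the labels by which planes through
-- given points are counted.

open import Defs

-- Kept in a module of its own because its arithmetic is that of ℕ, and that of the theorem is of ℚ.
module Supersaturation where

  open import Algebra.Apartness.Bundles using (HeytingField)
  open import Algebra.Bundles using (CommutativeRing)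
  import Algebra.Properties.Group as GroupProperties
  import Algebra.Solver.Ring.NaturalCoefficients.Default as RingSolver
  open import Data.Bool.Properties using () renaming (_≟_ to _≟ᵇ_)
  open import Data.Fin.Base using (Fin; zero; suc; toℕ)
  open import Data.Fin.Patterns using (0F; 1F; 2F; 3F)
  import Data.Fin.Properties as Fin
  open import Data.Fin.Subset using (Subset; inside; outside; ∣_∣; ⁅_⁆; _∪_; ⊥) renaming (_∈_ to _∈ˢ_; _⊆_ to _⊆ˢ_)
  open import Data.Fin.Subset.Properties using (_⊆?_; _∈?_; ∉⊥; x∈⁅x⁆; x∈⁅y⁆⇒x≡y; x∈p∪q⁻; x∈p∪q⁺; drop-there)
  open import Data.List.Base using (List; []; _∷_; _++_; map; filter; length; upTo; allFin; take; cartesianProduct; deduplicate)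
  open import Data.List.Extrema.Nat using (max≤v⁺)
  import Data.List.Membership.Setoid.Properties as SetoidMembership
  open import Data.List.Membership.Propositional using (_∈_; find; lose)
  open import Data.List.Membership.Propositional.Properties
    using (∈-upTo⁺; ∈-upTo⁻; ∈-allFin; ∈-filter⁻; ∈-filter⁺; ∈-map⁻; ∈-map⁺; ∈-++⁺ˡ; ∈-++⁺ʳ; ∈-deduplicate⁻;
           ∈-cartesianProduct⁺; ∈-cartesianProduct⁻)
  open import Data.List.Properties using (length-upTo; length-map; length-++; length-tabulate; length-take)
  open import Data.List.Relation.Unary.All as All using (All; []; _∷_)
  import Data.List.Relation.Unary.All.Properties as All
  open import Data.List.Relation.Unary.AllPairs as AllPairs using ([]; _∷_)
  import Data.List.Relation.Unary.AllPairs.Properties as AllPairs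
  open import Data.List.Relation.Unary.Any as Any using (Any; any?; here; there)
  import Data.List.Relation.Unary.Unique.DecSetoid.Properties as DecUnique
  open import Data.List.Relation.Unary.Unique.Propositional using (Unique)
  import Data.List.Relation.Unary.Unique.Propositional.Properties as Unique
  open import Data.Nat.Base using (ℕ; zero; suc; _+_; _*_; _∸_; _^_; _⊓_; _≤_; _<_; z≤n; s≤s; NonZero; >-nonZero)
  open import Data.Nat.ListAction using (sum; product)
  open import Data.Nat.Properties
  open import Data.Nat.Tactic.RingSolver using (solve-∀)
  open import Data.Product.Base using (_×_; _,_; proj₁; proj₂; ∃-syntax; Σ-syntax)
  open import Data.Product.Properties using () renaming (≡-dec to ×-≡-dec)
  open import Data.Sum.Base using (_⊎_; inj₁; inj₂)
  open import Data.Sum.Properties using () renaming (≡-dec to ⊎-≡-dec)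
  open import Data.Vec.Base as Vec using ([]; _∷_)
  open import Data.Vec.Functional using (Vector) renaming ([] to []ᶠ; _∷_ to _∷ᶠ_)
  open import Data.Vec.Properties using (≡-dec)
  open import Function.Base using (_∘_)
  open import Function.Bundles using (Inverse)
  open import Level using (0ℓ)
  open import Relation.Binary.Bundles using (DecSetoid)
  import Relation.Binary.Construct.On as On
  open import Relation.Binary.Definitions using (DecidableEquality)
  open import Relation.Binary.PropositionalEquality using (_≡_; _≢_; refl; sym; trans; cong; cong₂; subst; subst₂)
  import Relation.Binary.PropositionalEquality.Properties as ≡
  import Relation.Binary.Reasoning.Setoid as SetoidReasoning
  open import Relation.Nullary.Decidable using (Dec; yes; no; _×-dec_; _⊎-dec_; ¬?; decidable-stable)
  open import Relation.Nullary.Negation using (¬_; contradiction)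
  open import Relation.Unary using (Pred; Decidable)

  private
    variable
      A A′ : Set

  -- Finite sums, counting and the Cauchy-Schwarz inequality

  ∑ : List A → (A → ℕ) → ℕ
  ∑ xs f = sum (map f xs)

  𝟙 : {P : Set} → Dec P → ℕ
  𝟙 (yes _) = 1
  𝟙 (no  _) = 0

  𝟙-yes : {P : Set} (P? : Dec P) → P → 𝟙 P? ≡ 1
  𝟙-yes (yes _) p = refl
  𝟙-yes (no ¬p) p = contradiction p ¬p

  𝟙-× : {P Q : Set} (P? : Dec P) (Q? : Dec Q) → 𝟙 (P? ×-dec Q?) ≡ 𝟙 P? * 𝟙 Q?
  𝟙-× (yes _) (yes _) = refl
  𝟙-× (yes _) (no _)  = refl
  𝟙-× (no _)  _       = refl

  ∑-mono : ∀ (xs : List A) {f g} → (∀ x → x ∈ xs → f x ≤ g x) → ∑ xs f ≤ ∑ xs g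
  ∑-mono []       h = z≤n
  ∑-mono (x ∷ xs) h = +-mono-≤ (h x (here refl)) (∑-mono xs (λ y y∈ → h y (there y∈)))

  ∑-cong : ∀ (xs : List A) {f g} → (∀ x → x ∈ xs → f x ≡ g x) → ∑ xs f ≡ ∑ xs g
  ∑-cong []       h = refl
  ∑-cong (x ∷ xs) h = cong₂ _+_ (h x (here refl)) (∑-cong xs (λ y y∈ → h y (there y∈)))

  ∑-+ : ∀ (xs : List A) f g → ∑ xs (λ x → f x + g x) ≡ ∑ xs f + ∑ xs g
  ∑-+ []       f g = refl
  ∑-+ (x ∷ xs) f g rewrite ∑-+ xs f g = interchange (f x) (g x) (∑ xs f) (∑ xs g)
    where
    interchange : ∀ a b c d → a + b + (c + d) ≡ a + c + (b + d)
    interchange = solve-∀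

  ∑-*ˡ : ∀ (xs : List A) c f → ∑ xs (λ x → c * f x) ≡ c * ∑ xs f
  ∑-*ˡ []       c f = sym (*-zeroʳ c)
  ∑-*ˡ (x ∷ xs) c f rewrite ∑-*ˡ xs c f = sym (*-distribˡ-+ c (f x) (∑ xs f))

  ∑-*ʳ : ∀ (xs : List A) f c → ∑ xs (λ x → f x * c) ≡ ∑ xs f * c
  ∑-*ʳ []       f c = refl
  ∑-*ʳ (x ∷ xs) f c rewrite ∑-*ʳ xs f c = sym (*-distribʳ-+ c (f x) (∑ xs f))

  ∑-const : ∀ (xs : List A) c → ∑ xs (λ _ → c) ≡ length xs * c
  ∑-const []       c = refl
  ∑-const (x ∷ xs) c = cong (c +_) (∑-const xs c)

  ∑-swap : ∀ (xs : List A) (ys : List A′) (f : A → A′ → ℕ) →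
           ∑ xs (λ x → ∑ ys (f x)) ≡ ∑ ys (λ y → ∑ xs (λ x → f x y))
  ∑-swap []       ys f = sym (trans (∑-const ys 0) (*-zeroʳ (length ys)))
  ∑-swap (x ∷ xs) ys f rewrite ∑-swap xs ys f = sym (∑-+ ys (f x) (λ y → ∑ xs (λ x → f x y)))

  ∑-* : ∀ (xs : List A) (ys : List A′) (f : A → ℕ) (g : A′ → ℕ) →
        ∑ xs f * ∑ ys g ≡ ∑ xs (λ x → ∑ ys (λ y → f x * g y))
  ∑-* xs ys f g = trans (sym (∑-*ʳ xs f (∑ ys g))) (∑-cong xs (λ x _ → sym (∑-*ˡ ys (f x) g)))

  ∑-× : ∀ (xs : List A) (ys : List A′) f →
        ∑ (cartesianProduct xs ys) f ≡ ∑ xs (λ x → ∑ ys (λ y → f (x , y)))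
  ∑-× []       ys f = refl
  ∑-× (x ∷ xs) ys f = trans (∑-++ (map (x ,_) ys) (cartesianProduct xs ys) f)
      (cong₂ _+_ (∑-map ys) (∑-× xs ys f))
    where
    ∑-++ : ∀ {C : Set} (us vs : List C) f → ∑ (us ++ vs) f ≡ ∑ us f + ∑ vs f
    ∑-++ []       vs f = refl
    ∑-++ (u ∷ us) vs f = trans (cong (f u +_) (∑-++ us vs f)) (sym (+-assoc (f u) _ _))
    ∑-map : ∀ ys → ∑ (map (x ,_) ys) f ≡ ∑ ys (λ y → f (x , y))
    ∑-map []       = refl
    ∑-map (y ∷ ys) = cong (f (x , y) +_) (∑-map ys)

  count : {P : Pred A 0ℓ} → Decidable P → List A → ℕ
  count P? xs = length (filter P? xs)

  count≡∑ : ∀ {P : Pred A 0ℓ} (P? : Decidable P) xs → count P? xs ≡ ∑ xs (𝟙 ∘ P?)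
  count≡∑ P? []       = refl
  count≡∑ P? (x ∷ xs) with P? x
  ... | yes _ = cong suc (count≡∑ P? xs)
  ... | no  _ = count≡∑ P? xs

  ∑-filter : ∀ {P : Pred A 0ℓ} (P? : Decidable P) xs f → ∑ (filter P? xs) f ≡ ∑ xs (λ x → 𝟙 (P? x) * f x)
  ∑-filter P? []       f = refl
  ∑-filter P? (x ∷ xs) f with P? x
  ... | yes _ = cong₂ _+_ (sym (+-identityʳ (f x))) (∑-filter P? xs f)
  ... | no  _ = ∑-filter P? xs f

  count-mono : ∀ {P Q : Pred A 0ℓ} (P? : Decidable P) (Q? : Decidable Q) xs →
               (∀ x → x ∈ xs → P x → Q x) → count P? xs ≤ count Q? xs
  count-mono P? Q? xs h rewrite count≡∑ P? xs | count≡∑ Q? xs = ∑-mono xs step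
    where
    step : ∀ x → x ∈ xs → 𝟙 (P? x) ≤ 𝟙 (Q? x)
    step x x∈ with P? x
    ... | no  _ = z≤n
    ... | yes p = ≤-reflexive (sym (𝟙-yes (Q? x) (h x x∈ p)))

  length≤count+count : ∀ {P Q : Pred A 0ℓ} (P? : Decidable P) (Q? : Decidable Q) xs →
                       (∀ x → x ∈ xs → ¬ P x → Q x) → length xs ≤ count P? xs + count Q? xs
  length≤count+count P? Q? [] h = z≤n
  length≤count+count P? Q? (x ∷ xs) h with P? x | Q? x | length≤count+count P? Q? xs (λ y y∈ → h y (there y∈))
  ... | yes _ | yes _ | ih = s≤s (≤-trans ih (+-monoʳ-≤ (count P? xs) (n≤1+n _)))
  ... | yes _ | no  _ | ih = s≤s ih
  ... | no ¬p | yes _ | ih = ≤-trans (s≤s ih) (≤-reflexive (sym (+-suc (count P? xs) _)))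
  ... | no ¬p | no ¬q | ih = contradiction (h x (here refl) ¬p) ¬q

  -- Markov's inequality, in a form without division.
  count-*≤∑ : ∀ {P : Pred A 0ℓ} (P? : Decidable P) xs f m →
              (∀ x → x ∈ xs → P x → m ≤ f x) → count P? xs * m ≤ ∑ xs f
  count-*≤∑ P? []       f m h = z≤n
  count-*≤∑ P? (x ∷ xs) f m h with P? x
  ... | yes p = +-mono-≤ (h x (here refl) p) (count-*≤∑ P? xs f m (λ y y∈ → h y (there y∈)))
  ... | no  _ = ≤-trans (count-*≤∑ P? xs f m (λ y y∈ → h y (there y∈))) (m≤n+m _ (f x))

  2mn≤m²+n² : ∀ m n → 2 * (m * n) ≤ m * m + n * n
  2mn≤m²+n² m n with ≤-total m n
  ... | inj₁ m≤n = subst (λ n → 2 * (m * n) ≤ m * m + n * n) (m+[n∸m]≡n m≤n)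
                     (subst (2 * (m * (m + (n ∸ m))) ≤_) (square m (n ∸ m)) (m≤m+n _ _))
    where
    square : ∀ m d → 2 * (m * (m + d)) + d * d ≡ m * m + (m + d) * (m + d)
    square = solve-∀
  ... | inj₂ n≤m = subst (λ m → 2 * (m * n) ≤ m * m + n * n) (m+[n∸m]≡n n≤m)
                     (subst (2 * ((n + (m ∸ n)) * n) ≤_) (square n (m ∸ n)) (m≤m+n _ _))
    where
    square : ∀ n d → 2 * ((n + d) * n) + d * d ≡ (n + d) * (n + d) + n * n
    square = solve-∀

  -- Summing 2 f(x) f(y) ≤ f(x)² + f(y)² over all pairs (x , y) gives twice the claim.
  cauchy-schwarz : ∀ (xs : List A) f → ∑ xs f * ∑ xs f ≤ length xs * ∑ xs (λ x → f x * f x)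
  cauchy-schwarz xs f = *-cancelˡ-≤ 2 (begin
    2 * (∑ xs f * ∑ xs f)
      ≡⟨ cong (2 *_) (∑-* xs xs f f) ⟩
    2 * ∑ xs (λ x → ∑ xs (λ y → f x * f y))
      ≡⟨ ∑-*ˡ xs 2 _ ⟨
    ∑ xs (λ x → 2 * ∑ xs (λ y → f x * f y))
      ≡⟨ ∑-cong xs (λ x _ → sym (∑-*ˡ xs 2 _)) ⟩
    ∑ xs (λ x → ∑ xs (λ y → 2 * (f x * f y)))
      ≤⟨ ∑-mono xs (λ x _ → ∑-mono xs (λ y _ → 2mn≤m²+n² (f x) (f y))) ⟩
    ∑ xs (λ x → ∑ xs (λ y → f x * f x + f y * f y))
      ≡⟨ ∑-cong xs (λ x _ → trans (∑-+ xs _ _) (cong (_+ Q) (∑-const xs (f x * f x)))) ⟩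
    ∑ xs (λ x → length xs * (f x * f x) + Q)
      ≡⟨ trans (∑-+ xs _ _) (cong₂ _+_ (∑-*ˡ xs (length xs) _) (∑-const xs Q)) ⟩
    length xs * Q + length xs * Q
      ≡⟨ cong (length xs * Q +_) (+-identityʳ _) ⟨
    2 * (length xs * Q) ∎)
    where
    open ≤-Reasoning
    Q = ∑ xs (λ x → f x * f x)

  term≤∑ : ∀ (ys : List A) f {y} → y ∈ ys → f y ≤ ∑ ys f
  term≤∑ (y ∷ ys) f (here refl) = m≤m+n _ _
  term≤∑ (y ∷ ys) f (there y∈)  = ≤-trans (term≤∑ ys f y∈) (m≤n+m _ _)

  -- Cardinality bounds from injections into boxes

  AtMost : ℕ → Pred A 0ℓ → Set
  AtMost n P = ∀ xs → Unique xs → All P xs → length xs ≤ n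

  AtMost-one : ∀ {P : Pred A 0ℓ} → (∀ x y → P x → P y → x ≡ y) → AtMost 1 P
  AtMost-one h []           _                    _              = z≤n
  AtMost-one h (x ∷ [])     _                    _              = s≤s z≤n
  AtMost-one h (x ∷ y ∷ zs) ((x≢y ∷ _) ∷ _) (px ∷ py ∷ _) = contradiction (h x y px py) x≢y

  AtMost-fibres : ∀ {P : Pred A 0ℓ} (g : A → ℕ) {m n} → (∀ x → P x → g x < m) →
                  (∀ l → AtMost n (λ x → P x × g x ≡ l)) → AtMost (m * n) P
  AtMost-fibres {P = P} g {m} {n} g<m fibre xs uniq pxs = begin
    length xs
      ≡⟨ *-identityʳ _ ⟨
    length xs * 1
      ≡⟨ ∑-const xs 1 ⟨
    ∑ xs (λ _ → 1)
      ≤⟨ ∑-mono xs (λ x x∈ → hit x (All.lookup pxs x∈)) ⟩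
    ∑ xs (λ x → ∑ (upTo m) (λ l → 𝟙 (g x ≟ l)))
      ≡⟨ ∑-swap xs (upTo m) _ ⟩
    ∑ (upTo m) (λ l → ∑ xs (λ x → 𝟙 (g x ≟ l)))
      ≡⟨ ∑-cong (upTo m) (λ l _ → sym (count≡∑ (λ x → g x ≟ l) xs)) ⟩
    ∑ (upTo m) (λ l → count (λ x → g x ≟ l) xs)
      ≤⟨ ∑-mono (upTo m) (λ l _ → fibre l (filter (λ x → g x ≟ l) xs) (Unique.filter⁺ _ uniq)
           (All.tabulate (λ x∈ → let (x∈xs , eq) = ∈-filter⁻ (λ x → g x ≟ l) x∈ in All.lookup pxs x∈xs , eq))) ⟩
    ∑ (upTo m) (λ _ → n)
      ≡⟨ trans (∑-const (upTo m) n) (cong (_* n) (length-upTo m)) ⟩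
    m * n ∎
    where
    open ≤-Reasoning
    hit : ∀ x → P x → 1 ≤ ∑ (upTo m) (λ l → 𝟙 (g x ≟ l))
    hit x px = ≤-trans (≤-reflexive (sym (𝟙-yes (g x ≟ g x) refl)))
                       (term≤∑ (upTo m) (λ l → 𝟙 (g x ≟ l)) (∈-upTo⁺ (g<m x px)))

  -- The functions in `ls` together inject P into a box whose sides are the given bounds. All degree
  -- bounds are obtained this way, by naming the coordinates that still have to be chosen. `AtMost`
  -- measures P by duplicate-free lists because the parameter types to which this is applied contain
  -- ℕ and cannot be enumerated.
  AtMost-box : ∀ (ls : List ((A → ℕ) × ℕ)) {P : Pred A 0ℓ} →
               All (λ (g , m) → ∀ x → P x → g x < m) ls →
               (∀ x y → P x → P y → All (λ (g , _) → g x ≡ g y) ls → x ≡ y) →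
               AtMost (product (map proj₂ ls)) P
  AtMost-box []             []         inj = AtMost-one (λ x y px py → inj x y px py [])
  AtMost-box ((g , m) ∷ ls) (g<m ∷ hs) inj = AtMost-fibres g g<m (λ l → AtMost-box ls
    (All.map (λ h x (px , _) → h x px) hs)
    (λ x y (px , gx) (py , gy) eqs → inj x y px py (trans gx (sym gy) ∷ eqs)))

  module Rank (_≟ᴬ_ : DecidableEquality A) where

    -- An element that is absent gets the length of the list, a value taken by no member. `degree≤`
    -- relies on this to tell vertices inside S from those outside.
    rank : List A → A → ℕ
    rank []       y = 0
    rank (x ∷ xs) y with x ≟ᴬ y
    ... | yes _ = 0
    ... | no  _ = suc (rank xs y)

    rank<length : ∀ xs {y} → y ∈ xs → rank xs y < length xs
    rank<length (x ∷ xs) {y} y∈ with x ≟ᴬ y | y∈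
    ... | yes _  | _         = s≤s z≤n
    ... | no x≢y | here refl = contradiction refl x≢y
    ... | no _   | there y∈′ = s≤s (rank<length xs y∈′)

    rank-injective : ∀ xs {y z} → y ∈ xs → z ∈ xs → rank xs y ≡ rank xs z → y ≡ z
    rank-injective (x ∷ xs) {y} {z} y∈ z∈ eq with x ≟ᴬ y | x ≟ᴬ z | y∈ | z∈
    ... | yes refl | yes refl | _ | _ = refl
    ... | no x≢y | _ | here refl | _ = contradiction refl x≢y
    ... | _ | no x≢z | _ | here refl = contradiction refl x≢z
    ... | no _ | no _ | there y∈′ | there z∈′ = rank-injective xs y∈′ z∈′ (suc-injective eq)

    Unique-⊆⇒length≤ : ∀ xs ys → Unique xs → (∀ {x} → x ∈ xs → x ∈ ys) → length xs ≤ length ys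
    Unique-⊆⇒length≤ xs ys uniq xs⊆ys = subst (length xs ≤_) (*-identityʳ _)
      (AtMost-box ((rank ys , length ys) ∷ []) {P = _∈ ys}
        ((λ x x∈ → rank<length ys x∈) ∷ [])
        (λ { x y x∈ y∈ (eq ∷ []) → rank-injective ys x∈ y∈ eq })
        xs uniq (All.tabulate xs⊆ys))

  Unique-map : ∀ (f : A → A′) xs → (∀ {x y} → x ∈ xs → y ∈ xs → f x ≡ f y → x ≡ y) →
               Unique xs → Unique (map f xs)
  Unique-map f []       inj []          = []
  Unique-map f (x ∷ xs) inj (x∉ ∷ uniq) =
    All.map⁺ (All.tabulate (λ y∈ eq → All.lookup x∉ y∈ (inj (here refl) (there y∈) eq)))
    ∷ Unique-map f xs (λ x∈ y∈ → inj (there x∈) (there y∈)) uniq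

  AtMost-map : ∀ {P : Pred A′ 0ℓ} {n} (f : A → A′) {Q : Pred A 0ℓ} → (∀ {x y} → Q x → Q y → f x ≡ f y → x ≡ y) →
               (∀ {x} → Q x → P (f x)) → AtMost n P → AtMost n Q
  AtMost-map {n = n} f inj pres h xs uniq qxs = subst (_≤ n) (length-map f xs)
    (h (map f xs) (Unique-map f xs (λ x∈ y∈ → inj (All.lookup qxs x∈) (All.lookup qxs y∈)) uniq)
       (All.map⁺ (All.map pres qxs)))

  -- Only used at positions below the length, where the default is irrelevant.
  nth : A → List A → ℕ → A
  nth d []       _       = d
  nth d (x ∷ xs) zero    = x
  nth d (x ∷ xs) (suc s) = nth d xs s

  nth-∈ : ∀ (d : A) xs {s} → s < length xs → nth d xs s ∈ xs
  nth-∈ d (x ∷ xs) {zero}  _       = here refl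
  nth-∈ d (x ∷ xs) {suc s} (s≤s h) = there (nth-∈ d xs h)

  nth-injective : ∀ (d : A) {xs s t} → Unique xs → s < length xs → t < length xs →
                  nth d xs s ≡ nth d xs t → s ≡ t
  nth-injective d {x ∷ xs} {zero}  {zero}  _           _       _       eq = refl
  nth-injective d {x ∷ xs} {zero}  {suc t} (x∉ ∷ _)    _       (s≤s h) eq = contradiction eq (All.lookup x∉ (nth-∈ d xs h))
  nth-injective d {x ∷ xs} {suc s} {zero}  (x∉ ∷ _)    (s≤s h) _       eq = contradiction (sym eq) (All.lookup x∉ (nth-∈ d xs h))
  nth-injective d {x ∷ xs} {suc s} {suc t} (_ ∷ uniq)  (s≤s h) (s≤s k) eq = cong suc (nth-injective d uniq h k eq)

  -- Subsets as duplicate-free lists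

  elements : ∀ {n} → Subset n → List (Fin n)
  elements []            = []
  elements (inside  ∷ S) = zero ∷ map suc (elements S)
  elements (outside ∷ S) = map suc (elements S)

  length-elements : ∀ {n} (S : Subset n) → length (elements S) ≡ ∣ S ∣
  length-elements []            = refl
  length-elements (inside  ∷ S) = cong suc (trans (length-map suc (elements S)) (length-elements S))
  length-elements (outside ∷ S) = trans (length-map suc (elements S)) (length-elements S)

  elements-unique : ∀ {n} (S : Subset n) → Unique (elements S)
  elements-unique []            = []
  elements-unique (inside  ∷ S) =
    All.map⁺ (All.tabulate (λ _ ())) ∷ Unique.map⁺ Fin.suc-injective (elements-unique S)
  elements-unique (outside ∷ S) = Unique.map⁺ Fin.suc-injective (elements-unique S)

  ∈-elements⁺ : ∀ {n} {S : Subset n} {x} → x ∈ˢ S → x ∈ elements S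
  ∈-elements⁺ {S = inside  ∷ S} {zero}  _ = here refl
  ∈-elements⁺ {S = inside  ∷ S} {suc x} h = there (∈-map⁺ suc (∈-elements⁺ (drop-there h)))
  ∈-elements⁺ {S = outside ∷ S} {suc x} h = ∈-map⁺ suc (∈-elements⁺ (drop-there h))

  ∈-elements⁻ : ∀ {n} {S : Subset n} {x} → x ∈ elements S → x ∈ˢ S
  ∈-elements⁻ {S = inside  ∷ S} (here refl) = Vec.here
  ∈-elements⁻ {S = inside  ∷ S} (there h) with _ , h′ , refl ← ∈-map⁻ suc h = Vec.there (∈-elements⁻ h′)
  ∈-elements⁻ {S = outside ∷ S} h with _ , h′ , refl ← ∈-map⁻ suc h = Vec.there (∈-elements⁻ h′)

  fromList : ∀ {n} → List (Fin n) → Subset n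
  fromList []       = ⊥
  fromList (x ∷ xs) = ⁅ x ⁆ ∪ fromList xs

  ∈-fromList⁺ : ∀ {n} {xs : List (Fin n)} {x} → x ∈ xs → x ∈ˢ fromList xs
  ∈-fromList⁺ {xs = x ∷ xs} (here refl) = x∈p∪q⁺ (inj₁ (x∈⁅x⁆ x))
  ∈-fromList⁺ {xs = x ∷ xs} (there h)   = x∈p∪q⁺ (inj₂ (∈-fromList⁺ h))

  ∈-fromList⁻ : ∀ {n} {xs : List (Fin n)} {x} → x ∈ˢ fromList xs → x ∈ xs
  ∈-fromList⁻ {xs = []}     h = contradiction h ∉⊥
  ∈-fromList⁻ {xs = y ∷ xs} h with x∈p∪q⁻ ⁅ y ⁆ (fromList xs) h
  ... | inj₁ h′ = here (x∈⁅y⁆⇒x≡y y h′)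
  ... | inj₂ h′ = there (∈-fromList⁻ h′)

  ∣fromList∣ : ∀ {n} (xs : List (Fin n)) → Unique xs → ∣ fromList xs ∣ ≡ length xs
  ∣fromList∣ xs uniq = trans (sym (length-elements (fromList xs))) (≤-antisym
    (Unique-⊆⇒length≤ (elements S) xs (elements-unique S) (λ x∈ → ∈-fromList⁻ {xs = xs} (∈-elements⁻ {S = S} x∈)))
    (Unique-⊆⇒length≤ xs (elements S) uniq (λ x∈ → ∈-elements⁺ {S = S} (∈-fromList⁺ {xs = xs} x∈))))
    where
    open Rank Fin._≟_
    S = fromList xs

  -- Hypergraphs given by parametrized quadruples

  choose : ℕ → List A → List (List A)
  choose zero    _        = [] ∷ []
  choose (suc k) []       = []
  choose (suc k) (x ∷ xs) = map (x ∷_) (choose k xs) ++ choose (suc k) xs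

  -- The positions at which an edge meets S arise as a filter; this recognises them as one of the
  -- finitely many patterns for which a bound is supplied.
  filter-∈-choose : ∀ {P : Pred A 0ℓ} (P? : Decidable P) xs → filter P? xs ∈ choose (count P? xs) xs
  filter-∈-choose P? []       = here refl
  filter-∈-choose P? (x ∷ xs) with P? x
  ... | yes _ = ∈-++⁺ˡ (∈-map⁺ (x ∷_) (filter-∈-choose P? xs))
  ... | no  _ with count P? xs | filter-∈-choose P? xs
  ...   | zero  | h = here (nil h)
    where
    nil : ∀ {ys} → ys ∈ ([] ∷ []) → ys ≡ []
    nil (here eq) = eq
  ...   | suc k | h = ∈-++⁺ʳ (map (x ∷_) (choose k xs)) h

  -- Degrees are controlled position by position: it suffices to bound, for every
  -- set X of i of the four positions, the number of e with prescribed vertices in X.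
  module Hypergraph
    {n : ℕ} {E : Set} (v : Fin 4 → E → Fin n) (I : List E) (I-unique : Unique I)
    (v-injective : ∀ {e e′} → e ∈ I → e′ ∈ I → (∀ m → v m e ≡ v m e′) → e ≡ e′)
    (v-distinct : ∀ {e} → e ∈ I → ∀ {m m′} → v m e ≡ v m′ e → m ≡ m′)
    where

    positions : List (Fin 4)
    positions = 0F ∷ 1F ∷ 2F ∷ 3F ∷ []

    ∈-positions : ∀ m → m ∈ positions
    ∈-positions 0F = here refl
    ∈-positions 1F = there (here refl)
    ∈-positions 2F = there (there (here refl))
    ∈-positions 3F = there (there (there (here refl)))

    positions-unique : Unique positions
    positions-unique = Unique.allFin⁺ 4

    Agree : E → List (Fin 4) → Pred E 0ℓ
    Agree e₀ X e = e ∈ I × All (λ m → v m e ≡ v m e₀) X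

    vertices : E → List (Fin n)
    vertices e = map (λ m → v m e) positions

    vertices-unique : ∀ {e} → e ∈ I → Unique (vertices e)
    vertices-unique e∈ = Unique-map _ positions (λ _ _ → v-distinct e∈) positions-unique

    edge : E → Subset n
    edge e = fromList (vertices e)

    v∈edge : ∀ m e → v m e ∈ˢ edge e
    v∈edge m e = ∈-fromList⁺ {xs = vertices e} (∈-map⁺ (λ m → v m e) (∈-positions m))

    ∈edge⇒v : ∀ {x} e → x ∈ˢ edge e → ∃[ m ] x ≡ v m e
    ∈edge⇒v e x∈ with m , _ , eq ← ∈-map⁻ (λ m → v m e) (∈-fromList⁻ {xs = vertices e} x∈) = m , eq

    ∣edge∣ : ∀ {e} → e ∈ I → ∣ edge e ∣ ≡ 4
    ∣edge∣ {e} e∈ = ∣fromList∣ (vertices e) (vertices-unique e∈)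

    private
      _≟ˢ_ : DecidableEquality (Subset n)
      _≟ˢ_ = ≡-dec _≟ᵇ_

      edgeSetoid : DecSetoid _ _
      edgeSetoid = On.decSetoid (≡.decSetoid _≟ˢ_) edge

      -- Duplicates are removed among the parameters and not among their edges, so that a degree
      -- remains a count of elements of `I`.
      representatives : List E
      representatives = deduplicate (λ e e′ → edge e ≟ˢ edge e′) I

      representative⇒∈ : ∀ {e} → e ∈ representatives → e ∈ I
      representative⇒∈ = ∈-deduplicate⁻ (λ e e′ → edge e ≟ˢ edge e′) I

      module R = Rank (Fin._≟_ {n})

    edges : List (Subset n)
    edges = map edge representatives

    edges-unique : Unique edges
    edges-unique = AllPairs.map⁺ (DecUnique.deduplicate-! edgeSetoid I)

    ∈-edges⁻ : ∀ {T} → T ∈ edges → ∃[ e ] e ∈ I × T ≡ edge e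
    ∈-edges⁻ T∈ with e , e∈ , eq ← ∈-map⁻ edge T∈ = e , representative⇒∈ e∈ , eq

    edges-All : ∀ {P : Pred (Subset n) 0ℓ} → (∀ {e} → e ∈ I → P (edge e)) → All P edges
    edges-All {P} h = All.tabulate (λ T∈ → let (e , e∈ , eq) = ∈-edges⁻ T∈ in subst P (sym eq) (h e∈))

    edge-vertices : ∀ {Q : Pred (Fin n) 0ℓ} e → (∀ m → Q (v m e)) → ∀ {x} → x ∈ˢ edge e → Q x
    edge-vertices {Q} e h x∈ = let (m , eq) = ∈edge⇒v e x∈ in subst Q (sym eq) (h m)

    ∈-edges⁺ : ∀ {e} → e ∈ I → edge e ∈ edges
    ∈-edges⁺ {e} e∈ = locate (SetoidMembership.∈-deduplicate⁺ (DecSetoid.setoid edgeSetoid)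
      (λ e e′ → edge e ≟ˢ edge e′) (λ eq eq′ → trans eq′ (sym eq)) (Any.map (cong edge) e∈))
      where
      locate : ∀ {es} → Any (λ e′ → edge e ≡ edge e′) es → edge e ∈ map edge es
      locate (here eq) = here eq
      locate (there h) = there (locate h)

    -- An edge together with the ranks of the four vertices inside it determines the parameter. The
    -- four ranks are bounded independently, each by 4, which gives 4⁴ = 256.
    length-I≤ : length I ≤ length edges * 256
    length-I≤ = AtMost-box (((λ e → S.rank edges (edge e)) , length edges) ∷ map label positions)
      ((λ e e∈ → S.rank<length edges (∈-edges⁺ e∈)) ∷ bound 0F ∷ bound 1F ∷ bound 2F ∷ bound 3F ∷ [])
      inj I I-unique (All.tabulate (λ e∈ → e∈))
      where
      module S = Rank _≟ˢ_
      label : Fin 4 → (E → ℕ) × ℕ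
      label m = (λ e → R.rank (elements (edge e)) (v m e)) , 4
      bound : ∀ m e → e ∈ I → R.rank (elements (edge e)) (v m e) < 4
      bound m e e∈ = subst (R.rank (elements (edge e)) (v m e) <_)
        (trans (length-elements (edge e)) (∣edge∣ e∈))
        (R.rank<length (elements (edge e)) (∈-elements⁺ (v∈edge m e)))
      inj : ∀ e e′ → e ∈ I → e′ ∈ I →
            All (λ (g , _) → g e ≡ g e′) (((λ e → S.rank edges (edge e)) , length edges) ∷ map label positions) → e ≡ e′
      inj e e′ e∈ e′∈ (eq ∷ eqs) = v-injective e∈ e′∈ (λ m →
        R.rank-injective (elements (edge e)) (∈-elements⁺ (v∈edge m e))
          (subst (λ T → v m e′ ∈ elements T) (sym same) (∈-elements⁺ (v∈edge m e′)))
          (trans (All.lookup (All.map⁻ {f = label} eqs) (∈-positions m)) (cong (λ T → R.rank (elements T) (v m e′)) (sym same))))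
        where
        same : edge e ≡ edge e′
        same = S.rank-injective edges (∈-edges⁺ e∈) (∈-edges⁺ e′∈) eq

    -- Label each position by the rank of its vertex in S, with the value ∣S∣ for a vertex outside
    -- S. As ∣S∣ ≤ 3, there are at most 4 values per position and 256 label vectors in all.
    -- Parameters with equal labels have the same vertices at the ∣S∣ positions that meet S, so one
    -- of the assumed patterns bounds their number.
    degree≤ : ∀ (S : Subset n) {D} → ∣ S ∣ ≤ 3 →
              All (λ X → ∀ {e₀} → e₀ ∈ I → AtMost D (Agree e₀ X)) (choose ∣ S ∣ positions) →
              degree edges S ≤ D * 256
    degree≤ S {D} ∣S∣≤3 patterns = subst (_≤ D * 256) (sym (count-map representatives))
      (fibred (filter (λ e → S ⊆? edge e) representatives)
        (Unique.filter⁺ _ reps-unique)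
        (All.tabulate (λ e∈ → let (e∈′ , S⊆) = ∈-filter⁻ (λ e → S ⊆? edge e) {xs = representatives} e∈ in
          representative⇒∈ e∈′ , S⊆)))
      where
      reps-unique : Unique representatives
      reps-unique = AllPairs.map (λ neq eq → neq (cong edge eq))
        (DecUnique.deduplicate-! edgeSetoid I)

      count-map : ∀ es → degree (map edge es) S ≡ count (λ e → S ⊆? edge e) es
      count-map []       = refl
      count-map (e ∷ es) with S ⊆? edge e
      ... | yes _ = cong suc (count-map es)
      ... | no  _ = count-map es

      Q : Pred E 0ℓ
      Q e = e ∈ I × S ⊆ˢ edge e

      label : Fin 4 → E → ℕ
      label m e = R.rank (elements S) (v m e)

      rank≤length : ∀ xs x → R.rank xs x ≤ length xs
      rank≤length []       y = z≤n
      rank≤length (x ∷ xs) y with x Fin.≟ y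
      ... | yes _ = z≤n
      ... | no  _ = s≤s (rank≤length xs y)

      rank-∉ : ∀ xs {x} → ¬ x ∈ xs → R.rank xs x ≡ length xs
      rank-∉ []       h = refl
      rank-∉ (y ∷ xs) {x} h with y Fin.≟ x
      ... | yes refl = contradiction (here refl) h
      ... | no  _    = cong suc (rank-∉ xs (h ∘ there))

      label<4 : ∀ m e → Q e → label m e < 4
      label<4 m e _ = s≤s (≤-trans (rank≤length (elements S) (v m e))
                            (subst (_≤ 3) (sym (length-elements S)) ∣S∣≤3))

      fibre : ∀ l₀ l₁ l₂ l₃ → AtMost D (λ e →
                (((Q e × label 0F e ≡ l₀) × label 1F e ≡ l₁) × label 2F e ≡ l₂) × label 3F e ≡ l₃)
      fibre _ _ _ _ []       _    _    = z≤n
      -- The first parameter of the fibre is the reference e₀ with which all the others agree.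
      fibre l₀ l₁ l₂ l₃ es@(e₀ ∷ _) uniq qs@(((((( e₀∈ , S⊆ ) , h₀) , h₁) , h₂) , h₃) ∷ _) =
        All.lookup patterns X∈choose e₀∈ es uniq (All.map agree qs)
        where
        inS? : ∀ m → Dec (v m e₀ ∈ˢ S)
        inS? m = v m e₀ ∈? S

        X : List (Fin 4)
        X = filter inS? positions

        same-vertex : ∀ m {e} → label m e ≡ label m e₀ → v m e₀ ∈ˢ S → v m e ≡ v m e₀
        same-vertex m {e} eq vm∈ with v m e ∈? S
        ... | yes v∈ = R.rank-injective (elements S) (∈-elements⁺ v∈) (∈-elements⁺ vm∈) eq
        ... | no v∉ = contradiction
          (trans (sym (rank-∉ (elements S) (v∉ ∘ ∈-elements⁻))) eq)
          (<⇒≢ (R.rank<length (elements S) (∈-elements⁺ vm∈)) ∘ sym)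

        length-X : length X ≡ ∣ S ∣
        length-X = trans (sym (length-map (λ m → v m e₀) X)) (trans (≤-antisym
          (R.Unique-⊆⇒length≤ (map (λ m → v m e₀) X) (elements S)
            (Unique-map _ X (λ _ _ → v-distinct e₀∈) (Unique.filter⁺ inS? positions-unique))
            (λ x∈ → let (m , m∈ , eq) = ∈-map⁻ (λ m → v m e₀) x∈ in
               ∈-elements⁺ (subst (_∈ˢ S) (sym eq) (proj₂ (∈-filter⁻ inS? {xs = positions} m∈)))))
          (R.Unique-⊆⇒length≤ (elements S) (map (λ m → v m e₀) X) (elements-unique S)
            (λ {x} x∈ → let x∈S = ∈-elements⁻ x∈ ; (m , eq) = ∈edge⇒v e₀ (S⊆ x∈S) in
               subst (_∈ map (λ m → v m e₀) X) (sym eq)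
                 (∈-map⁺ (λ m → v m e₀) (∈-filter⁺ inS? (∈-positions m) (subst (_∈ˢ S) eq x∈S))))))
          (length-elements S))

        X∈choose : X ∈ choose ∣ S ∣ positions
        X∈choose = subst (λ i → X ∈ choose i positions) length-X (filter-∈-choose inS? positions)

        agree : ∀ {e} → (((Q e × label 0F e ≡ l₀) × label 1F e ≡ l₁) × label 2F e ≡ l₂) × label 3F e ≡ l₃ →
                Agree e₀ X e
        agree {e} (((((e∈ , _) , k₀) , k₁) , k₂) , k₃) = e∈ , All.tabulate (λ {m} m∈ →
          same-vertex m (labels m) (proj₂ (∈-filter⁻ inS? {xs = positions} m∈)))
          where
          labels : ∀ m → label m e ≡ label m e₀
          labels 0F = trans k₀ (sym h₀)
          labels 1F = trans k₁ (sym h₁)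
          labels 2F = trans k₂ (sym h₂)
          labels 3F = trans k₃ (sym h₃)

      fibred : AtMost (D * 256) Q
      fibred = subst (λ k → AtMost k Q) (assoc D)
        (AtMost-fibres (label 0F) (label<4 0F) (λ l₀ →
         AtMost-fibres (label 1F) (λ e (q , _) → label<4 1F e q) (λ l₁ →
         AtMost-fibres (label 2F) (λ e ((q , _) , _) → label<4 2F e q) (λ l₂ →
         AtMost-fibres (label 3F) (λ e (((q , _) , _) , _) → label<4 3F e q) (λ l₃ →
         fibre l₀ l₁ l₂ l₃)))))
        where
        assoc : ∀ D → 4 * (4 * (4 * (4 * D))) ≡ D * 256
        assoc = solve-∀

    Δ≤ : ∀ (U : Subset n) {i D} → i ≤ 3 →
         All (λ X → ∀ {e₀} → e₀ ∈ I → AtMost D (Agree e₀ X)) (choose i positions) →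
         Δ U i edges ≤ D * 256
    Δ≤ U {i} i≤3 patterns = max≤v⁺ z≤n (All.map⁺ (All.tabulate (λ {S} S∈ →
      let (_ , _ , ∣S∣≡i) = ∈-filter⁻ (λ S → (S ⊆? U) ×-dec (∣ S ∣ ≟ i)) {xs = subsets n} S∈ in
      degree≤ S (subst (_≤ 3) (sym ∣S∣≡i) i≤3)
        (subst (λ i → All _ (choose i positions)) (sym ∣S∣≡i) patterns))))

  open import Data.Product.Properties using () renaming (≡-dec to ×-≡-dec)
  open import Data.List.Membership.Propositional.Properties using (∈-cartesianProduct⁻)
  open import Data.List.Properties using (length-++)
  open import Relation.Nullary.Decidable using (_⊎-dec_)

  -- Cartesian products, unions and coinciding values

  ∈-cartesianProduct : ∀ (xs : List A) (ys : List A′) {x y} →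
                       (x , y) ∈ cartesianProduct xs ys → x ∈ xs × y ∈ ys
  ∈-cartesianProduct xs ys = ∈-cartesianProduct⁻ xs ys

  length-cartesianProduct : ∀ (xs : List A) (ys : List A′) → length (cartesianProduct xs ys) ≡ length xs * length ys
  length-cartesianProduct []       ys = refl
  length-cartesianProduct (x ∷ xs) ys = trans (length-++ (map (x ,_) ys))
    (cong₂ _+_ (length-map (x ,_) ys) (length-cartesianProduct xs ys))

  count-⊎ : ∀ {P Q : Pred A 0ℓ} (P? : Decidable P) (Q? : Decidable Q) xs →
            count (λ x → P? x ⊎-dec Q? x) xs ≤ count P? xs + count Q? xs
  count-⊎ P? Q? []       = z≤n
  count-⊎ P? Q? (x ∷ xs) with P? x | Q? x | count-⊎ P? Q? xs
  ... | yes _ | yes _ | ih = s≤s (≤-trans ih (+-monoʳ-≤ (count P? xs) (n≤1+n _)))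
  ... | yes _ | no  _ | ih = s≤s ih
  ... | no  _ | yes _ | ih = ≤-trans (s≤s ih) (≤-reflexive (sym (+-suc (count P? xs) _)))
  ... | no  _ | no  _ | ih = ih

  AtMost⇒count≤ : ∀ {P : Pred A 0ℓ} (P? : Decidable P) {xs n} → Unique xs →
                  AtMost n (λ x → x ∈ xs × P x) → count P? xs ≤ n
  AtMost⇒count≤ P? {xs} uniq h = h (filter P? xs) (Unique.filter⁺ P? uniq) (All.tabulate (∈-filter⁻ P?))

  ∑𝟙≟≤1 : ∀ (_≟ᴮ_ : DecidableEquality A′) ys b → Unique ys → ∑ ys (λ y → 𝟙 (b ≟ᴮ y)) ≤ 1
  ∑𝟙≟≤1 _≟ᴮ_ ys b uniq = subst (_≤ 1) (count≡∑ (b ≟ᴮ_) ys)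
    (AtMost⇒count≤ (b ≟ᴮ_) uniq (AtMost-one (λ { x y (_ , eq) (_ , eq′) → trans (sym eq) eq′ })))

  -- Cauchy-Schwarz applied to the fibre sizes `r`: they sum to at least the length of `xs`, and the
  -- sum of their squares counts the pairs with equal values.
  collisions : ∀ (_≟ᴮ_ : DecidableEquality A′) (f : A → A′) (xs : List A) (ys : List A′) → Unique ys →
               (∀ {x} → x ∈ xs → f x ∈ ys) →
               length xs * length xs ≤ length ys * ∑ xs (λ x → ∑ xs (λ x′ → 𝟙 (f x ≟ᴮ f x′)))
  collisions _≟ᴮ_ f xs ys uniq f∈ = begin
    length xs * length xs
      ≤⟨ *-mono-≤ size size ⟩
    ∑ ys r * ∑ ys r
      ≤⟨ cauchy-schwarz ys r ⟩
    length ys * ∑ ys (λ y → r y * r y)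
      ≡⟨ cong (length ys *_) squares ⟩
    length ys * ∑ xs (λ x → ∑ xs (λ x′ → ∑ ys (λ y → δ x y * δ x′ y)))
      ≤⟨ *-monoʳ-≤ (length ys) (∑-mono xs (λ x _ → ∑-mono xs (λ x′ _ → both-hit x x′))) ⟩
    length ys * ∑ xs (λ x → ∑ xs (λ x′ → 𝟙 (f x ≟ᴮ f x′))) ∎
    where
    open ≤-Reasoning
    δ : _ → _ → ℕ
    δ x y = 𝟙 (f x ≟ᴮ y)
    r : _ → ℕ
    r y = ∑ xs (λ x → δ x y)
    size : length xs ≤ ∑ ys r
    size = begin
      length xs                      ≡⟨ trans (∑-const xs 1) (*-identityʳ _) ⟨
      ∑ xs (λ _ → 1)                 ≤⟨ ∑-mono xs (λ x x∈ → ≤-trans (≤-reflexive (sym (𝟙-yes (f x ≟ᴮ f x) refl)))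
                                          (term≤∑ ys (δ x) (f∈ x∈))) ⟩
      ∑ xs (λ x → ∑ ys (δ x))        ≡⟨ ∑-swap xs ys δ ⟩
      ∑ ys r ∎
    squares : ∑ ys (λ y → r y * r y) ≡ ∑ xs (λ x → ∑ xs (λ x′ → ∑ ys (λ y → δ x y * δ x′ y)))
    squares = begin-equality
      ∑ ys (λ y → r y * r y)
        ≡⟨ ∑-cong ys (λ y _ → ∑-* xs xs (λ x → δ x y) (λ x → δ x y)) ⟩
      ∑ ys (λ y → ∑ xs (λ x → ∑ xs (λ x′ → δ x y * δ x′ y)))
        ≡⟨ ∑-swap ys xs (λ y x → ∑ xs (λ x′ → δ x y * δ x′ y)) ⟩
      ∑ xs (λ x → ∑ ys (λ y → ∑ xs (λ x′ → δ x y * δ x′ y)))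
        ≡⟨ ∑-cong xs (λ x _ → ∑-swap ys xs (λ y x′ → δ x y * δ x′ y)) ⟩
      ∑ xs (λ x → ∑ xs (λ x′ → ∑ ys (λ y → δ x y * δ x′ y))) ∎
    both-hit : ∀ x x′ → ∑ ys (λ y → δ x y * δ x′ y) ≤ 𝟙 (f x ≟ᴮ f x′)
    both-hit x x′ with f x ≟ᴮ f x′
    ... | yes _ = ≤-trans (∑-mono ys (λ y _ → ≤-trans (*-monoʳ-≤ (δ x y) (𝟙≤1 (f x′ ≟ᴮ y))) (≤-reflexive (*-identityʳ _))))
                          (∑𝟙≟≤1 _≟ᴮ_ ys (f x) uniq)
      where
      𝟙≤1 : ∀ {P : Set} (P? : Dec P) → 𝟙 P? ≤ 1
      𝟙≤1 (yes _) = ≤-refl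
      𝟙≤1 (no  _) = z≤n
    ... | no fx≢fx′ = ≤-reflexive (trans (∑-cong ys (λ y _ → vanish y)) (trans (∑-const ys 0) (*-zeroʳ (length ys))))
      where
      vanish : ∀ y → δ x y * δ x′ y ≡ 0
      vanish y with f x ≟ᴮ y | f x′ ≟ᴮ y
      ... | yes refl | yes eq = contradiction (sym eq) fx≢fx′
      ... | yes _    | no _   = refl
      ... | no _     | _      = refl

  -- Quadruples on two crossing blocks, with the blocks left abstract

  -- The quadruples with a, b in one block, c, d in another, and a common point x
  -- of the two blocks, where the positions in the first block satisfy b = a + x + k.
  -- Since any two of a, b, x determine the third, this keeps one k-th of all such
  -- quadruples and makes every triple of vertices leave only k choices for the fourth.
  module CrossingBlocks
    {n : ℕ} {L : Set} (_≟ᴸ_ : DecidableEquality L) (Bs : List L) (Bs-unique : Unique Bs)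
    (p : L → ℕ → Fin n) (k : ℕ)
    (p-injective : ∀ {B s t} → B ∈ Bs → s < 4 * k → t < 4 * k → p B s ≡ p B t → s ≡ t)
    (two-points : ∀ {B B′ s t s′ t′} → B ∈ Bs → B′ ∈ Bs → s < 4 * k → t < 4 * k → s′ < 4 * k → t′ < 4 * k →
                  s ≢ t → p B s ≡ p B′ s′ → p B t ≡ p B′ t′ → B ≡ B′)
    (r : ℕ) (label : L → Fin n → ℕ)
    (label<r : ∀ {B s} → B ∈ Bs → s < 4 * k → label B (p B s) < r)
    (label-injective : ∀ {B B′ s s′} → B ∈ Bs → B′ ∈ Bs → s < 4 * k → s′ < 4 * k → p B s ≡ p B′ s′ →
                       label B (p B s) ≡ label B′ (p B′ s′) → B ≡ B′)
    where

    E : Set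
    E = ((L × ℕ) × (L × ℕ)) × (ℕ × (ℕ × ℕ))

    middles : List (L × ℕ)
    middles = cartesianProduct Bs (upTo k)

    middle : L × ℕ → Fin n
    middle (B , l) = p B (k + l)

    crossing? : ∀ (h : (L × ℕ) × (L × ℕ)) →
                Dec (middle (proj₁ h) ≡ middle (proj₂ h) × proj₁ (proj₁ h) ≢ proj₁ (proj₂ h))
    crossing? ((B₁ , l) , (B₂ , l′)) = (p B₁ (k + l) Fin.≟ p B₂ (k + l′)) ×-dec ¬? (B₁ ≟ᴸ B₂)

    crossings : List ((L × ℕ) × (L × ℕ))
    crossings = filter crossing? (cartesianProduct middles middles)

    triples : List (ℕ × (ℕ × ℕ))
    triples = cartesianProduct (upTo k) (cartesianProduct (upTo k) (upTo k))

    I : List E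
    I = cartesianProduct crossings triples

    middles-unique : Unique middles
    middles-unique = Unique.cartesianProduct⁺ Bs-unique (Unique.upTo⁺ k)

    I-unique : Unique I
    I-unique = Unique.cartesianProduct⁺
      (Unique.filter⁺ crossing? (Unique.cartesianProduct⁺ middles-unique middles-unique))
      (Unique.cartesianProduct⁺ (Unique.upTo⁺ k) (Unique.cartesianProduct⁺ (Unique.upTo⁺ k) (Unique.upTo⁺ k)))

    B₁ B₂ : E → L
    B₁ (((B , _) , _) , _) = B
    B₂ ((_ , (B , _)) , _) = B

    l l′ i j j′ : E → ℕ
    l  (((_ , l) , _) , _)   = l
    l′ ((_ , (_ , l′)) , _)  = l′
    i  (_ , (i , _))         = i
    j  (_ , (_ , (j , _)))   = j
    j′ (_ , (_ , (_ , j′)))  = j′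

    -- The positions of a and c lie in [0, k), those of x and x′ in [k, 2k), those of b and d in
    -- [2k, 4k). The ranges are disjoint, so points of one block are distinct without further
    -- conditions. Since i + l < 2k, the relation b = a + x + k never leaves the 4k available
    -- positions.
    a b x c d x′ : E → ℕ
    a e  = i e
    b e  = 2 * k + (i e + l e)
    x e  = k + l e
    c e  = j e
    d e  = 2 * k + j′ e
    x′ e = k + l′ e

    v : Fin 4 → E → Fin n
    v 0F e = p (B₁ e) (a e)
    v 1F e = p (B₁ e) (b e)
    v 2F e = p (B₂ e) (c e)
    v 3F e = p (B₂ e) (d e)

    record Valid (e : E) : Set where
      field
        B₁∈   : B₁ e ∈ Bs
        B₂∈   : B₂ e ∈ Bs
        B₁≢B₂ : B₁ e ≢ B₂ e
        meet  : p (B₁ e) (x e) ≡ p (B₂ e) (x′ e)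
        i<k   : i e < k
        l<k   : l e < k
        l′<k  : l′ e < k
        j<k   : j e < k
        j′<k  : j′ e < k

      2k<4k : ∀ {s} → s < 2 * k → 2 * k + s < 4 * k
      2k<4k s< = <-≤-trans (+-monoʳ-< (2 * k) s<) (≤-reflexive (sym (*-distribʳ-+ k 2 2)))

      k≤4k : k ≤ 4 * k
      k≤4k = m≤m+n k _

      k+k≤4k : k + k ≤ 4 * k
      k+k≤4k = +-monoʳ-≤ k (m≤m+n k _)

      a<4k : a e < 4 * k
      a<4k = <-≤-trans i<k k≤4k
      c<4k : c e < 4 * k
      c<4k = <-≤-trans j<k k≤4k
      x<4k : x e < 4 * k
      x<4k = <-≤-trans (+-monoʳ-< k l<k) k+k≤4k
      x′<4k : x′ e < 4 * k
      x′<4k = <-≤-trans (+-monoʳ-< k l′<k) k+k≤4k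
      b<4k : b e < 4 * k
      b<4k = 2k<4k (<-≤-trans (+-mono-< i<k l<k) (≤-reflexive (cong (k +_) (sym (+-identityʳ k)))))
      d<4k : d e < 4 * k
      d<4k = 2k<4k (<-≤-trans j′<k (m≤m+n k _))

      k+l<2k : ∀ {m} → m < k → k + m < 2 * k
      k+l<2k m<k = <-≤-trans (+-monoʳ-< k m<k) (≤-reflexive (cong (k +_) (sym (+-identityʳ k))))

      a≢b : a e ≢ b e
      a≢b = <⇒≢ (<-≤-trans i<k (≤-trans (m≤m+n k _) (m≤m+n (2 * k) _)))
      a≢x : a e ≢ x e
      a≢x = <⇒≢ (<-≤-trans i<k (m≤m+n k _))
      x≢b : x e ≢ b e
      x≢b = <⇒≢ (<-≤-trans (k+l<2k l<k) (m≤m+n (2 * k) _))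
      c≢d : c e ≢ d e
      c≢d = <⇒≢ (<-≤-trans j<k (≤-trans (m≤m+n k _) (m≤m+n (2 * k) _)))
      c≢x′ : c e ≢ x′ e
      c≢x′ = <⇒≢ (<-≤-trans j<k (m≤m+n k _))
      x′≢d : x′ e ≢ d e
      x′≢d = <⇒≢ (<-≤-trans (k+l<2k l′<k) (m≤m+n (2 * k) _))

    open Valid

    ∈I⇒Valid : ∀ {e} → e ∈ I → Valid e
    ∈I⇒Valid {e} e∈ =
      let (h∈ , t∈) = ∈-cartesianProduct crossings triples e∈
          (h∈′ , (eq , neq)) = ∈-filter⁻ crossing? {xs = cartesianProduct middles middles} h∈
          (m∈ , m′∈) = ∈-cartesianProduct middles middles h∈′
          (B∈ , l∈) = ∈-cartesianProduct Bs (upTo k) m∈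
          (B′∈ , l′∈) = ∈-cartesianProduct Bs (upTo k) m′∈
          (i∈ , js∈) = ∈-cartesianProduct (upTo k) (cartesianProduct (upTo k) (upTo k)) t∈
          (j∈ , j′∈) = ∈-cartesianProduct (upTo k) (upTo k) js∈
      in record
        { B₁∈ = B∈ ; B₂∈ = B′∈ ; B₁≢B₂ = neq ; meet = eq
        ; i<k = ∈-upTo⁻ i∈ ; l<k = ∈-upTo⁻ l∈ ; l′<k = ∈-upTo⁻ l′∈ ; j<k = ∈-upTo⁻ j∈ ; j′<k = ∈-upTo⁻ j′∈ }

    module _ {e e′ : E} (V : Valid e) (V′ : Valid e′) where

      -- A parameter consists of two halves glued at the common point. Each injectivity proof
      -- recovers one half first, carries the common point over by `x≡-Same₂` or `x′≡-Same₁`, and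
      -- then recovers the other half from it.
      Same₁ Same₂ : Set
      Same₁ = B₁ e ≡ B₁ e′ × i e ≡ i e′ × l e ≡ l e′
      Same₂ = B₂ e ≡ B₂ e′ × l′ e ≡ l′ e′ × j e ≡ j e′ × j′ e ≡ j′ e′

      same : Same₁ → Same₂ → e ≡ e′
      same (refl , refl , refl) (refl , refl , refl , refl) = refl

      position : ∀ {B B′ s s′} → B ≡ B′ → B ∈ Bs → s < 4 * k → s′ < 4 * k → p B s ≡ p B′ s′ → s ≡ s′
      position refl B∈ s< s′< eq = p-injective B∈ s< s′< eq

      x≡ : Same₁ → p (B₁ e) (x e) ≡ p (B₁ e′) (x e′)
      x≡ (refl , _ , refl) = refl

      x′≡ : p (B₁ e) (x e) ≡ p (B₁ e′) (x e′) → p (B₂ e) (x′ e) ≡ p (B₂ e′) (x′ e′)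
      x′≡ eq = trans (sym (meet V)) (trans eq (meet V′))

      x≡′ : p (B₂ e) (x′ e) ≡ p (B₂ e′) (x′ e′) → p (B₁ e) (x e) ≡ p (B₁ e′) (x e′)
      x≡′ eq = trans (meet V) (trans eq (sym (meet V′)))

      x′≡-B₂ : B₂ e ≡ B₂ e′ → l′ e ≡ l′ e′ → p (B₂ e) (x′ e) ≡ p (B₂ e′) (x′ e′)
      x′≡-B₂ refl refl = refl

      i-from-a : B₁ e ≡ B₁ e′ → v 0F e ≡ v 0F e′ → i e ≡ i e′
      i-from-a B≡ eq = position B≡ (B₁∈ V) (a<4k V) (a<4k V′) eq

      i+l-from-b : B₁ e ≡ B₁ e′ → v 1F e ≡ v 1F e′ → i e + l e ≡ i e′ + l e′
      i+l-from-b B≡ eq = +-cancelˡ-≡ (2 * k) _ _ (position B≡ (B₁∈ V) (b<4k V) (b<4k V′) eq)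

      l-from-x : B₁ e ≡ B₁ e′ → p (B₁ e) (x e) ≡ p (B₁ e′) (x e′) → l e ≡ l e′
      l-from-x B≡ eq = +-cancelˡ-≡ k _ _ (position B≡ (B₁∈ V) (x<4k V) (x<4k V′) eq)

      l′-from-x′ : B₂ e ≡ B₂ e′ → p (B₂ e) (x′ e) ≡ p (B₂ e′) (x′ e′) → l′ e ≡ l′ e′
      l′-from-x′ B≡ eq = +-cancelˡ-≡ k _ _ (position B≡ (B₂∈ V) (x′<4k V) (x′<4k V′) eq)

      j-from-c : B₂ e ≡ B₂ e′ → v 2F e ≡ v 2F e′ → j e ≡ j e′
      j-from-c B≡ eq = position B≡ (B₂∈ V) (c<4k V) (c<4k V′) eq

      j′-from-d : B₂ e ≡ B₂ e′ → v 3F e ≡ v 3F e′ → j′ e ≡ j′ e′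
      j′-from-d B≡ eq = +-cancelˡ-≡ (2 * k) _ _ (position B≡ (B₂∈ V) (d<4k V) (d<4k V′) eq)

      l-from-i : i e + l e ≡ i e′ + l e′ → i e ≡ i e′ → l e ≡ l e′
      l-from-i eq i≡ = +-cancelˡ-≡ (i e) _ _ (trans eq (cong (_+ l e′) (sym i≡)))

      i-from-l : i e + l e ≡ i e′ + l e′ → l e ≡ l e′ → i e ≡ i e′
      i-from-l eq l≡ = +-cancelʳ-≡ (l e) _ _ (trans eq (cong (i e′ +_) (sym l≡)))

      -- The suffix of this and the following names tells which points are known. Two known points
      -- of a block determine it by `two-points`; one known point does so only together with its
      -- label, which costs a factor r.
      same₁-ab : v 0F e ≡ v 0F e′ → v 1F e ≡ v 1F e′ → Same₁
      same₁-ab a≡ b≡ = B≡ , i-from-a B≡ a≡ , l-from-i (i+l-from-b B≡ b≡) (i-from-a B≡ a≡)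
        where B≡ = two-points (B₁∈ V) (B₁∈ V′) (a<4k V) (b<4k V) (a<4k V′) (b<4k V′) (a≢b V) a≡ b≡

      same₁-a : v 0F e ≡ v 0F e′ → label (B₁ e) (v 0F e) ≡ label (B₁ e′) (v 0F e′) → l e ≡ l e′ → Same₁
      same₁-a a≡ lab≡ l≡ = B≡ , i-from-a B≡ a≡ , l≡
        where B≡ = label-injective (B₁∈ V) (B₁∈ V′) (a<4k V) (a<4k V′) a≡ lab≡

      same₁-b : v 1F e ≡ v 1F e′ → label (B₁ e) (v 1F e) ≡ label (B₁ e′) (v 1F e′) → l e ≡ l e′ → Same₁
      same₁-b b≡ lab≡ l≡ = B≡ , i-from-l (i+l-from-b B≡ b≡) l≡ , l≡
        where B≡ = label-injective (B₁∈ V) (B₁∈ V′) (b<4k V) (b<4k V′) b≡ lab≡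

      same₁-x : p (B₁ e) (x e) ≡ p (B₁ e′) (x e′) →
                label (B₁ e) (p (B₁ e) (x e)) ≡ label (B₁ e′) (p (B₁ e′) (x e′)) → i e ≡ i e′ → Same₁
      same₁-x x≡ lab≡ i≡ = B≡ , i≡ , l-from-x B≡ x≡
        where B≡ = label-injective (B₁∈ V) (B₁∈ V′) (x<4k V) (x<4k V′) x≡ lab≡

      same₁-ax : v 0F e ≡ v 0F e′ → p (B₁ e) (x e) ≡ p (B₁ e′) (x e′) → Same₁
      same₁-ax a≡ x≡ = B≡ , i-from-a B≡ a≡ , l-from-x B≡ x≡
        where B≡ = two-points (B₁∈ V) (B₁∈ V′) (a<4k V) (x<4k V) (a<4k V′) (x<4k V′) (a≢x V) a≡ x≡

      same₁-bx : v 1F e ≡ v 1F e′ → p (B₁ e) (x e) ≡ p (B₁ e′) (x e′) → Same₁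
      same₁-bx b≡ x≡ = B≡ , i-from-l (i+l-from-b B≡ b≡) (l-from-x B≡ x≡) , l-from-x B≡ x≡
        where B≡ = two-points (B₁∈ V) (B₁∈ V′) (x<4k V) (b<4k V) (x<4k V′) (b<4k V′) (x≢b V) x≡ b≡

      same₂-x : p (B₂ e) (x′ e) ≡ p (B₂ e′) (x′ e′) →
                label (B₂ e) (p (B₂ e) (x′ e)) ≡ label (B₂ e′) (p (B₂ e′) (x′ e′)) →
                j e ≡ j e′ → j′ e ≡ j′ e′ → Same₂
      same₂-x x≡ lab≡ j≡ j′≡ = B≡ , l′-from-x′ B≡ x≡ , j≡ , j′≡
        where B≡ = label-injective (B₂∈ V) (B₂∈ V′) (x′<4k V) (x′<4k V′) x≡ lab≡

      same₂-xc : p (B₂ e) (x′ e) ≡ p (B₂ e′) (x′ e′) → v 2F e ≡ v 2F e′ → j′ e ≡ j′ e′ → Same₂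
      same₂-xc x≡ c≡ j′≡ = B≡ , l′-from-x′ B≡ x≡ , j-from-c B≡ c≡ , j′≡
        where B≡ = two-points (B₂∈ V) (B₂∈ V′) (c<4k V) (x′<4k V) (c<4k V′) (x′<4k V′) (c≢x′ V) c≡ x≡

      same₂-xd : p (B₂ e) (x′ e) ≡ p (B₂ e′) (x′ e′) → v 3F e ≡ v 3F e′ → j e ≡ j e′ → Same₂
      same₂-xd x≡ d≡ j≡ = B≡ , l′-from-x′ B≡ x≡ , j≡ , j′-from-d B≡ d≡
        where B≡ = two-points (B₂∈ V) (B₂∈ V′) (x′<4k V) (d<4k V) (x′<4k V′) (d<4k V′) (x′≢d V) x≡ d≡

      same₂-cd : v 2F e ≡ v 2F e′ → v 3F e ≡ v 3F e′ → l′ e ≡ l′ e′ → Same₂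
      same₂-cd c≡ d≡ l′≡ = B≡ , l′≡ , j-from-c B≡ c≡ , j′-from-d B≡ d≡
        where B≡ = two-points (B₂∈ V) (B₂∈ V′) (c<4k V) (d<4k V) (c<4k V′) (d<4k V′) (c≢d V) c≡ d≡

      same₂-c : v 2F e ≡ v 2F e′ → label (B₂ e) (v 2F e) ≡ label (B₂ e′) (v 2F e′) →
                l′ e ≡ l′ e′ → j′ e ≡ j′ e′ → Same₂
      same₂-c c≡ lab≡ l′≡ j′≡ = B≡ , l′≡ , j-from-c B≡ c≡ , j′≡
        where B≡ = label-injective (B₂∈ V) (B₂∈ V′) (c<4k V) (c<4k V′) c≡ lab≡

      same₂-d : v 3F e ≡ v 3F e′ → label (B₂ e) (v 3F e) ≡ label (B₂ e′) (v 3F e′) →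
                l′ e ≡ l′ e′ → j e ≡ j e′ → Same₂
      same₂-d d≡ lab≡ l′≡ j≡ = B≡ , l′≡ , j≡ , j′-from-d B≡ d≡
        where B≡ = label-injective (B₂∈ V) (B₂∈ V′) (d<4k V) (d<4k V′) d≡ lab≡

      x≡-Same₂ : Same₂ → p (B₁ e) (x e) ≡ p (B₁ e′) (x e′)
      x≡-Same₂ (B≡ , l′≡ , _) = x≡′ (x′≡-B₂ B≡ l′≡)

      x′≡-Same₁ : Same₁ → p (B₂ e) (x′ e) ≡ p (B₂ e′) (x′ e′)
      x′≡-Same₁ s = x′≡ (x≡ s)

      v-injective-Valid : (∀ m → v m e ≡ v m e′) → e ≡ e′
      v-injective-Valid v≡ = same s₁ (same₂-cd (v≡ 2F) (v≡ 3F) l′≡)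
        where
        s₁ = same₁-ab (v≡ 0F) (v≡ 1F)
        B≡ = two-points (B₂∈ V) (B₂∈ V′) (c<4k V) (d<4k V) (c<4k V′) (d<4k V′) (c≢d V) (v≡ 2F) (v≡ 3F)
        l′≡ = l′-from-x′ B≡ (x′≡-Same₁ s₁)

    v-injective : ∀ {e e′} → e ∈ I → e′ ∈ I → (∀ m → v m e ≡ v m e′) → e ≡ e′
    v-injective e∈ e′∈ = v-injective-Valid (∈I⇒Valid e∈) (∈I⇒Valid e′∈)

    v-distinct : ∀ {e} → e ∈ I → ∀ {m m′} → v m e ≡ v m′ e → m ≡ m′
    v-distinct {e} e∈ = distinct
      where
      V : Valid e
      V = ∈I⇒Valid e∈
      -- A vertex common to both blocks would be a second common point besides x, and the blocks
      -- would coincide.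
      cross : ∀ {s t} → s < 4 * k → t < 4 * k → s ≢ x e → p (B₁ e) s ≢ p (B₂ e) t
      cross s< t< s≢x eq = B₁≢B₂ V (two-points (B₁∈ V) (B₂∈ V) s< (x<4k V) t< (x′<4k V) s≢x eq (meet V))
      distinct : ∀ {m m′} → v m e ≡ v m′ e → m ≡ m′
      distinct {0F} {0F} _  = refl
      distinct {0F} {1F} eq = contradiction (p-injective (B₁∈ V) (a<4k V) (b<4k V) eq) (a≢b V)
      distinct {0F} {2F} eq = contradiction eq (cross (a<4k V) (c<4k V) (a≢x V))
      distinct {0F} {3F} eq = contradiction eq (cross (a<4k V) (d<4k V) (a≢x V))
      distinct {1F} {0F} eq = contradiction (p-injective (B₁∈ V) (a<4k V) (b<4k V) (sym eq)) (a≢b V)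
      distinct {1F} {1F} _  = refl
      distinct {1F} {2F} eq = contradiction eq (cross (b<4k V) (c<4k V) (x≢b V ∘ sym))
      distinct {1F} {3F} eq = contradiction eq (cross (b<4k V) (d<4k V) (x≢b V ∘ sym))
      distinct {2F} {0F} eq = contradiction (sym eq) (cross (a<4k V) (c<4k V) (a≢x V))
      distinct {2F} {1F} eq = contradiction (sym eq) (cross (b<4k V) (c<4k V) (x≢b V ∘ sym))
      distinct {2F} {2F} _  = refl
      distinct {2F} {3F} eq = contradiction (p-injective (B₂∈ V) (c<4k V) (d<4k V) eq) (c≢d V)
      distinct {3F} {0F} eq = contradiction (sym eq) (cross (a<4k V) (d<4k V) (a≢x V))
      distinct {3F} {1F} eq = contradiction (sym eq) (cross (b<4k V) (d<4k V) (x≢b V ∘ sym))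
      distinct {3F} {2F} eq = contradiction (p-injective (B₂∈ V) (c<4k V) (d<4k V) (sym eq)) (c≢d V)
      distinct {3F} {3F} _  = refl

    open Hypergraph v I I-unique v-injective v-distinct public

    private
      pattern-box : ∀ (ls : List ((E → ℕ) × ℕ)) (X : List (Fin 4)) →
                    All (λ (g , m) → ∀ {e} → Valid e → g e < m) ls →
                    (∀ {e e′} → Valid e → Valid e′ → All (λ m → v m e ≡ v m e′) X →
                     All (λ (g , _) → g e ≡ g e′) ls → e ≡ e′) →
                    ∀ {e₀} → e₀ ∈ I → AtMost (product (map proj₂ ls)) (Agree e₀ X)
      pattern-box ls X bounds inj {e₀} _ = AtMost-box ls
        (All.map (λ h e (e∈ , _) → h (∈I⇒Valid e∈)) bounds)
        (λ e e′ (e∈ , eqs) (e′∈ , eqs′) → inj (∈I⇒Valid e∈) (∈I⇒Valid e′∈)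
          (All.zipWith (λ (eq , eq′) → trans eq (sym eq′)) (eqs , eqs′)))

      on-l on-l′ on-i on-j on-j′ : (E → ℕ) × ℕ
      on-l  = l , k
      on-l′ = l′ , k
      on-i  = i , k
      on-j  = j , k
      on-j′ = j′ , k

      on-a on-b on-x on-c on-d on-x′ : (E → ℕ) × ℕ
      on-a  = (λ e → label (B₁ e) (v 0F e)) , r
      on-b  = (λ e → label (B₁ e) (v 1F e)) , r
      on-x  = (λ e → label (B₁ e) (p (B₁ e) (x e))) , r
      on-c  = (λ e → label (B₂ e) (v 2F e)) , r
      on-d  = (λ e → label (B₂ e) (v 3F e)) , r
      on-x′ = (λ e → label (B₂ e) (p (B₂ e) (x′ e))) , r

      on-a< : ∀ {e} → Valid e → proj₁ on-a e < r
      on-a< V = label<r (B₁∈ V) (a<4k V)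
      on-b< : ∀ {e} → Valid e → proj₁ on-b e < r
      on-b< V = label<r (B₁∈ V) (b<4k V)
      on-x< : ∀ {e} → Valid e → proj₁ on-x e < r
      on-x< V = label<r (B₁∈ V) (x<4k V)
      on-c< : ∀ {e} → Valid e → proj₁ on-c e < r
      on-c< V = label<r (B₂∈ V) (c<4k V)
      on-d< : ∀ {e} → Valid e → proj₁ on-d e < r
      on-d< V = label<r (B₂∈ V) (d<4k V)
      on-x′< : ∀ {e} → Valid e → proj₁ on-x′ e < r
      on-x′< V = label<r (B₂∈ V) (x′<4k V)

    -- The order of the factors and the final `* 1` are those of the products in `pattern-box`, so
    -- that the two agree by computation.
    D : ℕ → ℕ
    D 1 = r * (k * (r * (k * (k * 1))))
    D 2 = r * (k * (k * 1))
    D _ = k * 1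

    -- Typical choices: given a, pick its block (r), x on it (k), the second block through x (r),
    -- then c and d (k each). Given a and b, the point x is known, and the second block, c and d
    -- remain. Given a and c, pick the block of a and x on it; the second block joins x to c. Given
    -- a, b and c, only d remains. Given c, d and a, pick x on the block of c and d; the first block
    -- joins a to x, and b is forced by the relation between the positions.
    patterns : ∀ i → 1 ≤ i → i ≤ 3 →
               All (λ X → ∀ {e₀} → e₀ ∈ I → AtMost (D i) (Agree e₀ X)) (choose i positions)
    patterns 1 _ _ =
      pattern-box (on-a ∷ on-l ∷ on-x′ ∷ on-j ∷ on-j′ ∷ []) (0F ∷ [])
        (on-a< ∷ l<k ∷ on-x′< ∷ j<k ∷ j′<k ∷ [])
        (λ { V V′ (a≡ ∷ []) (la ∷ l≡ ∷ lx ∷ j≡ ∷ j′≡ ∷ []) → let s = same₁-a V V′ a≡ la l≡ in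
             same V V′ s (same₂-x V V′ (x′≡-Same₁ V V′ s) lx j≡ j′≡) }) ∷
      pattern-box (on-b ∷ on-l ∷ on-x′ ∷ on-j ∷ on-j′ ∷ []) (1F ∷ [])
        (on-b< ∷ l<k ∷ on-x′< ∷ j<k ∷ j′<k ∷ [])
        (λ { V V′ (b≡ ∷ []) (lb ∷ l≡ ∷ lx ∷ j≡ ∷ j′≡ ∷ []) → let s = same₁-b V V′ b≡ lb l≡ in
             same V V′ s (same₂-x V V′ (x′≡-Same₁ V V′ s) lx j≡ j′≡) }) ∷
      pattern-box (on-c ∷ on-l′ ∷ on-x ∷ on-i ∷ on-j′ ∷ []) (2F ∷ [])
        (on-c< ∷ l′<k ∷ on-x< ∷ i<k ∷ j′<k ∷ [])
        (λ { V V′ (c≡ ∷ []) (lc ∷ l′≡ ∷ lx ∷ i≡ ∷ j′≡ ∷ []) → let s = same₂-c V V′ c≡ lc l′≡ j′≡ in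
             same V V′ (same₁-x V V′ (x≡-Same₂ V V′ s) lx i≡) s }) ∷
      pattern-box (on-d ∷ on-l′ ∷ on-x ∷ on-i ∷ on-j ∷ []) (3F ∷ [])
        (on-d< ∷ l′<k ∷ on-x< ∷ i<k ∷ j<k ∷ [])
        (λ { V V′ (d≡ ∷ []) (ld ∷ l′≡ ∷ lx ∷ i≡ ∷ j≡ ∷ []) → let s = same₂-d V V′ d≡ ld l′≡ j≡ in
             same V V′ (same₁-x V V′ (x≡-Same₂ V V′ s) lx i≡) s }) ∷ []
    patterns 2 _ _ =
      pattern-box (on-x′ ∷ on-j ∷ on-j′ ∷ []) (0F ∷ 1F ∷ []) (on-x′< ∷ j<k ∷ j′<k ∷ [])
        (λ { V V′ (a≡ ∷ b≡ ∷ []) (lx ∷ j≡ ∷ j′≡ ∷ []) → let s = same₁-ab V V′ a≡ b≡ in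
             same V V′ s (same₂-x V V′ (x′≡-Same₁ V V′ s) lx j≡ j′≡) }) ∷
      pattern-box (on-a ∷ on-l ∷ on-j′ ∷ []) (0F ∷ 2F ∷ []) (on-a< ∷ l<k ∷ j′<k ∷ [])
        (λ { V V′ (a≡ ∷ c≡ ∷ []) (la ∷ l≡ ∷ j′≡ ∷ []) → let s = same₁-a V V′ a≡ la l≡ in
             same V V′ s (same₂-xc V V′ (x′≡-Same₁ V V′ s) c≡ j′≡) }) ∷
      pattern-box (on-a ∷ on-l ∷ on-j ∷ []) (0F ∷ 3F ∷ []) (on-a< ∷ l<k ∷ j<k ∷ [])
        (λ { V V′ (a≡ ∷ d≡ ∷ []) (la ∷ l≡ ∷ j≡ ∷ []) → let s = same₁-a V V′ a≡ la l≡ in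
             same V V′ s (same₂-xd V V′ (x′≡-Same₁ V V′ s) d≡ j≡) }) ∷
      pattern-box (on-b ∷ on-l ∷ on-j′ ∷ []) (1F ∷ 2F ∷ []) (on-b< ∷ l<k ∷ j′<k ∷ [])
        (λ { V V′ (b≡ ∷ c≡ ∷ []) (lb ∷ l≡ ∷ j′≡ ∷ []) → let s = same₁-b V V′ b≡ lb l≡ in
             same V V′ s (same₂-xc V V′ (x′≡-Same₁ V V′ s) c≡ j′≡) }) ∷
      pattern-box (on-b ∷ on-l ∷ on-j ∷ []) (1F ∷ 3F ∷ []) (on-b< ∷ l<k ∷ j<k ∷ [])
        (λ { V V′ (b≡ ∷ d≡ ∷ []) (lb ∷ l≡ ∷ j≡ ∷ []) → let s = same₁-b V V′ b≡ lb l≡ in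
             same V V′ s (same₂-xd V V′ (x′≡-Same₁ V V′ s) d≡ j≡) }) ∷
      pattern-box (on-x ∷ on-l′ ∷ on-i ∷ []) (2F ∷ 3F ∷ []) (on-x< ∷ l′<k ∷ i<k ∷ [])
        (λ { V V′ (c≡ ∷ d≡ ∷ []) (lx ∷ l′≡ ∷ i≡ ∷ []) → let s = same₂-cd V V′ c≡ d≡ l′≡ in
             same V V′ (same₁-x V V′ (x≡-Same₂ V V′ s) lx i≡) s }) ∷ []
    patterns 3 _ _ =
      pattern-box (on-j′ ∷ []) (0F ∷ 1F ∷ 2F ∷ []) (j′<k ∷ [])
        (λ { V V′ (a≡ ∷ b≡ ∷ c≡ ∷ []) (j′≡ ∷ []) → let s = same₁-ab V V′ a≡ b≡ in
             same V V′ s (same₂-xc V V′ (x′≡-Same₁ V V′ s) c≡ j′≡) }) ∷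
      pattern-box (on-j ∷ []) (0F ∷ 1F ∷ 3F ∷ []) (j<k ∷ [])
        (λ { V V′ (a≡ ∷ b≡ ∷ d≡ ∷ []) (j≡ ∷ []) → let s = same₁-ab V V′ a≡ b≡ in
             same V V′ s (same₂-xd V V′ (x′≡-Same₁ V V′ s) d≡ j≡) }) ∷
      pattern-box (on-l′ ∷ []) (0F ∷ 2F ∷ 3F ∷ []) (l′<k ∷ [])
        (λ { V V′ (a≡ ∷ c≡ ∷ d≡ ∷ []) (l′≡ ∷ []) → let s = same₂-cd V V′ c≡ d≡ l′≡ in
             same V V′ (same₁-ax V V′ a≡ (x≡-Same₂ V V′ s)) s }) ∷
      pattern-box (on-l′ ∷ []) (1F ∷ 2F ∷ 3F ∷ []) (l′<k ∷ [])
        (λ { V V′ (b≡ ∷ c≡ ∷ d≡ ∷ []) (l′≡ ∷ []) → let s = same₂-cd V V′ c≡ d≡ l′≡ in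
             same V V′ (same₁-bx V V′ b≡ (x≡-Same₂ V V′ s)) s }) ∷ []
    patterns (suc (suc (suc (suc _)))) _ (s≤s (s≤s (s≤s ())))

    length-middles : length middles ≡ length Bs * k
    length-middles = trans (length-cartesianProduct Bs (upTo k)) (cong (length Bs *_) (length-upTo k))

    length-I : length I ≡ length crossings * (k * (k * k))
    length-I = trans (length-cartesianProduct crossings triples) (cong (length crossings *_)
      (trans (length-cartesianProduct (upTo k) (cartesianProduct (upTo k) (upTo k)))
        (cong₂ _*_ (length-upTo k) (trans (length-cartesianProduct (upTo k) (upTo k))
          (cong₂ _*_ (length-upTo k) (length-upTo k))))))

    -- By `collisions` many pairs of middles share their point. Such a pair either lies on two
    -- different blocks, and is a crossing, or lies on one block and is then diagonal, which
    -- accounts for the added `length middles`.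
    crossings-bound : ∀ (pts : List (Fin n)) → Unique pts →
                      (∀ {B s} → B ∈ Bs → s < 4 * k → p B s ∈ pts) →
                      length middles * length middles ≤ length pts * (length crossings + length middles)
    crossings-bound pts pts-unique p∈ = begin
      length middles * length middles
        ≤⟨ collisions Fin._≟_ middle middles pts pts-unique middle∈ ⟩
      length pts * ∑ middles (λ f → ∑ middles (λ f′ → 𝟙 (middle f Fin.≟ middle f′)))
        ≡⟨ cong (length pts *_) (sym (trans (count≡∑ meet? pairs) (∑-× middles middles _))) ⟩
      length pts * count meet? pairs
        ≤⟨ *-monoʳ-≤ (length pts) split ⟩
      length pts * (length crossings + length middles) ∎
      where
      open ≤-Reasoning
      pairs = cartesianProduct middles middles
      _≟ᶠ_ : DecidableEquality (L × ℕ)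
      _≟ᶠ_ = ×-≡-dec _≟ᴸ_ _≟_
      meet? : ∀ (h : (L × ℕ) × (L × ℕ)) → Dec (middle (proj₁ h) ≡ middle (proj₂ h))
      meet? h = middle (proj₁ h) Fin.≟ middle (proj₂ h)
      equal? : ∀ (h : (L × ℕ) × (L × ℕ)) → Dec (proj₁ h ≡ proj₂ h)
      equal? h = proj₁ h ≟ᶠ proj₂ h
      k+<4k : ∀ {m} → m < k → k + m < 4 * k
      k+<4k m<k = <-≤-trans (+-monoʳ-< k m<k) (+-monoʳ-≤ k (m≤m+n k _))
      middle∈ : ∀ {f} → f ∈ middles → middle f ∈ pts
      middle∈ f∈ = let (B∈ , l∈) = ∈-cartesianProduct Bs (upTo k) f∈ in p∈ B∈ (k+<4k (∈-upTo⁻ l∈))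
      split : count meet? pairs ≤ length crossings + length middles
      split = ≤-trans (count-mono meet? (λ h → crossing? h ⊎-dec equal? h) pairs cases)
        (≤-trans (count-⊎ crossing? equal? pairs)
          (+-monoʳ-≤ (length crossings)
            (AtMost⇒count≤ equal? (Unique.cartesianProduct⁺ middles-unique middles-unique)
              (AtMost-map proj₁ {Q = λ h → h ∈ pairs × proj₁ h ≡ proj₂ h}
                (λ { (_ , refl) (_ , refl) refl → refl })
                (λ (h∈ , _) → proj₁ (∈-cartesianProduct middles middles h∈))
                (λ fs uniq fs∈ → Rank.Unique-⊆⇒length≤ _≟ᶠ_ fs middles uniq (All.lookup fs∈))))))
        where
        cases : ∀ h → h ∈ pairs → middle (proj₁ h) ≡ middle (proj₂ h) →
                (middle (proj₁ h) ≡ middle (proj₂ h) × proj₁ (proj₁ h) ≢ proj₁ (proj₂ h)) ⊎ proj₁ h ≡ proj₂ h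
        cases ((B , m) , (B′ , m′)) h∈ eq with B ≟ᴸ B′
        ... | no B≢B′ = inj₁ (eq , B≢B′)
        ... | yes refl = let (f∈ , f′∈) = ∈-cartesianProduct middles middles h∈
                             (B∈ , m∈) = ∈-cartesianProduct Bs (upTo k) f∈
                             (_ , m′∈) = ∈-cartesianProduct Bs (upTo k) f′∈ in
          inj₂ (cong (B ,_) (+-cancelˡ-≡ k _ _
            (p-injective B∈ (k+<4k (∈-upTo⁻ m∈)) (k+<4k (∈-upTo⁻ m′∈)) eq)))

  -- Quadruples in general position, with the planes left abstract

  -- The blocks are planes, each with M chosen points p B 0, …, p B (M − 1).
  module GeneralPosition
    {n : ℕ} {L : Set} (Bs : List L) (Bs-unique : Unique Bs)
    (p : L → ℕ → Fin n) (M : ℕ)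
    (p-injective : ∀ {B s t} → B ∈ Bs → s < M → t < M → p B s ≡ p B t → s ≡ t)
    {Col : Fin n → Fin n → Fin n → Set} (Col? : ∀ x y z → Dec (Col x y z))
    (plane-unique : ∀ {B B′ s t u s′ t′ u′} → B ∈ Bs → B′ ∈ Bs →
                    s < M → t < M → u < M → s′ < M → t′ < M → u′ < M →
                    ¬ Col (p B s) (p B t) (p B u) →
                    p B s ≡ p B′ s′ → p B t ≡ p B′ t′ → p B u ≡ p B′ u′ → B ≡ B′)
    (q : ℕ) (label₁ label₂ : L → ℕ) (label₁<q : ∀ B → label₁ B < q) (label₂<q : ∀ B → label₂ B < q)
    (label-injective : ∀ {B B′ s s′} → B ∈ Bs → B′ ∈ Bs → s < M → s′ < M → p B s ≡ p B′ s′ →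
                       label₁ B ≡ label₁ B′ → label₂ B ≡ label₂ B′ → B ≡ B′)
    (pencil : Fin n → Fin n → L → ℕ) (pencil<q : ∀ x y B → pencil x y B < q)
    (pencil-injective : ∀ {B B′ s t s′ t′} → B ∈ Bs → B′ ∈ Bs → s < M → t < M → s′ < M → t′ < M → s ≢ t →
                        p B s ≡ p B′ s′ → p B t ≡ p B′ t′ →
                        pencil (p B s) (p B t) B ≡ pencil (p B′ s′) (p B′ t′) B′ → B ≡ B′)
    where

    E : Set
    E = L × ((ℕ × ℕ) × (ℕ × ℕ))

    B : E → L
    B = proj₁

    s : Fin 4 → E → ℕ
    s 0F (_ , ((s₀ , _) , _)) = s₀
    s 1F (_ , ((_ , s₁) , _)) = s₁
    s 2F (_ , (_ , (s₂ , _))) = s₂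
    s 3F (_ , (_ , (_ , s₃))) = s₃

    v : Fin 4 → E → Fin n
    v m e = p (B e) (s m e)

    -- There is one predicate for each newly chosen point, because `length-I≥` counts the choices
    -- one after another.
    Excluded₁ : ℕ → ℕ → Set
    Excluded₁ s₀ s₁ = s₁ ≡ s₀

    Excluded₂ : L → ℕ → ℕ → ℕ → Set
    Excluded₂ B s₀ s₁ s₂ = s₂ ≡ s₀ ⊎ (s₂ ≡ s₁ ⊎ Col (p B s₀) (p B s₁) (p B s₂))

    Excluded₃ : L → ℕ → ℕ → ℕ → ℕ → Set
    Excluded₃ B s₀ s₁ s₂ s₃ =
      (s₃ ≡ s₀ ⊎ (s₃ ≡ s₁ ⊎ s₃ ≡ s₂)) ⊎
      (Col (p B s₀) (p B s₁) (p B s₃) ⊎ (Col (p B s₀) (p B s₂) (p B s₃) ⊎ Col (p B s₁) (p B s₂) (p B s₃)))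

    excluded₁? : ∀ s₀ s₁ → Dec (Excluded₁ s₀ s₁)
    excluded₁? s₀ s₁ = s₁ ≟ s₀

    excluded₂? : ∀ B s₀ s₁ s₂ → Dec (Excluded₂ B s₀ s₁ s₂)
    excluded₂? B s₀ s₁ s₂ = (s₂ ≟ s₀) ⊎-dec ((s₂ ≟ s₁) ⊎-dec Col? (p B s₀) (p B s₁) (p B s₂))

    excluded₃? : ∀ B s₀ s₁ s₂ s₃ → Dec (Excluded₃ B s₀ s₁ s₂ s₃)
    excluded₃? B s₀ s₁ s₂ s₃ =
      ((s₃ ≟ s₀) ⊎-dec ((s₃ ≟ s₁) ⊎-dec (s₃ ≟ s₂))) ⊎-dec
      (Col? (p B s₀) (p B s₁) (p B s₃) ⊎-dec (Col? (p B s₀) (p B s₂) (p B s₃) ⊎-dec Col? (p B s₁) (p B s₂) (p B s₃)))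

    Admissible : E → Set
    Admissible (B , ((s₀ , s₁) , (s₂ , s₃))) =
      ¬ Excluded₁ s₀ s₁ × (¬ Excluded₂ B s₀ s₁ s₂ × ¬ Excluded₃ B s₀ s₁ s₂ s₃)

    admissible? : ∀ e → Dec (Admissible e)
    admissible? (B , ((s₀ , s₁) , (s₂ , s₃))) =
      ¬? (excluded₁? s₀ s₁) ×-dec (¬? (excluded₂? B s₀ s₁ s₂) ×-dec ¬? (excluded₃? B s₀ s₁ s₂ s₃))

    pairs : List (ℕ × ℕ)
    pairs = cartesianProduct (upTo M) (upTo M)

    candidates : List E
    candidates = cartesianProduct Bs (cartesianProduct pairs pairs)

    I : List E
    I = filter admissible? candidates

    I-unique : Unique I
    I-unique = Unique.filter⁺ admissible? (Unique.cartesianProduct⁺ Bs-unique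
      (Unique.cartesianProduct⁺ pairs-unique pairs-unique))
      where pairs-unique = Unique.cartesianProduct⁺ (Unique.upTo⁺ M) (Unique.upTo⁺ M)

    record Valid (e : E) : Set where
      field
        B∈  : B e ∈ Bs
        s<M : ∀ m → s m e < M
        ok  : Admissible e

    open Valid

    ∈I⇒Valid : ∀ {e} → e ∈ I → Valid e
    ∈I⇒Valid {e} e∈ =
      let (e∈′ , ok) = ∈-filter⁻ admissible? {xs = candidates} e∈
          (B∈ , t∈) = ∈-cartesianProduct Bs (cartesianProduct pairs pairs) e∈′
          (p∈ , p∈′) = ∈-cartesianProduct pairs pairs t∈
          (s₀∈ , s₁∈) = ∈-cartesianProduct (upTo M) (upTo M) p∈
          (s₂∈ , s₃∈) = ∈-cartesianProduct (upTo M) (upTo M) p∈′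
      in record
        { B∈ = B∈ ; ok = ok
        ; s<M = λ { 0F → ∈-upTo⁻ s₀∈ ; 1F → ∈-upTo⁻ s₁∈ ; 2F → ∈-upTo⁻ s₂∈ ; 3F → ∈-upTo⁻ s₃∈ } }

    s-distinct : ∀ {e} → Valid e → ∀ {m m′} → s m e ≡ s m′ e → m ≡ m′
    s-distinct {e} V = distinct
      where
      ok₁ = proj₁ (ok V)
      ok₂ = proj₁ (proj₂ (ok V))
      ok₃ = proj₂ (proj₂ (ok V))
      distinct : ∀ {m m′} → s m e ≡ s m′ e → m ≡ m′
      distinct {0F} {0F} _  = refl
      distinct {0F} {1F} eq = contradiction (sym eq) ok₁
      distinct {0F} {2F} eq = contradiction (inj₁ (sym eq)) ok₂
      distinct {0F} {3F} eq = contradiction (inj₁ (inj₁ (sym eq))) ok₃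
      distinct {1F} {0F} eq = contradiction eq ok₁
      distinct {1F} {1F} _  = refl
      distinct {1F} {2F} eq = contradiction (inj₂ (inj₁ (sym eq))) ok₂
      distinct {1F} {3F} eq = contradiction (inj₁ (inj₂ (inj₁ (sym eq)))) ok₃
      distinct {2F} {0F} eq = contradiction (inj₁ eq) ok₂
      distinct {2F} {1F} eq = contradiction (inj₂ (inj₁ eq)) ok₂
      distinct {2F} {2F} _  = refl
      distinct {2F} {3F} eq = contradiction (inj₁ (inj₂ (inj₂ (sym eq)))) ok₃
      distinct {3F} {0F} eq = contradiction (inj₁ (inj₁ eq)) ok₃
      distinct {3F} {1F} eq = contradiction (inj₁ (inj₂ (inj₁ eq))) ok₃
      distinct {3F} {2F} eq = contradiction (inj₁ (inj₂ (inj₂ eq))) ok₃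
      distinct {3F} {3F} _  = refl

    v-distinct : ∀ {e} → e ∈ I → ∀ {m m′} → v m e ≡ v m′ e → m ≡ m′
    v-distinct e∈ {m} {m′} eq = s-distinct V {m} {m′} (p-injective (B∈ V) (s<M V m) (s<M V m′) eq)
      where V = ∈I⇒Valid e∈

    ¬Col-012 : ∀ {e} → Valid e → ¬ Col (v 0F e) (v 1F e) (v 2F e)
    ¬Col-012 V col = proj₁ (proj₂ (ok V)) (inj₂ (inj₂ col))
    ¬Col-013 : ∀ {e} → Valid e → ¬ Col (v 0F e) (v 1F e) (v 3F e)
    ¬Col-013 V col = proj₂ (proj₂ (ok V)) (inj₂ (inj₁ col))
    ¬Col-023 : ∀ {e} → Valid e → ¬ Col (v 0F e) (v 2F e) (v 3F e)
    ¬Col-023 V col = proj₂ (proj₂ (ok V)) (inj₂ (inj₂ (inj₁ col)))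
    ¬Col-123 : ∀ {e} → Valid e → ¬ Col (v 1F e) (v 2F e) (v 3F e)
    ¬Col-123 V col = proj₂ (proj₂ (ok V)) (inj₂ (inj₂ (inj₂ col)))

    module _ {e e′ : E} (V : Valid e) (V′ : Valid e′) where

      same-block : ∀ m₀ m₁ m₂ → ¬ Col (v m₀ e) (v m₁ e) (v m₂ e) →
                   v m₀ e ≡ v m₀ e′ → v m₁ e ≡ v m₁ e′ → v m₂ e ≡ v m₂ e′ → B e ≡ B e′
      same-block m₀ m₁ m₂ = plane-unique (B∈ V) (B∈ V′)
        (s<M V m₀) (s<M V m₁) (s<M V m₂) (s<M V′ m₀) (s<M V′ m₁) (s<M V′ m₂)

      same : B e ≡ B e′ → (∀ m → v m e ≡ v m e′ ⊎ s m e ≡ s m e′) → e ≡ e′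
      same B≡ h = assemble B≡ (s≡ 0F) (s≡ 1F) (s≡ 2F) (s≡ 3F)
        where
        position : ∀ {B B′ t u} → B ≡ B′ → B ∈ Bs → t < M → u < M → p B t ≡ p B′ u → t ≡ u
        position refl = p-injective
        s≡ : ∀ m → s m e ≡ s m e′
        s≡ m with h m
        ... | inj₁ eq = position B≡ (B∈ V) (s<M V m) (s<M V′ m) eq
        ... | inj₂ eq = eq
        assemble : B e ≡ B e′ → s 0F e ≡ s 0F e′ → s 1F e ≡ s 1F e′ → s 2F e ≡ s 2F e′ → s 3F e ≡ s 3F e′ → e ≡ e′
        assemble refl refl refl refl refl = refl

      same-labels : ∀ m → v m e ≡ v m e′ → label₁ (B e) ≡ label₁ (B e′) → label₂ (B e) ≡ label₂ (B e′) → B e ≡ B e′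
      same-labels m = label-injective (B∈ V) (B∈ V′) (s<M V m) (s<M V′ m)

      same-pencil : ∀ m m′ → m ≢ m′ → v m e ≡ v m e′ → v m′ e ≡ v m′ e′ →
                    pencil (v m e) (v m′ e) (B e) ≡ pencil (v m e′) (v m′ e′) (B e′) → B e ≡ B e′
      same-pencil m m′ m≢m′ = pencil-injective (B∈ V) (B∈ V′) (s<M V m) (s<M V m′) (s<M V′ m) (s<M V′ m′)
        (λ eq → m≢m′ (s-distinct V eq))

    v-injective : ∀ {e e′} → e ∈ I → e′ ∈ I → (∀ m → v m e ≡ v m e′) → e ≡ e′
    v-injective e∈ e′∈ v≡ = same V V′ (same-block V V′ 0F 1F 2F (¬Col-012 V) (v≡ 0F) (v≡ 1F) (v≡ 2F)) (λ m → inj₁ (v≡ m))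
      where
      V = ∈I⇒Valid e∈
      V′ = ∈I⇒Valid e′∈

    open Hypergraph v I I-unique v-injective v-distinct public

    private
      pattern-box : ∀ (ls : List ((E → ℕ) × ℕ)) (X : List (Fin 4)) →
                    All (λ (g , m) → ∀ {e} → Valid e → g e < m) ls →
                    (∀ {e e′} → Valid e → Valid e′ → All (λ m → v m e ≡ v m e′) X →
                     All (λ (g , _) → g e ≡ g e′) ls → e ≡ e′) →
                    ∀ {e₀} → e₀ ∈ I → AtMost (product (map proj₂ ls)) (Agree e₀ X)
      pattern-box ls X bounds inj {e₀} _ = AtMost-box ls
        (All.map (λ h e (e∈ , _) → h (∈I⇒Valid e∈)) bounds)
        (λ e e′ (e∈ , eqs) (e′∈ , eqs′) → inj (∈I⇒Valid e∈) (∈I⇒Valid e′∈)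
          (All.zipWith (λ (eq , eq′) → trans eq (sym eq′)) (eqs , eqs′)))

      at : Fin 4 → (E → ℕ) × ℕ
      at m = s m , M

      at< : ∀ m {e} → Valid e → s m e < M
      at< m V = s<M V m

      on₁ on₂ : (E → ℕ) × ℕ
      on₁ = (λ e → label₁ (B e)) , q
      on₂ = (λ e → label₂ (B e)) , q

      on₁< : ∀ {e} → Valid e → proj₁ on₁ e < q
      on₁< {e} _ = label₁<q (B e)
      on₂< : ∀ {e} → Valid e → proj₁ on₂ e < q
      on₂< {e} _ = label₂<q (B e)

      on-pencil : Fin 4 → Fin 4 → (E → ℕ) × ℕ
      on-pencil m m′ = (λ e → pencil (v m e) (v m′ e) (B e)) , q

      on-pencil< : ∀ m m′ {e} → Valid e → proj₁ (on-pencil m m′) e < q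
      on-pencil< m m′ {e} _ = pencil<q (v m e) (v m′ e) (B e)

      -- `cases` says that the listed positions exhaust all four, as an elimination principle; this
      -- lets a single proof serve every order of the positions.
      one : ∀ m m₁ m₂ m₃ → (∀ {P : Fin 4 → Set} → P m → P m₁ → P m₂ → P m₃ → ∀ i → P i) →
            ∀ {e₀} → e₀ ∈ I → AtMost (q * (q * (M * (M * (M * 1))))) (Agree e₀ (m ∷ []))
      one m m₁ m₂ m₃ cases = pattern-box (on₁ ∷ on₂ ∷ at m₁ ∷ at m₂ ∷ at m₃ ∷ []) (m ∷ [])
        (on₁< ∷ on₂< ∷ at< m₁ ∷ at< m₂ ∷ at< m₃ ∷ [])
        (λ { {e} {e′} V V′ (v≡ ∷ []) (l₁ ∷ l₂ ∷ h₁ ∷ h₂ ∷ h₃ ∷ []) →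
             same V V′ (same-labels V V′ m v≡ l₁ l₂)
               (cases {λ i → v i e ≡ v i e′ ⊎ s i e ≡ s i e′} (inj₁ v≡) (inj₂ h₁) (inj₂ h₂) (inj₂ h₃)) })

      two : ∀ m m′ m₂ m₃ → m ≢ m′ → (∀ {P : Fin 4 → Set} → P m → P m′ → P m₂ → P m₃ → ∀ i → P i) →
            ∀ {e₀} → e₀ ∈ I → AtMost (q * (M * (M * 1))) (Agree e₀ (m ∷ m′ ∷ []))
      two m m′ m₂ m₃ m≢m′ cases = pattern-box (on-pencil m m′ ∷ at m₂ ∷ at m₃ ∷ []) (m ∷ m′ ∷ [])
        (on-pencil< m m′ ∷ at< m₂ ∷ at< m₃ ∷ [])
        (λ { {e} {e′} V V′ (v≡ ∷ v′≡ ∷ []) (l ∷ h₂ ∷ h₃ ∷ []) →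
             same V V′ (same-pencil V V′ m m′ m≢m′ v≡ v′≡ l)
               (cases {λ i → v i e ≡ v i e′ ⊎ s i e ≡ s i e′} (inj₁ v≡) (inj₁ v′≡) (inj₂ h₂) (inj₂ h₃)) })

      three : ∀ m₀ m₁ m₂ m → (∀ {e} → Valid e → ¬ Col (v m₀ e) (v m₁ e) (v m₂ e)) →
              (∀ {P : Fin 4 → Set} → P m₀ → P m₁ → P m₂ → P m → ∀ i → P i) →
              ∀ {e₀} → e₀ ∈ I → AtMost (M * 1) (Agree e₀ (m₀ ∷ m₁ ∷ m₂ ∷ []))
      three m₀ m₁ m₂ m ¬col cases = pattern-box (at m ∷ []) (m₀ ∷ m₁ ∷ m₂ ∷ []) (at< m ∷ [])
        (λ { {e} {e′} V V′ (eq₀ ∷ eq₁ ∷ eq₂ ∷ []) (h ∷ []) →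
             same V V′ (same-block V V′ m₀ m₁ m₂ (¬col V) eq₀ eq₁ eq₂)
               (cases {λ i → v i e ≡ v i e′ ⊎ s i e ≡ s i e′} (inj₁ eq₀) (inj₁ eq₁) (inj₁ eq₂) (inj₂ h)) })

    D : ℕ → ℕ
    D 1 = q * (q * (M * (M * (M * 1))))
    D 2 = q * (M * (M * 1))
    D _ = M * 1

    patterns : ∀ i → 1 ≤ i → i ≤ 3 →
               All (λ X → ∀ {e₀} → e₀ ∈ I → AtMost (D i) (Agree e₀ X)) (choose i positions)
    patterns 1 _ _ =
      one 0F 1F 2F 3F (λ { a b c d 0F → a ; a b c d 1F → b ; a b c d 2F → c ; a b c d 3F → d }) ∷
      one 1F 0F 2F 3F (λ { a b c d 1F → a ; a b c d 0F → b ; a b c d 2F → c ; a b c d 3F → d }) ∷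
      one 2F 0F 1F 3F (λ { a b c d 2F → a ; a b c d 0F → b ; a b c d 1F → c ; a b c d 3F → d }) ∷
      one 3F 0F 1F 2F (λ { a b c d 3F → a ; a b c d 0F → b ; a b c d 1F → c ; a b c d 2F → d }) ∷ []
    patterns 2 _ _ =
      two 0F 1F 2F 3F (λ ()) (λ { a b c d 0F → a ; a b c d 1F → b ; a b c d 2F → c ; a b c d 3F → d }) ∷
      two 0F 2F 1F 3F (λ ()) (λ { a b c d 0F → a ; a b c d 2F → b ; a b c d 1F → c ; a b c d 3F → d }) ∷
      two 0F 3F 1F 2F (λ ()) (λ { a b c d 0F → a ; a b c d 3F → b ; a b c d 1F → c ; a b c d 2F → d }) ∷
      two 1F 2F 0F 3F (λ ()) (λ { a b c d 1F → a ; a b c d 2F → b ; a b c d 0F → c ; a b c d 3F → d }) ∷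
      two 1F 3F 0F 2F (λ ()) (λ { a b c d 1F → a ; a b c d 3F → b ; a b c d 0F → c ; a b c d 2F → d }) ∷
      two 2F 3F 0F 1F (λ ()) (λ { a b c d 2F → a ; a b c d 3F → b ; a b c d 0F → c ; a b c d 1F → d }) ∷ []
    patterns 3 _ _ =
      three 0F 1F 2F 3F ¬Col-012 (λ { a b c d 0F → a ; a b c d 1F → b ; a b c d 2F → c ; a b c d 3F → d }) ∷
      three 0F 1F 3F 2F ¬Col-013 (λ { a b c d 0F → a ; a b c d 1F → b ; a b c d 3F → c ; a b c d 2F → d }) ∷
      three 0F 2F 3F 1F ¬Col-023 (λ { a b c d 0F → a ; a b c d 2F → b ; a b c d 3F → c ; a b c d 1F → d }) ∷
      three 1F 2F 3F 0F ¬Col-123 (λ { a b c d 1F → a ; a b c d 2F → b ; a b c d 3F → c ; a b c d 0F → d }) ∷ []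
    patterns (suc (suc (suc (suc _)))) _ (s≤s (s≤s (s≤s ())))

    -- Greedy choice. The last point has to avoid three earlier positions and three lines through
    -- earlier points, each with at most g positions; at least h remain, and no fewer at the earlier
    -- steps. The first point is free, hence the factor M.
    length-I≥ : ∀ {g h} → 3 + 3 * g + h ≤ M →
                (∀ {B s t} → B ∈ Bs → s < M → t < M → s ≢ t → count (λ u → Col? (p B s) (p B t) (p B u)) (upTo M) ≤ g) →
                length Bs * (M * (h * (h * h))) ≤ length I
    length-I≥ {g} {h} room few = begin
      length Bs * (M * (h * (h * h)))
        ≡⟨ ∑-const Bs _ ⟨
      ∑ Bs (λ B → M * (h * (h * h)))
        ≤⟨ ∑-mono Bs (λ B B∈ → ≤-trans (≤-reflexive (sym (trans (∑-const (upTo M) _) (cong (_* (h * (h * h))) (length-upTo M)))))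
             (∑-mono (upTo M) (λ s₀ s₀∈ → level₁ B∈ (∈-upTo⁻ s₀∈)))) ⟩
      ∑ Bs (λ B → ∑ (upTo M) (λ s₀ → ∑ (upTo M) (λ s₁ → ∑ (upTo M) (λ s₂ → ∑ (upTo M) (λ s₃ →
        𝟙 (admissible? (B , ((s₀ , s₁) , (s₂ , s₃)))))))))
        ≡⟨ ∑-cong Bs (λ B _ → unfold B) ⟨
      ∑ Bs (λ B → ∑ (cartesianProduct pairs pairs) (λ t → 𝟙 (admissible? (B , t))))
        ≡⟨ ∑-× Bs (cartesianProduct pairs pairs) _ ⟨
      ∑ candidates (λ e → 𝟙 (admissible? e))
        ≡⟨ count≡∑ admissible? candidates ⟨
      length I ∎
      where
      open ≤-Reasoning
      unfold : ∀ B → ∑ (cartesianProduct pairs pairs) (λ t → 𝟙 (admissible? (B , t))) ≡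
               ∑ (upTo M) (λ s₀ → ∑ (upTo M) (λ s₁ → ∑ (upTo M) (λ s₂ → ∑ (upTo M) (λ s₃ →
                 𝟙 (admissible? (B , ((s₀ , s₁) , (s₂ , s₃))))))))
      unfold B = trans (∑-× pairs pairs _) (trans (∑-× (upTo M) (upTo M) _)
        (∑-cong (upTo M) (λ s₀ _ → ∑-cong (upTo M) (λ s₁ _ → ∑-× (upTo M) (upTo M) _))))

      survivors : ∀ {P : Pred ℕ 0ℓ} (P? : Decidable P) → count P? (upTo M) ≤ 3 + 3 * g →
                  h ≤ count (λ u → ¬? (P? u)) (upTo M)
      survivors P? bad≤ = +-cancelˡ-≤ (3 + 3 * g) _ _ (begin
        3 + 3 * g + h                                        ≤⟨ room ⟩
        M                                                    ≡⟨ length-upTo M ⟨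
        length (upTo M)                                      ≤⟨ length≤count+count P? (λ u → ¬? (P? u)) (upTo M) (λ _ _ ¬p → ¬p) ⟩
        count P? (upTo M) + count (λ u → ¬? (P? u)) (upTo M) ≤⟨ +-monoˡ-≤ _ bad≤ ⟩
        3 + 3 * g + count (λ u → ¬? (P? u)) (upTo M)         ∎)

      equal≤1 : ∀ t → count (λ u → u ≟ t) (upTo M) ≤ 1
      equal≤1 t = AtMost⇒count≤ (λ u → u ≟ t) (Unique.upTo⁺ M) (AtMost-one (λ { x y (_ , eq) (_ , eq′) → trans eq (sym eq′) }))

      level₃ : ∀ {B s₀ s₁ s₂} → B ∈ Bs → s₀ < M → s₁ < M → s₂ < M → ¬ Excluded₁ s₀ s₁ → ¬ Excluded₂ B s₀ s₁ s₂ →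
               h ≤ ∑ (upTo M) (λ s₃ → 𝟙 (admissible? (B , ((s₀ , s₁) , (s₂ , s₃)))))
      level₃ {B} {s₀} {s₁} {s₂} B∈ s₀< s₁< s₂< ok₁ ok₂ = begin
        h
          ≤⟨ survivors (excluded₃? B s₀ s₁ s₂) bad ⟩
        count (λ u → ¬? (excluded₃? B s₀ s₁ s₂ u)) (upTo M)
          ≡⟨ *-identityʳ _ ⟨
        count (λ u → ¬? (excluded₃? B s₀ s₁ s₂ u)) (upTo M) * 1
          ≤⟨ count-*≤∑ (λ u → ¬? (excluded₃? B s₀ s₁ s₂ u)) (upTo M) _ 1
               (λ s₃ _ ok₃ → ≤-reflexive (sym (𝟙-yes (admissible? (B , ((s₀ , s₁) , (s₂ , s₃)))) (ok₁ , ok₂ , ok₃)))) ⟩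
        ∑ (upTo M) (λ s₃ → 𝟙 (admissible? (B , ((s₀ , s₁) , (s₂ , s₃))))) ∎
        where
        union : ∀ {P Q : Pred ℕ 0ℓ} (P? : Decidable P) (Q? : Decidable Q) {m m′} →
                count P? (upTo M) ≤ m → count Q? (upTo M) ≤ m′ → count (λ x → P? x ⊎-dec Q? x) (upTo M) ≤ m + m′
        union P? Q? h h′ = ≤-trans (count-⊎ P? Q? (upTo M)) (+-mono-≤ h h′)
        bad : count (excluded₃? B s₀ s₁ s₂) (upTo M) ≤ 3 + 3 * g
        bad = subst (count (excluded₃? B s₀ s₁ s₂) (upTo M) ≤_) (cong (λ z → 3 + (g + (g + z))) (sym (+-identityʳ g)))
          (union _ _ (union _ _ (equal≤1 s₀) (union _ _ (equal≤1 s₁) (equal≤1 s₂)))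
            (union _ _ (few B∈ s₀< s₁< (ok₁ ∘ sym)) (union _ _ (few B∈ s₀< s₂< (ok₂ ∘ inj₁ ∘ sym))
              (few B∈ s₁< s₂< (ok₂ ∘ inj₂ ∘ inj₁ ∘ sym)))))

      level₂ : ∀ {B s₀ s₁} → B ∈ Bs → s₀ < M → s₁ < M → ¬ Excluded₁ s₀ s₁ →
               h * h ≤ ∑ (upTo M) (λ s₂ → ∑ (upTo M) (λ s₃ → 𝟙 (admissible? (B , ((s₀ , s₁) , (s₂ , s₃))))))
      level₂ {B} {s₀} {s₁} B∈ s₀< s₁< ok₁ = ≤-trans (*-monoˡ-≤ h (survivors (excluded₂? B s₀ s₁) bad))
        (count-*≤∑ (λ u → ¬? (excluded₂? B s₀ s₁ u)) (upTo M) _ h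
          (λ s₂ s₂∈ ok₂ → level₃ B∈ s₀< s₁< (∈-upTo⁻ s₂∈) ok₁ ok₂))
        where
        bad : count (excluded₂? B s₀ s₁) (upTo M) ≤ 3 + 3 * g
        bad = ≤-trans (count-⊎ (_≟ s₀) _ (upTo M)) (+-mono-≤ (equal≤1 s₀)
          (≤-trans (count-⊎ (_≟ s₁) _ (upTo M)) (+-mono-≤ (equal≤1 s₁)
            (≤-trans (few B∈ s₀< s₁< (ok₁ ∘ sym)) (≤-trans (m≤m+n g _) (n≤1+n _))))))

      level₁ : ∀ {B s₀} → B ∈ Bs → s₀ < M →
               h * (h * h) ≤ ∑ (upTo M) (λ s₁ → ∑ (upTo M) (λ s₂ → ∑ (upTo M) (λ s₃ →
                 𝟙 (admissible? (B , ((s₀ , s₁) , (s₂ , s₃)))))))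
      level₁ {B} {s₀} B∈ s₀< = ≤-trans (*-monoˡ-≤ (h * h) (survivors (excluded₁? s₀) (≤-trans (equal≤1 s₀) (s≤s z≤n))))
        (count-*≤∑ (λ u → ¬? (excluded₁? s₀ u)) (upTo M) _ (h * h)
          (λ s₁ s₁∈ ok₁ → level₂ B∈ s₀< (∈-upTo⁻ s₁∈) ok₁))

  -- Planes and lines of F³

  module Geometry {q : ℕ} (F : FiniteField q) where

    open FiniteField F
    private
      module H = HeytingField heytingField
      module K = CommutativeRing commutativeRing
    open K using (Carrier; _≈_; 0#; 1#; -_; setoid)
      renaming (_+_ to _⊕_; _*_ to _⊛_; refl to ≈-refl; sym to ≈-sym; trans to ≈-trans)
    open Inverse enumeration using (to; from; to-cong; from-cong; strictlyInverseˡ; strictlyInverseʳ)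
    open AffineSpace F 3
    open RingSolver K.commutativeSemiring using (solve; _:=_; _:+_; _:*_; con)
    open SetoidReasoning setoid
    private module G = GroupProperties K.+-group

    infix 4 _≈?_
    _≈?_ : ∀ s t → Dec (s ≈ t)
    s ≈? t with to s Fin.≟ to t
    ... | yes eq = yes (≈-trans (≈-sym (strictlyInverseʳ s)) (≈-trans (from-cong eq) (strictlyInverseʳ t)))
    ... | no neq = no (neq ∘ to-cong)

    from-injective : ∀ {i j} → from i ≈ from j → i ≡ j
    from-injective eq = trans (sym (strictlyInverseˡ _)) (trans (to-cong eq) (strictlyInverseˡ _))

    -- Since the field is finite, an inverse can be searched for. If there is none then s is not
    -- apart from 0, and tightness gives s ≈ 0. Invertibility is stated for the difference s - 0,
    -- which has to be rewritten to s.
    zero-or-invertible : ∀ s → s ≈ 0# ⊎ (∃[ u ] u ⊛ s ≈ 1#)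
    zero-or-invertible s with Fin.any? (λ i → (from i ⊛ s) ≈? 1#)
    ... | yes (i , eq) = inj₂ (from i , eq)
    ... | no none = inj₁ (proj₁ (H.tight s 0#) (λ s#0 → let (u , eq , _) = H.#⇒invertible s#0 in
      none (to u , ≈-trans (K.*-cong (strictlyInverseʳ u) (≈-trans (≈-sym (K.+-identityʳ s))
        (K.+-congˡ (≈-sym G.ε⁻¹≈ε)))) eq)))

    -- The solver works over the commutative semiring, so a difference enters it as one opaque
    -- variable d, after s has been replaced by t + d.
    shift : ∀ s t → s ≈ t ⊕ (s ⊕ - t)
    shift s t = ≈-sym (≈-trans (K.+-comm t (s ⊕ - t)) (G.//-rightDividesˡ t s))

    -- Subtracting the two equations leaves α d ≈ α′ d with d = s - t invertible. Uniqueness of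
    -- lines and the labelling of planes below all reduce to this.
    affine-unique : ∀ {s t α γ α′ γ′} → ¬ s ≈ t → α ⊛ s ⊕ γ ≈ α′ ⊛ s ⊕ γ′ → α ⊛ t ⊕ γ ≈ α′ ⊛ t ⊕ γ′ →
                    α ≈ α′ × γ ≈ γ′
    affine-unique {s} {t} {α} {γ} {α′} {γ′} s≉t eqs eqt = α≈α′ , G.∙-cancelˡ (α′ ⊛ s) γ γ′
      (≈-trans (K.+-congʳ (K.*-congʳ (≈-sym α≈α′))) eqs)
      where
      d = s ⊕ - t
      s≈t+d = shift s t
      αd≈α′d : α ⊛ d ≈ α′ ⊛ d
      αd≈α′d = G.∙-cancelʳ (α ⊛ t ⊕ γ) _ _ (begin
        α ⊛ d ⊕ (α ⊛ t ⊕ γ)     ≈⟨ solve 4 (λ α d t γ → α :* d :+ (α :* t :+ γ) := α :* (t :+ d) :+ γ) ≈-refl α d t γ ⟩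
        α ⊛ (t ⊕ d) ⊕ γ         ≈⟨ K.+-congʳ (K.*-congˡ s≈t+d) ⟨
        α ⊛ s ⊕ γ               ≈⟨ eqs ⟩
        α′ ⊛ s ⊕ γ′             ≈⟨ K.+-congʳ (K.*-congˡ s≈t+d) ⟩
        α′ ⊛ (t ⊕ d) ⊕ γ′       ≈⟨ solve 4 (λ α d t γ → α :* (t :+ d) :+ γ := α :* d :+ (α :* t :+ γ)) ≈-refl α′ d t γ′ ⟩
        α′ ⊛ d ⊕ (α′ ⊛ t ⊕ γ′)  ≈⟨ K.+-congˡ eqt ⟨
        α′ ⊛ d ⊕ (α ⊛ t ⊕ γ)    ∎)
      α≈α′ : α ≈ α′
      α≈α′ with zero-or-invertible d
      ... | inj₁ d≈0 = contradiction (≈-trans s≈t+d (≈-trans (K.+-congˡ d≈0) (K.+-identityʳ t))) s≉t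
      ... | inj₂ (u , ud≈1) = begin
        α              ≈⟨ K.*-identityʳ α ⟨
        α ⊛ 1#         ≈⟨ K.*-congˡ ud≈1 ⟨
        α ⊛ (u ⊛ d)    ≈⟨ solve 3 (λ α u d → α :* (u :* d) := α :* d :* u) ≈-refl α u d ⟩
        α ⊛ d ⊛ u      ≈⟨ K.*-congʳ αd≈α′d ⟩
        α′ ⊛ d ⊛ u     ≈⟨ solve 3 (λ α u d → α :* d :* u := α :* (u :* d)) ≈-refl α′ u d ⟩
        α′ ⊛ (u ⊛ d)   ≈⟨ K.*-congˡ ud≈1 ⟩
        α′ ⊛ 1#        ≈⟨ K.*-identityʳ α′ ⟩
        α′             ∎

    X Y Z : Fin (q ^ 3) → Carrier
    X a = point a 0F
    Y a = point a 1F
    Z a = point a 2F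

    coordinates-injective : ∀ {a b} → X a ≈ X b → Y a ≈ Y b → Z a ≈ Z b → a ≡ b
    coordinates-injective {a} {b} x≈ y≈ z≈ = point-injective a b (λ { 0F → x≈ ; 1F → y≈ ; 2F → z≈ })

    -- The plane z = α x + β y + γ. The vertical planes are not used.
    Plane : Set
    Plane = Fin q × (Fin q × Fin q)

    α β γ : Plane → Carrier
    α (i , _)       = from i
    β (_ , (j , _)) = from j
    γ (_ , (_ , l)) = from l

    infix 4 _∈ᴾ_ _∈ᴸ_ _∈ᴾ?_ _∈ᴸ?_

    _∈ᴾ_ : Fin (q ^ 3) → Plane → Set
    a ∈ᴾ π = Z a ≈ α π ⊛ X a ⊕ β π ⊛ Y a ⊕ γ π

    _∈ᴾ?_ : ∀ a π → Dec (a ∈ᴾ π)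
    a ∈ᴾ? π = Z a ≈? _

    plane-≡ : ∀ {π π′} → α π ≈ α π′ → β π ≈ β π′ → γ π ≈ γ π′ → π ≡ π′
    plane-≡ α≈ β≈ γ≈ = cong₂ _,_ (from-injective α≈) (cong₂ _,_ (from-injective β≈) (from-injective γ≈))

    -- The nonvertical lines: (y , z) = (m x + y₀ , n x + z₀), and x = x₀ with z = n y + z₀.
    Line : Set
    Line = (Fin q × Fin q) × (Fin q × Fin q) ⊎ Fin q × (Fin q × Fin q)

    _∈ᴸ_ : Fin (q ^ 3) → Line → Set
    a ∈ᴸ inj₁ ((m , y₀) , (n , z₀)) = Y a ≈ from m ⊛ X a ⊕ from y₀ × Z a ≈ from n ⊛ X a ⊕ from z₀
    a ∈ᴸ inj₂ (x₀ , (n , z₀))       = X a ≈ from x₀ × Z a ≈ from n ⊛ Y a ⊕ from z₀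

    _∈ᴸ?_ : ∀ a ℓ → Dec (a ∈ᴸ ℓ)
    a ∈ᴸ? inj₁ ((m , y₀) , (n , z₀)) = (Y a ≈? _) ×-dec (Z a ≈? _)
    a ∈ᴸ? inj₂ (x₀ , (n , z₀))       = (X a ≈? _) ×-dec (Z a ≈? _)

    _≟ᴸ_ : DecidableEquality Line
    _≟ᴸ_ = ⊎-≡-dec (×-≡-dec (×-≡-dec Fin._≟_ Fin._≟_) (×-≡-dec Fin._≟_ Fin._≟_)) (×-≡-dec Fin._≟_ (×-≡-dec Fin._≟_ Fin._≟_))

    X≉-inj₁ : ∀ {a b h} → a ≢ b → a ∈ᴸ inj₁ h → b ∈ᴸ inj₁ h → ¬ X a ≈ X b
    X≉-inj₁ a≢b (ya , za) (yb , zb) x≈ = a≢b (coordinates-injective x≈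
      (≈-trans ya (≈-trans (K.+-congʳ (K.*-congˡ x≈)) (≈-sym yb)))
      (≈-trans za (≈-trans (K.+-congʳ (K.*-congˡ x≈)) (≈-sym zb))))

    Y≉-inj₂ : ∀ {a b h} → a ≢ b → a ∈ᴸ inj₂ h → b ∈ᴸ inj₂ h → ¬ Y a ≈ Y b
    Y≉-inj₂ a≢b (xa , za) (xb , zb) y≈ = a≢b (coordinates-injective (≈-trans xa (≈-sym xb)) y≈
      (≈-trans za (≈-trans (K.+-congʳ (K.*-congˡ y≈)) (≈-sym zb))))

    line-unique : ∀ {a b} ℓ ℓ′ → a ≢ b → a ∈ᴸ ℓ → b ∈ᴸ ℓ → a ∈ᴸ ℓ′ → b ∈ᴸ ℓ′ → ℓ ≡ ℓ′
    line-unique (inj₁ h) (inj₁ h′) a≢b a∈@(ya , za) b∈@(yb , zb) (ya′ , za′) (yb′ , zb′) =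
      let x≉ = X≉-inj₁ a≢b a∈ b∈
          (m≈ , y≈) = affine-unique x≉ (≈-trans (≈-sym ya) ya′) (≈-trans (≈-sym yb) yb′)
          (n≈ , z≈) = affine-unique x≉ (≈-trans (≈-sym za) za′) (≈-trans (≈-sym zb) zb′)
      in cong inj₁ (cong₂ _,_ (cong₂ _,_ (from-injective m≈) (from-injective y≈))
                              (cong₂ _,_ (from-injective n≈) (from-injective z≈)))
    line-unique (inj₁ h) (inj₂ h′) a≢b a∈ b∈ (xa , _) (xb , _) =
      contradiction (≈-trans xa (≈-sym xb)) (X≉-inj₁ a≢b a∈ b∈)
    line-unique (inj₂ h) (inj₁ h′) a≢b (xa , _) (xb , _) a∈ b∈ =
      contradiction (≈-trans xa (≈-sym xb)) (X≉-inj₁ a≢b a∈ b∈)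
    line-unique (inj₂ h) (inj₂ h′) a≢b a∈@(xa , za) b∈@(xb , zb) (xa′ , za′) (xb′ , zb′) =
      let (n≈ , z≈) = affine-unique (Y≉-inj₂ a≢b a∈ b∈) (≈-trans (≈-sym za) za′) (≈-trans (≈-sym zb) zb′)
      in cong inj₂ (cong₂ _,_ (from-injective (≈-trans (≈-sym xa) xa′))
                              (cong₂ _,_ (from-injective n≈) (from-injective z≈)))

    -- Label of a plane through a and b. If their x-coordinates agree then the y-coordinates must
    -- differ, the points fix β and γ, and α is free; otherwise β is given and the points fix α and
    -- γ.
    pencil : Fin (q ^ 3) → Fin (q ^ 3) → Plane → ℕ
    pencil a b (i , (j , _)) with X a ≈? X b
    ... | yes _ = toℕ i
    ... | no  _ = toℕ j

    pencil<q : ∀ a b π → pencil a b π < q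
    pencil<q a b (i , (j , _)) with X a ≈? X b
    ... | yes _ = Fin.toℕ<n i
    ... | no  _ = Fin.toℕ<n j

    pencil-injective : ∀ {a b} π π′ → a ≢ b → a ∈ᴾ π → b ∈ᴾ π → a ∈ᴾ π′ → b ∈ᴾ π′ →
                       pencil a b π ≡ pencil a b π′ → π ≡ π′
    pencil-injective {a} {b} π@(i , (j , _)) π′@(i′ , (j′ , _)) a≢b a∈ b∈ a∈′ b∈′ eq with X a ≈? X b
    ... | yes x≈ with Fin.toℕ-injective eq
    ...   | refl = plane-≡ {π} {π′} ≈-refl (proj₁ same) (proj₂ same)
      where
      reduce : ∀ {c} → c ∈ᴾ π → c ∈ᴾ π′ → β π ⊛ Y c ⊕ γ π ≈ β π′ ⊛ Y c ⊕ γ π′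
      reduce {c} c∈ c∈′ = G.∙-cancelˡ (α π ⊛ X c) _ _
        (≈-trans (≈-sym (K.+-assoc _ _ _)) (≈-trans (≈-sym c∈) (≈-trans c∈′ (K.+-assoc _ _ _))))
      y≉ : ¬ Y a ≈ Y b
      y≉ y≈ = a≢b (coordinates-injective x≈ y≈
        (≈-trans a∈ (≈-trans (K.+-congʳ (K.+-cong (K.*-congˡ x≈) (K.*-congˡ y≈))) (≈-sym b∈))))
      same = affine-unique y≉ (reduce a∈ a∈′) (reduce b∈ b∈′)
    pencil-injective {a} {b} π@(i , (j , _)) π′@(i′ , (j′ , _)) a≢b a∈ b∈ a∈′ b∈′ eq | no x≉ with Fin.toℕ-injective eq
    ...   | refl = plane-≡ {π} {π′} (proj₁ same) ≈-refl (proj₂ same)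
      where
      reduce : ∀ {c} → c ∈ᴾ π → c ∈ᴾ π′ → α π ⊛ X c ⊕ γ π ≈ α π′ ⊛ X c ⊕ γ π′
      reduce {c} c∈ c∈′ = G.∙-cancelʳ (β π ⊛ Y c) _ _
        (≈-trans (swap (α π ⊛ X c) (γ π) (β π ⊛ Y c)) (≈-trans (≈-sym c∈)
          (≈-trans c∈′ (swap (α π′ ⊛ X c) (β π′ ⊛ Y c) (γ π′)))))
        where
        swap : ∀ r s t → r ⊕ s ⊕ t ≈ r ⊕ t ⊕ s
        swap = solve 3 (λ r s t → r :+ s :+ t := r :+ t :+ s) ≈-refl
      same = affine-unique x≉ (reduce a∈ a∈′) (reduce b∈ b∈′)

    slope-injective : ∀ {a} π π′ → a ∈ᴾ π → a ∈ᴾ π′ → toℕ (proj₁ π) ≡ toℕ (proj₁ π′) →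
                      toℕ (proj₁ (proj₂ π)) ≡ toℕ (proj₁ (proj₂ π′)) → π ≡ π′
    slope-injective π@(i , (j , _)) π′@(i′ , (j′ , _)) a∈ a∈′ eq eq′
      with Fin.toℕ-injective eq | Fin.toℕ-injective eq′
    ... | refl | refl = plane-≡ {π} {π′} ≈-refl ≈-refl (G.∙-cancelˡ _ _ _ (≈-trans (≈-sym a∈) a∈′))

    -- Label of a plane through a line. For the first kind of line, α + β m = n and β y₀ + γ = z₀
    -- leave β free; for the second, β = n and α x₀ + γ = z₀ leave α free.
    around : Line → Plane → ℕ
    around (inj₁ _) (_ , (j , _)) = toℕ j
    around (inj₂ _) (i , _)       = toℕ i

    around<q : ∀ ℓ π → around ℓ π < q
    around<q (inj₁ _) (_ , (j , _)) = Fin.toℕ<n j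
    around<q (inj₂ _) (i , _)       = Fin.toℕ<n i

    -- Two common points stand for containment: they are what the counting provides, and they
    -- already yield the equations between the coefficients.
    Contains : Plane → Line → Set
    Contains π ℓ = ∃[ a ] ∃[ b ] (a ≢ b × (a ∈ᴸ ℓ × b ∈ᴸ ℓ) × (a ∈ᴾ π × b ∈ᴾ π))

    around-injective : ∀ ℓ π π′ → Contains π ℓ → Contains π′ ℓ → around ℓ π ≡ around ℓ π′ → π ≡ π′
    around-injective (inj₁ ((m , y₀) , (n , z₀))) π@(i , (j , _)) π′@(i′ , (j′ , _)) c c′ eq with Fin.toℕ-injective eq
    ... | refl = plane-≡ {π} {π′}
        (G.∙-cancelʳ _ _ _ (≈-trans (proj₁ (coefficients π c)) (≈-sym (proj₁ (coefficients π′ c′)))))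
        ≈-refl
        (G.∙-cancelˡ _ _ _ (≈-trans (proj₂ (coefficients π c)) (≈-sym (proj₂ (coefficients π′ c′)))))
      where
      coefficients : ∀ π → Contains π (inj₁ ((m , y₀) , (n , z₀))) →
                     α π ⊕ β π ⊛ from m ≈ from n × β π ⊛ from y₀ ⊕ γ π ≈ from z₀
      coefficients π (a , b , a≢b , (a∈ , b∈) , (a∈′ , b∈′)) =
        affine-unique (X≉-inj₁ a≢b a∈ b∈) (at a∈ a∈′) (at b∈ b∈′)
        where
        at : ∀ {c} → c ∈ᴸ inj₁ ((m , y₀) , (n , z₀)) → c ∈ᴾ π →
             (α π ⊕ β π ⊛ from m) ⊛ X c ⊕ (β π ⊛ from y₀ ⊕ γ π) ≈ from n ⊛ X c ⊕ from z₀
        at {c} (y≈ , z≈) c∈ = begin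
          (α π ⊕ β π ⊛ from m) ⊛ X c ⊕ (β π ⊛ from y₀ ⊕ γ π)
            ≈⟨ solve 6 (λ α β m x y γ → (α :+ β :* m) :* x :+ (β :* y :+ γ) := α :* x :+ β :* (m :* x :+ y) :+ γ)
                 ≈-refl (α π) (β π) (from m) (X c) (from y₀) (γ π) ⟩
          α π ⊛ X c ⊕ β π ⊛ (from m ⊛ X c ⊕ from y₀) ⊕ γ π
            ≈⟨ K.+-congʳ (K.+-congˡ (K.*-congˡ y≈)) ⟨
          α π ⊛ X c ⊕ β π ⊛ Y c ⊕ γ π
            ≈⟨ c∈ ⟨
          Z c
            ≈⟨ z≈ ⟩
          from n ⊛ X c ⊕ from z₀ ∎
    around-injective (inj₂ (x₀ , (n , z₀))) π@(i , (j , _)) π′@(i′ , (j′ , _)) c c′ eq with Fin.toℕ-injective eq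
    ... | refl = plane-≡ {π} {π′}
        ≈-refl
        (≈-trans (proj₁ (coefficients π c)) (≈-sym (proj₁ (coefficients π′ c′))))
        (G.∙-cancelˡ _ _ _ (≈-trans (proj₂ (coefficients π c)) (≈-sym (proj₂ (coefficients π′ c′)))))
      where
      coefficients : ∀ π → Contains π (inj₂ (x₀ , (n , z₀))) → β π ≈ from n × α π ⊛ from x₀ ⊕ γ π ≈ from z₀
      coefficients π (a , b , a≢b , (a∈ , b∈) , (a∈′ , b∈′)) =
        affine-unique (Y≉-inj₂ a≢b a∈ b∈) (at a∈ a∈′) (at b∈ b∈′)
        where
        at : ∀ {c} → c ∈ᴸ inj₂ (x₀ , (n , z₀)) → c ∈ᴾ π →
             β π ⊛ Y c ⊕ (α π ⊛ from x₀ ⊕ γ π) ≈ from n ⊛ Y c ⊕ from z₀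
        at {c} (x≈ , z≈) c∈ = begin
          β π ⊛ Y c ⊕ (α π ⊛ from x₀ ⊕ γ π)
            ≈⟨ solve 5 (λ β y α x γ → β :* y :+ (α :* x :+ γ) := α :* x :+ β :* y :+ γ)
                 ≈-refl (β π) (Y c) (α π) (from x₀) (γ π) ⟩
          α π ⊛ from x₀ ⊕ β π ⊛ Y c ⊕ γ π
            ≈⟨ K.+-congʳ (K.+-congʳ (K.*-congˡ x≈)) ⟨
          α π ⊛ X c ⊕ β π ⊛ Y c ⊕ γ π
            ≈⟨ c∈ ⟨
          Z c
            ≈⟨ z≈ ⟩
          from n ⊛ Y c ⊕ from z₀ ∎

    -- If β ≈ β′, two common points with different x would make the planes equal, so x is constant
    -- and a₀ supplies its value. Otherwise β - β′ is invertible, and equating the two expressions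
    -- for z gives y as an affine function of x.
    planes-meet-in-line : ∀ π π′ → π ≢ π′ → ∀ {a₀} → a₀ ∈ᴾ π → a₀ ∈ᴾ π′ →
                          ∃[ ℓ ] (∀ {a} → a ∈ᴾ π → a ∈ᴾ π′ → a ∈ᴸ ℓ)
    planes-meet-in-line π@(i , (j , l)) π′@(i′ , (j′ , l′)) π≢π′ {a₀} a₀∈ a₀∈′ with zero-or-invertible (β π ⊕ - β π′)
    ... | inj₁ δ≈0 = inj₂ (to (X a₀) , (j , to (α π ⊛ X a₀ ⊕ γ π))) , λ {a} a∈ a∈′ →
        ≈-trans (X-constant a∈ a∈′) (≈-sym (strictlyInverseʳ (X a₀))) ,
        (begin
          Z a
            ≈⟨ a∈ ⟩
          α π ⊛ X a ⊕ β π ⊛ Y a ⊕ γ π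
            ≈⟨ K.+-congʳ (K.+-congʳ (K.*-congˡ (X-constant a∈ a∈′))) ⟩
          α π ⊛ X a₀ ⊕ β π ⊛ Y a ⊕ γ π
            ≈⟨ solve 3 (λ r s t → r :+ s :+ t := s :+ (r :+ t)) ≈-refl (α π ⊛ X a₀) (β π ⊛ Y a) (γ π) ⟩
          β π ⊛ Y a ⊕ (α π ⊛ X a₀ ⊕ γ π)
            ≈⟨ K.+-congˡ (strictlyInverseʳ _) ⟨
          β π ⊛ Y a ⊕ from (to (α π ⊛ X a₀ ⊕ γ π)) ∎)
      where
      β≈β′ : β π ≈ β π′
      β≈β′ = G.x∙y⁻¹≈ε⇒x≈y (β π) (β π′) δ≈0
      reduce : ∀ {a} → a ∈ᴾ π → a ∈ᴾ π′ → α π ⊛ X a ⊕ γ π ≈ α π′ ⊛ X a ⊕ γ π′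
      reduce {a} a∈ a∈′ = G.∙-cancelʳ (β π ⊛ Y a) _ _ (begin
        α π ⊛ X a ⊕ γ π ⊕ β π ⊛ Y a      ≈⟨ swap (α π ⊛ X a) (γ π) (β π ⊛ Y a) ⟩
        α π ⊛ X a ⊕ β π ⊛ Y a ⊕ γ π      ≈⟨ a∈ ⟨
        Z a                              ≈⟨ a∈′ ⟩
        α π′ ⊛ X a ⊕ β π′ ⊛ Y a ⊕ γ π′   ≈⟨ swap (α π′ ⊛ X a) (β π′ ⊛ Y a) (γ π′) ⟩
        α π′ ⊛ X a ⊕ γ π′ ⊕ β π′ ⊛ Y a   ≈⟨ K.+-congˡ (K.*-congʳ β≈β′) ⟨
        α π′ ⊛ X a ⊕ γ π′ ⊕ β π ⊛ Y a    ∎)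
        where
        swap : ∀ r s t → r ⊕ s ⊕ t ≈ r ⊕ t ⊕ s
        swap = solve 3 (λ r s t → r :+ s :+ t := r :+ t :+ s) ≈-refl
      X-constant : ∀ {a} → a ∈ᴾ π → a ∈ᴾ π′ → X a ≈ X a₀
      X-constant {a} a∈ a∈′ with X a ≈? X a₀
      ... | yes x≈ = x≈
      ... | no x≉ = let (α≈ , γ≈) = affine-unique x≉ (reduce a∈ a∈′) (reduce a₀∈ a₀∈′) in
        contradiction (plane-≡ {π} {π′} α≈ β≈β′ γ≈) π≢π′
    ... | inj₂ (u , uδ≈1) = inj₁ ((to m , to y₀) , (to (α π ⊕ β π ⊛ m) , to (β π ⊛ y₀ ⊕ γ π))) , λ {a} a∈ a∈′ →
        ≈-trans (Y-affine a∈ a∈′) (≈-sym (K.+-cong (K.*-congʳ (strictlyInverseʳ m)) (strictlyInverseʳ y₀))) ,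
        (begin
          Z a
            ≈⟨ a∈ ⟩
          α π ⊛ X a ⊕ β π ⊛ Y a ⊕ γ π
            ≈⟨ K.+-congʳ (K.+-congˡ (K.*-congˡ (Y-affine a∈ a∈′))) ⟩
          α π ⊛ X a ⊕ β π ⊛ (m ⊛ X a ⊕ y₀) ⊕ γ π
            ≈⟨ solve 6 (λ α β m x y γ → α :* x :+ β :* (m :* x :+ y) :+ γ := (α :+ β :* m) :* x :+ (β :* y :+ γ))
                 ≈-refl (α π) (β π) m (X a) y₀ (γ π) ⟩
          (α π ⊕ β π ⊛ m) ⊛ X a ⊕ (β π ⊛ y₀ ⊕ γ π)
            ≈⟨ K.+-cong (K.*-congʳ (strictlyInverseʳ _)) (strictlyInverseʳ _) ⟨
          from (to (α π ⊕ β π ⊛ m)) ⊛ X a ⊕ from (to (β π ⊛ y₀ ⊕ γ π)) ∎)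
      where
      δ ε ζ m y₀ : Carrier
      δ = β π ⊕ - β π′
      ε = α π′ ⊕ - α π
      ζ = γ π′ ⊕ - γ π
      m = u ⊛ ε
      y₀ = u ⊛ ζ
      δY : ∀ {a} → a ∈ᴾ π → a ∈ᴾ π′ → δ ⊛ Y a ≈ ε ⊛ X a ⊕ ζ
      δY {a} a∈ a∈′ = G.∙-cancelˡ (α π ⊛ X a ⊕ β π′ ⊛ Y a ⊕ γ π) _ _ (begin
        α π ⊛ X a ⊕ β π′ ⊛ Y a ⊕ γ π ⊕ δ ⊛ Y a
          ≈⟨ solve 6 (λ α β′ γ δ x y → α :* x :+ β′ :* y :+ γ :+ δ :* y := α :* x :+ (β′ :+ δ) :* y :+ γ)
               ≈-refl (α π) (β π′) (γ π) δ (X a) (Y a) ⟩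
        α π ⊛ X a ⊕ (β π′ ⊕ δ) ⊛ Y a ⊕ γ π
          ≈⟨ K.+-congʳ (K.+-congˡ (K.*-congʳ (shift (β π) (β π′)))) ⟨
        α π ⊛ X a ⊕ β π ⊛ Y a ⊕ γ π
          ≈⟨ ≈-trans (≈-sym a∈) a∈′ ⟩
        α π′ ⊛ X a ⊕ β π′ ⊛ Y a ⊕ γ π′
          ≈⟨ K.+-cong (K.+-congʳ (K.*-congʳ (shift (α π′) (α π)))) (shift (γ π′) (γ π)) ⟩
        (α π ⊕ ε) ⊛ X a ⊕ β π′ ⊛ Y a ⊕ (γ π ⊕ ζ)
          ≈⟨ solve 7 (λ α ε β′ γ ζ x y → (α :+ ε) :* x :+ β′ :* y :+ (γ :+ ζ) := α :* x :+ β′ :* y :+ γ :+ (ε :* x :+ ζ))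
               ≈-refl (α π) ε (β π′) (γ π) ζ (X a) (Y a) ⟩
        α π ⊛ X a ⊕ β π′ ⊛ Y a ⊕ γ π ⊕ (ε ⊛ X a ⊕ ζ) ∎)
      Y-affine : ∀ {a} → a ∈ᴾ π → a ∈ᴾ π′ → Y a ≈ m ⊛ X a ⊕ y₀
      Y-affine {a} a∈ a∈′ = begin
        Y a                     ≈⟨ K.*-identityˡ (Y a) ⟨
        1# ⊛ Y a                ≈⟨ K.*-congʳ uδ≈1 ⟨
        u ⊛ δ ⊛ Y a             ≈⟨ K.*-assoc u δ (Y a) ⟩
        u ⊛ (δ ⊛ Y a)           ≈⟨ K.*-congˡ (δY a∈ a∈′) ⟩
        u ⊛ (ε ⊛ X a ⊕ ζ)       ≈⟨ solve 4 (λ u ε x ζ → u :* (ε :* x :+ ζ) := u :* ε :* x :+ u :* ζ) ≈-refl u ε (X a) ζ ⟩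
        m ⊛ X a ⊕ y₀            ∎

    vec : Carrier → Carrier → Carrier → Point
    vec r s t = r ∷ᶠ s ∷ᶠ t ∷ᶠ []ᶠ

    two : Point → Point → Vector Point 2
    two w w′ = w ∷ᶠ w′ ∷ᶠ []ᶠ

    two-terms : ∀ s t → s ⊕ (t ⊕ 0#) ≈ s ⊕ t
    two-terms s t = K.+-congˡ (K.+-identityʳ t)

    planeFlat : Plane → Flat 2
    planeFlat π = record
      { origin      = vec 0# 0# (γ π)
      ; direction   = two (vec 1# 0# (α π)) (vec 0# 1# (β π))
      ; independent = λ t eqs → λ
          { 0F → ≈-trans (solve 2 (λ r s → r := r :* con 1 :+ (s :* con 0 :+ con 0)) ≈-refl (t 0F) (t 1F)) (eqs 0F)
          ; 1F → ≈-trans (solve 2 (λ r s → s := r :* con 0 :+ (s :* con 1 :+ con 0)) ≈-refl (t 0F) (t 1F)) (eqs 1F) }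
      }

    ∈-planeFlat : ∀ {a} π → a ∈ᴾ π → point a ∈ᶠ planeFlat π
    ∈-planeFlat {a} π a∈ = (X a ∷ᶠ Y a ∷ᶠ []ᶠ) , λ
      { 0F → solve 2 (λ x y → x := con 0 :+ (x :* con 1 :+ (y :* con 0 :+ con 0))) ≈-refl (X a) (Y a)
      ; 1F → solve 2 (λ x y → y := con 0 :+ (x :* con 0 :+ (y :* con 1 :+ con 0))) ≈-refl (X a) (Y a)
      ; 2F → ≈-trans a∈ (solve 5 (λ α β γ x y → α :* x :+ β :* y :+ γ := γ :+ (x :* α :+ (y :* β :+ con 0)))
               ≈-refl (α π) (β π) (γ π) (X a) (Y a)) }

    slope : Line → Point
    slope (inj₁ ((m , _) , (n , _))) = vec 1# (from m) (from n)
    slope (inj₂ (_ , (n , _)))       = vec 0# 1# (from n)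

    parameter : Line → Fin (q ^ 3) → Carrier
    parameter (inj₁ _) = X
    parameter (inj₂ _) = Y

    private
      -- This is s (m - m′) = 0 with t = -s, arranged so that no subtraction occurs.
      combination-zero : ∀ {s t m m′} → s ⊕ t ≈ 0# → s ⊛ m ⊕ t ⊛ m′ ≈ 0# → ¬ s ≈ 0# → m ≈ m′
      combination-zero {s} {t} {m} {m′} sum≈0 comb≈0 s≉0 with zero-or-invertible s
      ... | inj₁ s≈0 = contradiction s≈0 s≉0
      ... | inj₂ (u , us≈1) = begin
          m               ≈⟨ invert m ⟩
          u ⊛ (s ⊛ m)     ≈⟨ K.*-congˡ (G.∙-cancelʳ (t ⊛ m′) _ _ (begin
            s ⊛ m ⊕ t ⊛ m′   ≈⟨ comb≈0 ⟩
            0#               ≈⟨ K.zeroˡ m′ ⟨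
            0# ⊛ m′          ≈⟨ K.*-congʳ sum≈0 ⟨
            (s ⊕ t) ⊛ m′     ≈⟨ K.distribʳ m′ s t ⟩
            s ⊛ m′ ⊕ t ⊛ m′  ∎)) ⟩
          u ⊛ (s ⊛ m′)    ≈⟨ invert m′ ⟨
          m′              ∎
        where
        invert : ∀ m → m ≈ u ⊛ (s ⊛ m)
        invert m = ≈-trans (≈-sym (K.*-identityˡ m)) (≈-trans (K.*-congʳ (≈-sym us≈1)) (K.*-assoc u s m))

      vanish-both : ∀ {s t} → s ⊕ t ≈ 0# → s ≈ 0# → t ≈ 0#
      vanish-both {s} {t} sum≈0 s≈0 = ≈-trans (≈-sym (K.+-identityˡ t)) (≈-trans (K.+-congʳ (≈-sym s≈0)) sum≈0)

      both : ∀ {t : Fin 2 → Carrier} → t 0F ≈ 0# → t 1F ≈ 0# → ∀ l → t l ≈ 0#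
      both h h′ 0F = h
      both h h′ 1F = h′

      -- For lines of the same kind, a nontrivial relation forces equal slopes; the common point x
      -- then forces equal intercepts, against ℓ ≢ ℓ′. For lines of different kinds the first
      -- coordinates 1 and 0 decide.
      line-through : ∀ {x} ℓ ℓ′ → ℓ ≢ ℓ′ → x ∈ᴸ ℓ → x ∈ᴸ ℓ′ → LinearlyIndependent (two (slope ℓ) (slope ℓ′))
      line-through {x} ℓ@(inj₁ ((m , y₀) , (n , z₀))) ℓ′@(inj₁ ((m′ , y₀′) , (n′ , z₀′))) ℓ≢ℓ′ (y≈ , z≈) (y≈′ , z≈′) t eqs =
        both {t} t₀≈0 (vanish-both sum≈0 t₀≈0)
        where
        sum≈0 : t 0F ⊕ t 1F ≈ 0#
        sum≈0 = ≈-trans (solve 2 (λ r s → r :+ s := r :* con 1 :+ (s :* con 1 :+ con 0)) ≈-refl (t 0F) (t 1F)) (eqs 0F)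
        t₀≈0 : t 0F ≈ 0#
        t₀≈0 with t 0F ≈? 0#
        ... | yes h = h
        ... | no t₀≉0 = contradiction
          (cong inj₁ (cong₂ _,_ (cong₂ _,_ (from-injective m≈) (from-injective (cancel m≈ y≈ y≈′)))
                                (cong₂ _,_ (from-injective n≈) (from-injective (cancel n≈ z≈ z≈′))))) ℓ≢ℓ′
          where
          m≈ = combination-zero sum≈0 (≈-trans (≈-sym (two-terms _ _)) (eqs 1F)) t₀≉0
          n≈ = combination-zero sum≈0 (≈-trans (≈-sym (two-terms _ _)) (eqs 2F)) t₀≉0
          cancel : ∀ {w m m′ r r′} → m ≈ m′ → w ≈ m ⊛ X x ⊕ r → w ≈ m′ ⊛ X x ⊕ r′ → r ≈ r′
          cancel {m = m} m≈ eq eq′ = G.∙-cancelˡ (m ⊛ X x) _ _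
            (≈-trans (≈-sym eq) (≈-trans eq′ (K.+-congʳ (K.*-congʳ (≈-sym m≈)))))
      line-through (inj₁ _) (inj₂ _) ℓ≢ℓ′ _ _ t eqs = both {t} t₀≈0
        (vanish-both (≈-trans (solve 3 (λ r s m → r :* m :+ s := r :* m :+ (s :* con 1 :+ con 0)) ≈-refl (t 0F) (t 1F) _) (eqs 1F))
          (≈-trans (K.*-congʳ t₀≈0) (K.zeroˡ _)))
        where
        t₀≈0 : t 0F ≈ 0#
        t₀≈0 = ≈-trans (solve 2 (λ r s → r := r :* con 1 :+ (s :* con 0 :+ con 0)) ≈-refl (t 0F) (t 1F)) (eqs 0F)
      line-through (inj₂ _) (inj₁ _) ℓ≢ℓ′ _ _ t eqs = both {t}
        (vanish-both (≈-trans (solve 3 (λ r s m → s :* m :+ r := r :* con 1 :+ (s :* m :+ con 0)) ≈-refl (t 0F) (t 1F) _) (eqs 1F))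
          (≈-trans (K.*-congʳ t₁≈0) (K.zeroˡ _)))
        t₁≈0
        where
        t₁≈0 : t 1F ≈ 0#
        t₁≈0 = ≈-trans (solve 2 (λ r s → s := r :* con 0 :+ (s :* con 1 :+ con 0)) ≈-refl (t 0F) (t 1F)) (eqs 0F)
      line-through {x} (inj₂ (x₀ , (n , z₀))) (inj₂ (x₀′ , (n′ , z₀′))) ℓ≢ℓ′ (x≈ , z≈) (x≈′ , z≈′) t eqs =
        both {t} t₀≈0 (vanish-both sum≈0 t₀≈0)
        where
        sum≈0 : t 0F ⊕ t 1F ≈ 0#
        sum≈0 = ≈-trans (solve 2 (λ r s → r :+ s := r :* con 1 :+ (s :* con 1 :+ con 0)) ≈-refl (t 0F) (t 1F)) (eqs 1F)
        t₀≈0 : t 0F ≈ 0#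
        t₀≈0 with t 0F ≈? 0#
        ... | yes h = h
        ... | no t₀≉0 = contradiction
          (cong inj₂ (cong₂ _,_ (from-injective (≈-trans (≈-sym x≈) x≈′))
                                (cong₂ _,_ (from-injective n≈) (from-injective
            (G.∙-cancelˡ (from n ⊛ Y x) _ _ (≈-trans (≈-sym z≈) (≈-trans z≈′ (K.+-congʳ (K.*-congʳ (≈-sym n≈))))))))))
          ℓ≢ℓ′
          where
          n≈ = combination-zero sum≈0 (≈-trans (≈-sym (two-terms _ _)) (eqs 2F)) t₀≉0

      along : ∀ ℓ {x a} → x ∈ᴸ ℓ → a ∈ᴸ ℓ →
              ∀ j → point a j ≈ point x j ⊕ (parameter ℓ a ⊕ - parameter ℓ x) ⊛ slope ℓ j
      along ℓ {x} {a} x∈ a∈ = coordinates ℓ x∈ a∈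
        where
        slide : ∀ {w w′ m r s t} → w ≈ m ⊛ t ⊕ r → w′ ≈ m ⊛ s ⊕ r → w′ ≈ w ⊕ (s ⊕ - t) ⊛ m
        slide {w} {w′} {m} {r} {s} {t} eq eq′ = begin
          w′                             ≈⟨ eq′ ⟩
          m ⊛ s ⊕ r                      ≈⟨ K.+-congʳ (K.*-congˡ (shift s t)) ⟩
          m ⊛ (t ⊕ (s ⊕ - t)) ⊕ r        ≈⟨ solve 4 (λ m t d r → m :* (t :+ d) :+ r := m :* t :+ r :+ d :* m) ≈-refl m t (s ⊕ - t) r ⟩
          m ⊛ t ⊕ r ⊕ (s ⊕ - t) ⊛ m      ≈⟨ K.+-congʳ eq ⟨
          w ⊕ (s ⊕ - t) ⊛ m              ∎
        itself : ∀ s t → s ≈ t ⊕ (s ⊕ - t) ⊛ 1#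
        itself s t = ≈-trans (shift s t) (K.+-congˡ (≈-sym (K.*-identityʳ _)))
        coordinates : ∀ ℓ → x ∈ᴸ ℓ → a ∈ᴸ ℓ →
                      ∀ j → point a j ≈ point x j ⊕ (parameter ℓ a ⊕ - parameter ℓ x) ⊛ slope ℓ j
        coordinates (inj₁ _) (y≈ , z≈) (y≈′ , z≈′) 0F = itself (X a) (X x)
        coordinates (inj₁ _) (y≈ , z≈) (y≈′ , z≈′) 1F = slide y≈ y≈′
        coordinates (inj₁ _) (y≈ , z≈) (y≈′ , z≈′) 2F = slide z≈ z≈′
        coordinates (inj₂ _) (x≈ , z≈) (x≈′ , z≈′) 0F = begin
          X a                            ≈⟨ ≈-trans x≈′ (≈-sym x≈) ⟩
          X x                            ≈⟨ solve 2 (λ x d → x := x :+ d :* con 0) ≈-refl (X x) (Y a ⊕ - Y x) ⟩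
          X x ⊕ (Y a ⊕ - Y x) ⊛ 0#       ∎
        coordinates (inj₂ _) (x≈ , z≈) (x≈′ , z≈′) 1F = itself (Y a) (Y x)
        coordinates (inj₂ _) (x≈ , z≈) (x≈′ , z≈′) 2F = slide z≈ z≈′

    -- Two crossing nonvertical lines may span a vertical plane, which no `planeFlat` describes; so
    -- their plane is built from the common point and the two directions.
    spanFlat : ∀ {x} ℓ ℓ′ → ℓ ≢ ℓ′ → x ∈ᴸ ℓ → x ∈ᴸ ℓ′ → Flat 2
    spanFlat {x} ℓ ℓ′ ℓ≢ℓ′ x∈ x∈′ = record
      { origin = point x ; direction = two (slope ℓ) (slope ℓ′) ; independent = line-through ℓ ℓ′ ℓ≢ℓ′ x∈ x∈′ }

    ∈-spanFlat : ∀ {x a} ℓ ℓ′ (ℓ≢ℓ′ : ℓ ≢ ℓ′) (x∈ : x ∈ᴸ ℓ) (x∈′ : x ∈ᴸ ℓ′) →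
                 a ∈ᴸ ℓ ⊎ a ∈ᴸ ℓ′ → point a ∈ᶠ spanFlat ℓ ℓ′ ℓ≢ℓ′ x∈ x∈′
    ∈-spanFlat {x} {a} ℓ ℓ′ _ x∈ x∈′ (inj₁ a∈) = (t ∷ᶠ 0# ∷ᶠ []ᶠ) , λ j →
      ≈-trans (along ℓ x∈ a∈ j) (solve 4 (λ x t w w′ → x :+ t :* w := x :+ (t :* w :+ (con 0 :* w′ :+ con 0)))
        ≈-refl (point x j) t (slope ℓ j) (slope ℓ′ j))
      where t = parameter ℓ a ⊕ - parameter ℓ x
    ∈-spanFlat {x} {a} ℓ ℓ′ _ x∈ x∈′ (inj₂ a∈) = (0# ∷ᶠ t ∷ᶠ []ᶠ) , λ j →
      ≈-trans (along ℓ′ x∈′ a∈ j) (solve 4 (λ x t w w′ → x :+ t :* w′ := x :+ (con 0 :* w :+ (t :* w′ :+ con 0)))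
        ≈-refl (point x j) t (slope ℓ j) (slope ℓ′ j))
      where t = parameter ℓ′ a ⊕ - parameter ℓ′ x

  -- Incidences between points and nonvertical planes

  module Counting {q : ℕ} (F : FiniteField q) where

    open FiniteField F using (commutativeRing; enumeration)
    private module K = CommutativeRing commutativeRing
    open Inverse enumeration using (to; strictlyInverseʳ)
    open AffineSpace F 3
    open Geometry F

    V : Set
    V = Fin (q ^ 3)

    planes : List Plane
    planes = cartesianProduct (allFin q) (cartesianProduct (allFin q) (allFin q))

    planes-unique : Unique planes
    planes-unique = Unique.cartesianProduct⁺ (Unique.allFin⁺ q) (Unique.cartesianProduct⁺ (Unique.allFin⁺ q) (Unique.allFin⁺ q))

    length-allFin : length (allFin q) ≡ q
    length-allFin = length-tabulate (λ i → i)

    length-planes : length planes ≡ q * (q * q)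
    length-planes = trans (length-cartesianProduct (allFin q) _) (cong₂ _*_ length-allFin
      (trans (length-cartesianProduct (allFin q) _) (cong₂ _*_ length-allFin length-allFin)))

    lines : List Line
    lines = map inj₁ (cartesianProduct (cartesianProduct (allFin q) (allFin q)) (cartesianProduct (allFin q) (allFin q)))
         ++ map inj₂ (cartesianProduct (allFin q) (cartesianProduct (allFin q) (allFin q)))

    lines-unique : Unique lines
    lines-unique = Unique.++⁺
      (Unique.map⁺ (λ { refl → refl }) (Unique.cartesianProduct⁺ squares squares))
      (Unique.map⁺ (λ { refl → refl }) (Unique.cartesianProduct⁺ (Unique.allFin⁺ q) squares))
      λ (ℓ∈ , ℓ∈′) → disjoint (∈-map⁻ inj₁ ℓ∈) (∈-map⁻ inj₂ ℓ∈′)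
      where
      squares = Unique.cartesianProduct⁺ (Unique.allFin⁺ q) (Unique.allFin⁺ q)
      disjoint : ∀ {A B : Set} {ℓ : A ⊎ B} {xs ys} → (∃[ x ] x ∈ xs × ℓ ≡ inj₁ x) → ¬ (∃[ y ] y ∈ ys × ℓ ≡ inj₂ y)
      disjoint (_ , _ , refl) (_ , _ , ())

    ∈-lines : ∀ ℓ → ℓ ∈ lines
    ∈-lines (inj₁ ((m , y₀) , (n , z₀))) = ∈-++⁺ˡ (∈-map⁺ inj₁ (∈-cartesianProduct⁺
      (∈-cartesianProduct⁺ (∈-allFin m) (∈-allFin y₀)) (∈-cartesianProduct⁺ (∈-allFin n) (∈-allFin z₀))))
    ∈-lines (inj₂ (x₀ , (n , z₀))) = ∈-++⁺ʳ _ (∈-map⁺ inj₂ (∈-cartesianProduct⁺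
      (∈-allFin x₀) (∈-cartesianProduct⁺ (∈-allFin n) (∈-allFin z₀))))

    -- For each choice of the two slopes exactly one intercept puts the plane through a.
    planes-through : ∀ a → ∑ planes (λ π → 𝟙 (a ∈ᴾ? π)) ≡ q * q
    planes-through a = trans (∑-× (allFin q) _ _) (trans
      (∑-cong (allFin q) (λ i _ → trans (∑-× (allFin q) (allFin q) _) (trans (∑-cong (allFin q) (λ j _ → one i j)) ones)))
      (trans (∑-const (allFin q) q) (cong (_* q) length-allFin)))
      where
      ones : ∑ (allFin q) (λ _ → 1) ≡ q
      ones = trans (∑-const (allFin q) 1) (trans (*-identityʳ _) length-allFin)
      one : ∀ i j → ∑ (allFin q) (λ l → 𝟙 (a ∈ᴾ? (i , (j , l)))) ≡ 1
      one i j = ≤-antisym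
        (subst (_≤ 1) (count≡∑ (λ l → a ∈ᴾ? (i , (j , l))) (allFin q))
          (AtMost⇒count≤ (λ l → a ∈ᴾ? (i , (j , l))) (Unique.allFin⁺ q)
            (AtMost-one (λ l l′ (_ , a∈) (_ , a∈′) →
              cong (λ π → proj₂ (proj₂ π)) (slope-injective (i , (j , l)) (i , (j , l′)) a∈ a∈′ refl refl)))))
        (≤-trans (≤-reflexive (sym (𝟙-yes (a ∈ᴾ? (i , (j , l₀))) incident)))
          (term≤∑ (allFin q) (λ l → 𝟙 (a ∈ᴾ? (i , (j , l)))) (∈-allFin l₀)))
        where
        -- The last component of the triple is a placeholder, since `α` and `β` do not read it.
        s = α (i , (j , i)) K.* X a K.+ β (i , (j , i)) K.* Y a
        l₀ : Fin q
        l₀ = to (Z a K.+ K.- s)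
        incident : a ∈ᴾ (i , (j , l₀))
        incident = K.trans (shift (Z a) s) (K.+-congˡ (K.sym (strictlyInverseʳ _)))

    planes-through-two : ∀ {a b} → a ≢ b → ∑ planes (λ π → 𝟙 (a ∈ᴾ? π) * 𝟙 (b ∈ᴾ? π)) ≤ q
    planes-through-two {a} {b} a≢b = subst (_≤ q)
      (trans (count≡∑ (λ π → (a ∈ᴾ? π) ×-dec (b ∈ᴾ? π)) planes) (∑-cong planes (λ π _ → 𝟙-× (a ∈ᴾ? π) (b ∈ᴾ? π))))
      (AtMost⇒count≤ (λ π → (a ∈ᴾ? π) ×-dec (b ∈ᴾ? π)) planes-unique
        (subst (λ m → AtMost m (λ π → π ∈ planes × (a ∈ᴾ π × b ∈ᴾ π))) (*-identityʳ q)
          (AtMost-box ((pencil a b , q) ∷ []) ((λ π _ → pencil<q a b π) ∷ [])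
            (λ { π π′ (_ , a∈ , b∈) (_ , a∈′ , b∈′) (eq ∷ []) → pencil-injective π π′ a≢b a∈ b∈ a∈′ b∈′ eq }))))

    -- Triples on a vertical line are not captured. This does no harm, because a nonvertical plane
    -- contains no two points of a vertical line.
    Col : V → V → V → Set
    Col a b c = Any (λ ℓ → a ∈ᴸ ℓ × (b ∈ᴸ ℓ × c ∈ᴸ ℓ)) lines

    Col? : ∀ a b c → Dec (Col a b c)
    Col? a b c = any? (λ ℓ → (a ∈ᴸ? ℓ) ×-dec ((b ∈ᴸ? ℓ) ×-dec (c ∈ᴸ? ℓ))) lines

    infix 4 _≟ᴾ_
    _≟ᴾ_ : DecidableEquality Plane
    _≟ᴾ_ = ×-≡-dec Fin._≟_ (×-≡-dec Fin._≟_ Fin._≟_)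

    noncollinear-plane-unique : ∀ {a b c} π π′ → ¬ Col a b c → a ∈ᴾ π → b ∈ᴾ π → c ∈ᴾ π →
                                a ∈ᴾ π′ → b ∈ᴾ π′ → c ∈ᴾ π′ → π ≡ π′
    noncollinear-plane-unique π π′ ¬col a∈ b∈ c∈ a∈′ b∈′ c∈′ with π ≟ᴾ π′
    ... | yes eq = eq
    ... | no neq = let (ℓ , on-ℓ) = planes-meet-in-line π π′ neq a∈ a∈′ in
      contradiction (lose (∈-lines ℓ) (on-ℓ a∈ a∈′ , on-ℓ b∈ b∈′ , on-ℓ c∈ c∈′)) ¬col

    module _ (pts : List V) (pts-unique : Unique pts) where

      private
        N : ℕ
        N = length pts

      on : Plane → ℕ
      on π = count (_∈ᴾ? π) pts

      ∑-on : ∑ planes on ≡ N * (q * q)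
      ∑-on = trans (∑-cong planes (λ π _ → count≡∑ (_∈ᴾ? π) pts))
        (trans (∑-swap planes pts (λ π a → 𝟙 (a ∈ᴾ? π)))
          (trans (∑-cong pts (λ a _ → planes-through a)) (∑-const pts (q * q))))

      -- The second moment counts pairs of points with a common plane: q² planes for each diagonal
      -- pair and at most q for any other.
      ∑-on² : ∑ planes (λ π → on π * on π) ≤ N * (q * q + N * q)
      ∑-on² = begin
        ∑ planes (λ π → on π * on π)
          ≡⟨ ∑-cong planes (λ π _ → trans (cong₂ _*_ (count≡∑ (_∈ᴾ? π) pts) (count≡∑ (_∈ᴾ? π) pts)) (∑-* pts pts _ _)) ⟩
        ∑ planes (λ π → ∑ pts (λ a → ∑ pts (λ b → 𝟙 (a ∈ᴾ? π) * 𝟙 (b ∈ᴾ? π))))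
          ≡⟨ ∑-swap planes pts (λ π a → ∑ pts (λ b → 𝟙 (a ∈ᴾ? π) * 𝟙 (b ∈ᴾ? π))) ⟩
        ∑ pts (λ a → ∑ planes (λ π → ∑ pts (λ b → 𝟙 (a ∈ᴾ? π) * 𝟙 (b ∈ᴾ? π))))
          ≡⟨ ∑-cong pts (λ a _ → ∑-swap planes pts (λ π b → 𝟙 (a ∈ᴾ? π) * 𝟙 (b ∈ᴾ? π))) ⟩
        ∑ pts (λ a → ∑ pts (λ b → ∑ planes (λ π → 𝟙 (a ∈ᴾ? π) * 𝟙 (b ∈ᴾ? π))))
          ≤⟨ ∑-mono pts (λ a _ → ∑-mono pts (λ b _ → joint a b)) ⟩
        ∑ pts (λ a → ∑ pts (λ b → 𝟙 (a Fin.≟ b) * (q * q) + q))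
          ≡⟨ ∑-cong pts (λ a _ → trans (∑-+ pts _ _) (cong₂ _+_ (∑-*ʳ pts _ (q * q)) (∑-const pts q))) ⟩
        ∑ pts (λ a → ∑ pts (λ b → 𝟙 (a Fin.≟ b)) * (q * q) + N * q)
          ≤⟨ ∑-mono pts (λ a _ → +-monoˡ-≤ (N * q)
               (≤-trans (*-monoˡ-≤ (q * q) (∑𝟙≟≤1 Fin._≟_ pts a pts-unique)) (≤-reflexive (*-identityˡ (q * q))))) ⟩
        ∑ pts (λ _ → q * q + N * q)
          ≡⟨ ∑-const pts _ ⟩
        N * (q * q + N * q) ∎
        where
        open ≤-Reasoning
        joint : ∀ a b → ∑ planes (λ π → 𝟙 (a ∈ᴾ? π) * 𝟙 (b ∈ᴾ? π)) ≤ 𝟙 (a Fin.≟ b) * (q * q) + q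
        joint a b with a Fin.≟ b
        ... | no a≢b = planes-through-two a≢b
        ... | yes refl = ≤-trans (∑-mono planes (λ π _ → idem (a ∈ᴾ? π)))
          (≤-trans (≤-reflexive (trans (planes-through a) (sym (+-identityʳ (q * q))))) (m≤m+n (q * q + 0) q))
          where
          idem : ∀ {P : Set} (P? : Dec P) → 𝟙 P? * 𝟙 P? ≤ 𝟙 P?
          idem (yes _) = ≤-refl
          idem (no _)  = ≤-refl

      -- Chebyshev's inequality: a plane holds N / q points on average.
      few-poor-planes : ∀ {M} → 2 * (q * M) ≤ N → 0 < N →
                        count (λ π → suc (on π) ≤? M) planes * N ≤ 4 * (q * (q * (q * q)))
      few-poor-planes {M} 2qM≤N 0<N = *-cancelʳ-≤ _ _ N {{>-nonZero 0<N}} (+-cancelʳ-≤ (8 * N * (q * (N * (q * q)))) _ _ (begin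
        P * N * N + 8 * N * (q * (N * (q * q)))
          ≡⟨ cong₂ (λ z w → z + 8 * N * (q * w)) weights (sym ∑-on) ⟩
        ∑ planes (λ π → 𝟙 (suc (on π) ≤? M) * (N * N)) + 8 * N * (q * ∑ planes on)
          ≡⟨ cong (∑ planes (λ π → 𝟙 (suc (on π) ≤? M) * (N * N)) +_) (trans (cong (8 * N *_) (sym (∑-*ˡ planes q on))) (sym (∑-*ˡ planes (8 * N) _))) ⟩
        ∑ planes (λ π → 𝟙 (suc (on π) ≤? M) * (N * N)) + ∑ planes (λ π → 8 * N * (q * on π))
          ≡⟨ ∑-+ planes _ _ ⟨
        ∑ planes (λ π → 𝟙 (suc (on π) ≤? M) * (N * N) + 8 * N * (q * on π))
          ≤⟨ ∑-mono planes (λ π _ → deviation π) ⟩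
        ∑ planes (λ π → 4 * (N * N) + 4 * (q * q) * (on π * on π))
          ≡⟨ trans (∑-+ planes _ _) (cong₂ _+_ (trans (∑-const planes _) (cong (_* (4 * (N * N))) length-planes))
               (∑-*ˡ planes (4 * (q * q)) _)) ⟩
        q * (q * q) * (4 * (N * N)) + 4 * (q * q) * ∑ planes (λ π → on π * on π)
          ≤⟨ +-monoʳ-≤ (q * (q * q) * (4 * (N * N))) (*-monoʳ-≤ (4 * (q * q)) ∑-on²) ⟩
        q * (q * q) * (4 * (N * N)) + 4 * (q * q) * (N * (q * q + N * q))
          ≡⟨ collect q N ⟩
        4 * (q * (q * (q * q))) * N + 8 * N * (q * (N * (q * q))) ∎))
        where
        open ≤-Reasoning
        P = count (λ π → suc (on π) ≤? M) planes
        collect : ∀ q N → q * (q * q) * (4 * (N * N)) + 4 * (q * q) * (N * (q * q + N * q)) ≡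
                  4 * (q * (q * (q * q))) * N + 8 * N * (q * (N * (q * q)))
        collect = solve-∀
        weights : P * N * N ≡ ∑ planes (λ π → 𝟙 (suc (on π) ≤? M) * (N * N))
        weights = trans (*-assoc P N N) (trans (cong (_* (N * N)) (count≡∑ (λ π → suc (on π) ≤? M) planes))
          (sym (∑-*ʳ planes _ (N * N))))
        -- This is 4 (N - q m)² ≥ N² for a poor plane with m points, and ≥ 0 for any other, with the
        -- cross term moved to the left. For a poor plane write N = 2qm + e; the surplus is e (4qm +
        -- 3e).
        deviation : ∀ π → 𝟙 (suc (on π) ≤? M) * (N * N) + 8 * N * (q * on π) ≤ 4 * (N * N) + 4 * (q * q) * (on π * on π)
        deviation π with suc (on π) ≤? M
        ... | yes on<M = subst (λ N → 1 * (N * N) + 8 * N * (q * on π) ≤ 4 * (N * N) + 4 * (q * q) * (on π * on π))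
                (m+[n∸m]≡n 2qm≤N) (≤-trans (m≤m+n _ _) (≤-reflexive (square q (on π) (N ∸ 2 * (q * on π)))))
          where
          2qm≤N : 2 * (q * on π) ≤ N
          2qm≤N = ≤-trans (*-monoʳ-≤ 2 (*-monoʳ-≤ q (<⇒≤ on<M))) 2qM≤N
          square : ∀ q m e → 1 * ((2 * (q * m) + e) * (2 * (q * m) + e)) + 8 * (2 * (q * m) + e) * (q * m)
                               + (4 * (e * (q * m)) + 3 * (e * e)) ≡
                             4 * ((2 * (q * m) + e) * (2 * (q * m) + e)) + 4 * (q * q) * (m * m)
          square = solve-∀
        ... | no _ = begin
          8 * N * (q * on π)                           ≡⟨ double N (q * on π) ⟩
          4 * (2 * (N * (q * on π)))                   ≤⟨ *-monoʳ-≤ 4 (2mn≤m²+n² N (q * on π)) ⟩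
          4 * (N * N + q * on π * (q * on π))          ≡⟨ expand q N (on π) ⟩
          4 * (N * N) + 4 * (q * q) * (on π * on π)    ∎
          where
          double : ∀ N m → 8 * N * m ≡ 4 * (2 * (N * m))
          double = solve-∀
          expand : ∀ q N m → 4 * (N * N + q * m * (q * m)) ≡ 4 * (N * N) + 4 * (q * q) * (m * m)
          expand = solve-∀

  -- Auxiliary counts and the arithmetic of the constants

  two-members : ∀ {A : Set} {xs : List A} → Unique xs → 2 ≤ length xs → ∃[ x ] ∃[ y ] (x ≢ y × x ∈ xs × y ∈ xs)
  two-members {xs = x ∷ y ∷ _} ((x≢y ∷ _) ∷ _) _ = x , y , x≢y , here refl , there (here refl)
  two-members {xs = _ ∷ []} _ (s≤s ())

  count-filter : ∀ {A : Set} {P Q : Pred A 0ℓ} (P? : Decidable P) (Q? : Decidable Q) xs →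
                 count P? (filter Q? xs) ≡ count (λ x → P? x ×-dec Q? x) xs
  count-filter P? Q? []       = refl
  count-filter P? Q? (x ∷ xs) with Q? x
  ... | no _ with P? x
  ...   | yes _ = count-filter P? Q? xs
  ...   | no  _ = count-filter P? Q? xs
  count-filter P? Q? (x ∷ xs) | yes _ with P? x
  ...   | yes _ = cong suc (count-filter P? Q? xs)
  ...   | no  _ = count-filter P? Q? xs

  -- The union bound.
  count-any≤∑ : ∀ {A B : Set} {R : A → B → Set} (R? : ∀ x y → Dec (R x y)) xs ys →
                count (λ x → any? (R? x) ys) xs ≤ ∑ ys (λ y → count (λ x → R? x y) xs)
  count-any≤∑ R? xs ys = begin
    count (λ x → any? (R? x) ys) xs                ≡⟨ count≡∑ (λ x → any? (R? x) ys) xs ⟩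
    ∑ xs (λ x → 𝟙 (any? (R? x) ys))                ≤⟨ ∑-mono xs (λ x _ → hit x) ⟩
    ∑ xs (λ x → ∑ ys (λ y → 𝟙 (R? x y)))           ≡⟨ ∑-swap xs ys _ ⟩
    ∑ ys (λ y → ∑ xs (λ x → 𝟙 (R? x y)))           ≡⟨ ∑-cong ys (λ y _ → count≡∑ (λ x → R? x y) xs) ⟨
    ∑ ys (λ y → count (λ x → R? x y) xs)           ∎
    where
    open ≤-Reasoning
    hit : ∀ x → 𝟙 (any? (R? x) ys) ≤ ∑ ys (λ y → 𝟙 (R? x y))
    hit x with any? (R? x) ys
    ... | no _ = z≤n
    ... | yes h = let (y , y∈ , r) = find h in
      ≤-trans (≤-reflexive (sym (𝟙-yes (R? x y) r))) (term≤∑ ys (λ y → 𝟙 (R? x y)) y∈)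

  scale-degree : ∀ {δ D q X} → δ ≤ D * 256 → D * q ≤ X → δ * q ≤ X * 256
  scale-degree {δ} {D} {q} {X} h h′ = begin
    δ * q              ≤⟨ *-monoˡ-≤ q h ⟩
    D * 256 * q        ≡⟨ *-assoc D 256 q ⟩
    D * (256 * q)      ≡⟨ cong (D *_) (*-comm 256 q) ⟩
    D * (q * 256)      ≡⟨ *-assoc D q 256 ⟨
    D * q * 256        ≤⟨ *-monoˡ-≤ 256 h′ ⟩
    X * 256            ∎
    where open ≤-Reasoning

  cube-bound : ∀ {q M N} → q * M ≤ N → q * (q * (M * (M * (M * 1)))) * q ≤ N * (N * (N * 1))
  cube-bound {q} {M} {N} h = ≤-trans (≤-reflexive (cube q M)) (*-mono-≤ h (*-mono-≤ h (*-monoˡ-≤ 1 h)))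
    where
    cube : ∀ q M → q * (q * (M * (M * (M * 1)))) * q ≡ q * M * (q * M * (q * M * 1))
    cube = solve-∀

  square-bound : ∀ {q M N} → q * M ≤ N → q * (M * (M * 1)) * q ≤ N * (N * 1)
  square-bound {q} {M} {N} h = ≤-trans (≤-reflexive (square q M)) (*-mono-≤ h (*-monoˡ-≤ 1 h))
    where
    square : ∀ q M → q * (M * (M * 1)) * q ≡ q * M * (q * M * 1)
    square = solve-∀

  linear-bound : ∀ {q M N} → q * M ≤ N → M * 1 * q ≤ N * 1
  linear-bound {q} {M} {N} h = ≤-trans (≤-reflexive (linear q M)) (*-monoˡ-≤ 1 h)
    where
    linear : ∀ q M → M * 1 * q ≡ q * M * 1
    linear = solve-∀

  -- The space condition of `length-I≥` for M = 64k points, at most g = 8k on a line, and h = 32k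
  -- surviving choices.
  room : ∀ {k} → 1 ≤ k → 3 + 3 * (8 * k) + 32 * k ≤ 64 * k
  room {k} 1≤k = ≤-trans
    (+-monoˡ-≤ (32 * k) (+-monoˡ-≤ (3 * (8 * k)) (≤-trans (*-monoʳ-≤ 3 1≤k) (*-monoˡ-≤ k (≤ᵇ⇒≤ 3 8 _)))))
    (≤-reflexive (collect 8 k))
    where
    collect : ∀ c k → c * k + 3 * (c * k) + 4 * c * k ≡ 8 * c * k
    collect = solve-∀

  -- The estimate is generous; it is rounded up to the constant that the crossing lines need.
  planes-size : ∀ {Q g i e k} → Q ≤ 2 * g → g * (64 * k * (32 * k * (32 * k * (32 * k)))) ≤ i → i ≤ e * 256 →
                Q * (k * (k * (k * k))) ≤ e * 8388608
  planes-size {Q} {g} {i} {e} {k} Q≤ i≥ i≤ = begin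
    Q * (k * (k * (k * k)))
      ≤⟨ *-monoˡ-≤ (k * (k * (k * k))) Q≤ ⟩
    2 * g * (k * (k * (k * k)))
      ≡⟨ *-assoc 2 g _ ⟩
    2 * (g * (k * (k * (k * k))))
      ≤⟨ *-monoʳ-≤ 2 (*-monoʳ-≤ g (*-mono-≤ (m≤n*m k 64) (*-mono-≤ (m≤n*m k 32) (*-mono-≤ (m≤n*m k 32) (m≤n*m k 32))))) ⟩
    2 * (g * (64 * k * (32 * k * (32 * k * (32 * k)))))
      ≤⟨ *-monoʳ-≤ 2 (≤-trans i≥ i≤) ⟩
    2 * (e * 256)
      ≡⟨ trans (*-comm 2 (e * 256)) (*-assoc e 256 2) ⟩
    e * 512
      ≤⟨ *-monoʳ-≤ e (≤ᵇ⇒≤ 512 8388608 _) ⟩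
    e * 8388608 ∎
    where open ≤-Reasoning

  -- The case of few rich lines

  module Cases
    {q : ℕ} (F : FiniteField q) (U : AffineSpace.PointSet F 3) (k : ℕ) (1≤k : 1 ≤ k) (4096≤q : 4096 ≤ q)
    (N≥ : 128 * (q * k) ≤ ∣ U ∣)
    where

    open AffineSpace F 3
    open Geometry F
    open Counting F

    N : ℕ
    N = ∣ U ∣

    -- The common goal of the two cases, in natural numbers. As N is at most 256qk, the size bound
    -- q³k⁴ has the order N⁴/q. The constant 8388608 = 256 · 512 · 64 is dictated by `cross-size`,
    -- and 256 is the overcount of `Hypergraph`.
    Balanced : Set
    Balanced = Σ[ H ∈ List PointSet ] (Unique H × All (𝒮₄ U) H ×
      q * (q * q) * (k * (k * (k * k))) ≤ length H * 8388608 ×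
      (∀ i → 1 ≤ i → i ≤ 3 → Δ U i H * q ≤ N ^ (4 ∸ i) * 256))

    pts : List V
    pts = elements U

    pts-unique : Unique pts
    pts-unique = elements-unique U

    length-pts : length pts ≡ N
    length-pts = length-elements U

    0<q : 0 < q
    0<q = ≤-trans (s≤s z≤n) 4096≤q

    instance
      q≢0 : NonZero q
      q≢0 = >-nonZero 0<q
      k≢0 : NonZero k
      k≢0 = >-nonZero 1≤k

    -- Only a default for `nth`; the positions used stay below the lengths of the lists.
    origin₀ : V
    origin₀ = index (λ _ → CommutativeRing.0# (FiniteField.commutativeRing F))

    Rich : Line → Set
    Rich ℓ = 8 * k ≤ count (_∈ᴸ? ℓ) pts

    rich? : ∀ ℓ → Dec (Rich ℓ)
    rich? ℓ = 8 * k ≤? count (_∈ᴸ? ℓ) pts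

    richLines : List Line
    richLines = filter rich? lines

    richLines-unique : Unique richLines
    richLines-unique = Unique.filter⁺ rich? lines-unique

    qk≤N : ∀ c → c ≤ 128 → c * (q * k) ≤ N
    qk≤N c c≤ = ≤-trans (*-monoˡ-≤ (q * k) c≤) N≥

    module FewRichLines (few-rich : 4 * length richLines ≤ q * q) where

      M : ℕ
      M = 64 * k

      meets? : ∀ π ℓ → Dec (2 ≤ count (λ a → (a ∈ᴸ? ℓ) ×-dec (a ∈ᴾ? π)) pts)
      meets? π ℓ = 2 ≤? count (λ a → (a ∈ᴸ? ℓ) ×-dec (a ∈ᴾ? π)) pts

      poor? : ∀ π → Dec (on pts pts-unique π < M)
      poor? π = suc (on pts pts-unique π) ≤? M

      -- Two points of U on both the plane and the rich line already count. This is weak enough for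
      -- `few-collinear` to produce it and strong enough to leave at most q such planes for each
      -- line.
      Bad : Plane → Set
      Bad π = Any (λ ℓ → 2 ≤ count (λ a → (a ∈ᴸ? ℓ) ×-dec (a ∈ᴾ? π)) pts) richLines

      bad? : ∀ π → Dec (Bad π)
      bad? π = any? (meets? π) richLines

      few-bad : count bad? planes ≤ length richLines * q
      few-bad = ≤-trans (count-any≤∑ meets? planes richLines)
        (≤-trans (∑-mono richLines (λ ℓ _ → through ℓ)) (≤-reflexive (∑-const richLines q)))
        where
        through : ∀ ℓ → count (λ π → meets? π ℓ) planes ≤ q
        through ℓ = AtMost⇒count≤ (λ π → meets? π ℓ) planes-unique
          (subst (λ m → AtMost m (λ π → π ∈ planes × 2 ≤ count (λ a → (a ∈ᴸ? ℓ) ×-dec (a ∈ᴾ? π)) pts)) (*-identityʳ q)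
            (AtMost-box ((around ℓ , q) ∷ []) ((λ π _ → around<q ℓ π) ∷ [])
              (λ { π π′ (_ , h) (_ , h′) (eq ∷ []) → around-injective ℓ π π′ (contains π h) (contains π′ h′) eq })))
          where
          contains : ∀ π → 2 ≤ count (λ a → (a ∈ᴸ? ℓ) ×-dec (a ∈ᴾ? π)) pts → Contains π ℓ
          contains π h =
            let on? = λ a → (a ∈ᴸ? ℓ) ×-dec (a ∈ᴾ? π)
                (a , b , a≢b , a∈ , b∈) = two-members (Unique.filter⁺ on? pts-unique) h
                (_ , aℓ , aπ) = ∈-filter⁻ on? {xs = pts} a∈
                (_ , bℓ , bπ) = ∈-filter⁻ on? {xs = pts} b∈
            in a , b , a≢b , (aℓ , bℓ) , (aπ , bπ)

      good? : ∀ π → Dec (¬ (on pts pts-unique π < M) × ¬ Bad π)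
      good? π = ¬? (poor? π) ×-dec ¬? (bad? π)

      good : List Plane
      good = filter good? planes

      -- At most a quarter of the q³ planes is poor, and at most a quarter is bad: q planes for each
      -- of at most q²/4 rich lines.
      many-good : q * (q * q) ≤ 2 * length good
      many-good = *-cancelˡ-≤ 2 (+-cancelʳ-≤ (2 * (q * (q * q))) _ _ (begin
        2 * (q * (q * q)) + 2 * (q * (q * q))
          ≡⟨ *-distribʳ-+ (q * (q * q)) 2 2 ⟨
        4 * (q * (q * q))
          ≤⟨ *-monoʳ-≤ 4 total ⟩
        4 * (length good + (count poor? planes + count bad? planes))
          ≡⟨ regroup (length good) (count poor? planes) (count bad? planes) ⟩
        2 * (2 * length good) + (4 * count poor? planes + 4 * count bad? planes)
          ≤⟨ +-monoʳ-≤ (2 * (2 * length good)) (≤-trans (+-mono-≤ few-poor few-bad′) (≤-reflexive (cong (q * (q * q) +_) (sym (+-identityʳ _))))) ⟩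
        2 * (2 * length good) + 2 * (q * (q * q)) ∎))
        where
        open ≤-Reasoning
        regroup : ∀ g p b → 4 * (g + (p + b)) ≡ 2 * (2 * g) + (4 * p + 4 * b)
        regroup = solve-∀
        total : q * (q * q) ≤ length good + (count poor? planes + count bad? planes)
        total = begin
          q * (q * q)
            ≡⟨ length-planes ⟨
          length planes
            ≤⟨ length≤count+count good? (λ π → poor? π ⊎-dec bad? π) planes (λ π _ → dichotomy π) ⟩
          length good + count (λ π → poor? π ⊎-dec bad? π) planes
            ≤⟨ +-monoʳ-≤ (length good) (count-⊎ poor? bad? planes) ⟩
          length good + (count poor? planes + count bad? planes) ∎
          where
          dichotomy : ∀ π → ¬ (¬ (on pts pts-unique π < M) × ¬ Bad π) → on pts pts-unique π < M ⊎ Bad π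
          dichotomy π h with poor? π | bad? π
          ... | yes p | _     = inj₁ p
          ... | no _  | yes b = inj₂ b
          ... | no ¬p | no ¬b = contradiction (¬p , ¬b) h
        -- Chebyshev gives P N ≤ 4q⁴ for the number P of poor planes, and N ≥ 16q turns this into 4P
        -- ≤ q³.
        few-poor : 4 * count poor? planes ≤ q * (q * q)
        few-poor = *-cancelˡ-≤ (4 * q) {{m*n≢0 4 q}} (begin
          4 * q * (4 * count poor? planes)
            ≡⟨ reorder 4 q (count poor? planes) ⟩
          count poor? planes * (16 * (q * 1))
            ≤⟨ *-monoʳ-≤ (count poor? planes) (≤-trans (*-monoʳ-≤ 16 (*-monoʳ-≤ q 1≤k)) (qk≤N 16 (≤ᵇ⇒≤ 16 128 _))) ⟩
          count poor? planes * N
            ≡⟨ cong (count poor? planes *_) length-pts ⟨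
          count poor? planes * length pts
            ≤⟨ few-poor-planes pts pts-unique {M} 2qM≤N 0<N ⟩
          4 * (q * (q * (q * q)))
            ≡⟨ *-assoc 4 q _ ⟨
          4 * q * (q * (q * q)) ∎)
          where
          reorder : ∀ m q c → m * q * (m * c) ≡ c * (m * m * (q * 1))
          reorder = solve-∀
          2qM≤N : 2 * (q * M) ≤ length pts
          2qM≤N = subst₂ _≤_ (rearrange 64 q k) (sym length-pts) N≥
            where
            rearrange : ∀ c q k → 2 * c * (q * k) ≡ 2 * (q * (c * k))
            rearrange = solve-∀
          0<N : 0 < length pts
          0<N = subst (1 ≤_) (sym length-pts) (≤-trans (*-mono-≤ {1} {128} (s≤s z≤n) (*-mono-≤ 0<q 1≤k)) N≥)
        few-bad′ : 4 * count bad? planes ≤ q * (q * q)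
        few-bad′ = begin
          4 * count bad? planes         ≤⟨ *-monoʳ-≤ 4 few-bad ⟩
          4 * (length richLines * q)    ≡⟨ *-assoc 4 (length richLines) q ⟨
          4 * length richLines * q      ≤⟨ *-monoˡ-≤ q few-rich ⟩
          q * q * q                     ≡⟨ *-assoc q q q ⟩
          q * (q * q)                   ∎

      W : Plane → List V
      W π = filter (_∈ᴾ? π) pts

      p : Plane → ℕ → V
      p π s = nth origin₀ (W π) s

      module _ {π} (π∈ : π ∈ good) where

        M≤length-W : M ≤ length (W π)
        M≤length-W = ≮⇒≥ (proj₁ (proj₂ (∈-filter⁻ good? {xs = planes} π∈)))

        ¬bad : ¬ Bad π
        ¬bad = proj₂ (proj₂ (∈-filter⁻ good? {xs = planes} π∈))

        p∈W : ∀ {s} → s < M → p π s ∈ W π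
        p∈W s<M = nth-∈ origin₀ (W π) (<-≤-trans s<M M≤length-W)

        p∈pts : ∀ {s} → s < M → p π s ∈ pts
        p∈pts s<M = proj₁ (∈-filter⁻ (_∈ᴾ? π) {xs = pts} (p∈W s<M))

        p∈π : ∀ {s} → s < M → p π s ∈ᴾ π
        p∈π s<M = proj₂ (∈-filter⁻ (_∈ᴾ? π) {xs = pts} (p∈W s<M))

        p-injective : ∀ {s t} → s < M → t < M → p π s ≡ p π t → s ≡ t
        p-injective s<M t<M = nth-injective origin₀ (Unique.filter⁺ (_∈ᴾ? π) pts-unique)
          (<-≤-trans s<M M≤length-W) (<-≤-trans t<M M≤length-W)

        -- All the positions counted lie on one line, the only one through the two given points. It
        -- meets the plane in these two points of U, so it is not rich, as the plane would be bad;
        -- hence it holds fewer than 8k points.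
        few-collinear : ∀ {s t} → s < M → t < M → s ≢ t → count (λ u → Col? (p π s) (p π t) (p π u)) (upTo M) ≤ 8 * k
        few-collinear {s} {t} s<M t<M s≢t =
          AtMost⇒count≤ (λ u → Col? (p π s) (p π t) (p π u)) (Unique.upTo⁺ M) bound
          where
          ps≢pt : p π s ≢ p π t
          ps≢pt eq = s≢t (p-injective s<M t<M eq)
          bound : AtMost (8 * k) (λ u → u ∈ upTo M × Col (p π s) (p π t) (p π u))
          bound [] _ _ = z≤n
          bound us@(_ ∷ _) uniq cols@((_ , col) ∷ _) with find col
          ... | ℓ , ℓ∈ , sℓ , tℓ , _ = ≤-trans
              (AtMost-map (p π) {Q = λ u → u < M × p π u ∈ᴸ ℓ}
                (λ (u< , _) (u′< , _) → p-injective u< u′<)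
                (λ (u< , uℓ) → ∈-filter⁺ (_∈ᴸ? ℓ) (p∈pts u<) uℓ)
                (λ xs uniq xs∈ → Rank.Unique-⊆⇒length≤ Fin._≟_ xs (filter (_∈ᴸ? ℓ) pts) uniq (All.lookup xs∈))
                us uniq (All.map on-ℓ cols))
              (<⇒≤ (≰⇒> ¬rich))
            where
            on-ℓ : ∀ {u} → u ∈ upTo M × Col (p π s) (p π t) (p π u) → u < M × p π u ∈ᴸ ℓ
            on-ℓ (u∈ , col) with find col
            ... | ℓ′ , _ , sℓ′ , tℓ′ , uℓ′ with line-unique ℓ ℓ′ ps≢pt sℓ tℓ sℓ′ tℓ′
            ...   | refl = ∈-upTo⁻ u∈ , uℓ′
            ¬rich : ¬ Rich ℓ
            ¬rich rich = ¬bad (lose (∈-filter⁺ rich? ℓ∈ rich)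
              (Rank.Unique-⊆⇒length≤ Fin._≟_ (p π s ∷ p π t ∷ []) (filter on? pts)
                ((ps≢pt ∷ []) ∷ [] ∷ [])
                (λ { (here refl)         → ∈-filter⁺ on? (p∈pts s<M) (sℓ , p∈π s<M)
                   ; (there (here refl)) → ∈-filter⁺ on? (p∈pts t<M) (tℓ , p∈π t<M) })))
              where
              on? : ∀ a → Dec (a ∈ᴸ ℓ × a ∈ᴾ π)
              on? a = (a ∈ᴸ? ℓ) ×-dec (a ∈ᴾ? π)

      transport : ∀ {a b π} → a ≡ b → b ∈ᴾ π → a ∈ᴾ π
      transport refl h = h

      module G = GeneralPosition good (Unique.filter⁺ good? planes-unique) p M
        (λ π∈ → p-injective π∈) Col?
        (λ {π} {π′} π∈ π∈′ s< t< u< s′< t′< u′< ¬col eq eq′ eq″ → noncollinear-plane-unique π π′ ¬col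
          (p∈π π∈ s<) (p∈π π∈ t<) (p∈π π∈ u<)
          (transport {π = π′} eq (p∈π π∈′ s′<)) (transport {π = π′} eq′ (p∈π π∈′ t′<)) (transport {π = π′} eq″ (p∈π π∈′ u′<)))
        q (λ π → toℕ (proj₁ π)) (λ π → toℕ (proj₁ (proj₂ π))) (λ _ → Fin.toℕ<n _) (λ _ → Fin.toℕ<n _)
        (λ {π} {π′} π∈ π∈′ s< s′< eq → slope-injective π π′ (p∈π π∈ s<) (transport {π = π′} eq (p∈π π∈′ s′<)))
        pencil pencil<q
        (λ {π} {π′} π∈ π∈′ s< t< s′< t′< s≢t eq eq′ lab≡ → pencil-injective π π′
          (λ h → s≢t (p-injective π∈ s< t< h)) (p∈π π∈ s<) (p∈π π∈ t<)
          (transport {π = π′} eq (p∈π π∈′ s′<)) (transport {π = π′} eq′ (p∈π π∈′ t′<))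
          (trans lab≡ (sym (cong₂ (λ x y → pencil x y π′) eq eq′))))

      edge-valid : ∀ {e} → e ∈ G.I → 𝒮₄ U (G.edge e)
      edge-valid {e} e∈ =
        G.edge-vertices {_∈ˢ U} e (λ m → ∈-elements⁻ (p∈pts B∈ (s<M m))) ,
        G.∣edge∣ e∈ ,
        planeFlat (proj₁ e) ,
        G.edge-vertices {λ x → point x ∈ᶠ planeFlat (proj₁ e)} e (λ m → ∈-planeFlat (proj₁ e) (p∈π B∈ (s<M m)))
        where open G.Valid (G.∈I⇒Valid e∈)

      qM≤N : q * M ≤ N
      qM≤N = ≤-trans (≤-reflexive (rearrange 64 q k)) (qk≤N 64 (≤ᵇ⇒≤ 64 128 _))
        where
        rearrange : ∀ c q k → q * (c * k) ≡ c * (q * k)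
        rearrange = solve-∀

      degrees : ∀ i → 1 ≤ i → i ≤ 3 → Δ U i G.edges * q ≤ N ^ (4 ∸ i) * 256
      degrees i 1≤i i≤3 = scale-degree {D = G.D i} (G.Δ≤ U i≤3 (G.patterns i 1≤i i≤3)) (bound i 1≤i i≤3)
        where
        bound : ∀ i → 1 ≤ i → i ≤ 3 → G.D i * q ≤ N ^ (4 ∸ i)
        bound 1 _ _ = cube-bound {q} {M} qM≤N
        bound 2 _ _ = square-bound {q} {M} qM≤N
        bound 3 _ _ = linear-bound {q} {M} qM≤N
        bound (suc (suc (suc (suc _)))) _ (s≤s (s≤s (s≤s ())))

      balanced : Balanced
      balanced = G.edges , G.edges-unique , G.edges-All edge-valid ,
        planes-size {g = length good} {i = length G.I} {e = length G.edges} {k = k} many-good (G.length-I≥ {8 * k} {32 * k} (room 1≤k)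
          (λ π∈ s< t< s≢t → few-collinear π∈ s< t< s≢t)) G.length-I≤ , degrees

  -- With N ≤ 256qk the collision bound reads n²k ≤ 256q (X + nk). From n ≥ q²/8 and q ≥ 4096
  -- follows n ≥ 512q, so the term nk absorbs at most half of the left side and X ≥ n²k / 512q ≥ q³k
  -- / (512 · 64). Each crossing carries k³ parameters, and each edge at most 256 of them.
  cross-size : ∀ {n q N k X i e} → q * q ≤ 8 * n → 4096 ≤ q → N ≤ 256 * (q * k) → 1 ≤ k →
               n * k * (n * k) ≤ N * (X + n * k) → i ≡ X * (k * (k * k)) → i ≤ e * 256 →
               q * (q * q) * (k * (k * (k * k))) ≤ e * 8388608
  cross-size {n} {q} {N} {k} {X} {i} {e} q²≤ 4096≤q N≤ 1≤k collide refl i≤ = begin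
    q * (q * q) * (k * (k * (k * k)))     ≡⟨ regroup (q * (q * q)) k (k * (k * k)) ⟩
    q * (q * q) * k * (k * (k * k))       ≤⟨ *-monoˡ-≤ (k * (k * k)) q³k≤ ⟩
    X * 32768 * (k * (k * k))             ≡⟨ swap X 32768 (k * (k * k)) ⟩
    X * (k * (k * k)) * 32768             ≤⟨ *-monoˡ-≤ 32768 i≤ ⟩
    e * 256 * 32768                       ≡⟨ *-assoc e 256 32768 ⟩
    e * 8388608                           ∎
    where
    open ≤-Reasoning
    instance
      k≢0 : NonZero k
      k≢0 = >-nonZero 1≤k
      q≢0 : NonZero q
      q≢0 = >-nonZero (≤-trans (s≤s z≤n) 4096≤q)
    regroup : ∀ a k b → a * (k * b) ≡ a * k * b
    regroup = solve-∀
    swap : ∀ a b c → a * b * c ≡ a * c * b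
    swap = solve-∀
    n²k≤ : n * n * k ≤ q * 256 * (X + n * k)
    n²k≤ = *-cancelʳ-≤ _ _ k (begin
      n * n * k * k                   ≡⟨ square n k ⟩
      n * k * (n * k)                 ≤⟨ collide ⟩
      N * (X + n * k)                 ≤⟨ *-monoˡ-≤ (X + n * k) N≤ ⟩
      256 * (q * k) * (X + n * k)     ≡⟨ move 256 q k (X + n * k) ⟩
      q * 256 * (X + n * k) * k       ∎)
      where
      square : ∀ n k → n * n * k * k ≡ n * k * (n * k)
      square = solve-∀
      move : ∀ c q k y → c * (q * k) * y ≡ q * c * y * k
      move = solve-∀
    q512≤n : q * 512 ≤ n
    q512≤n = *-cancelʳ-≤ _ _ 8 (begin
      q * 512 * 8      ≡⟨ *-assoc q 512 8 ⟩
      q * 4096         ≤⟨ *-monoʳ-≤ q 4096≤q ⟩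
      q * q            ≤⟨ q²≤ ⟩
      8 * n            ≡⟨ *-comm 8 n ⟩
      n * 8            ∎)
    -- At most half of n²k comes from the diagonal term.
    n²k≤X : n * n * k ≤ q * 512 * X
    n²k≤X = +-cancelʳ-≤ (n * n * k) _ _ (begin
      n * n * k + n * n * k                              ≡⟨ double (n * n * k) ⟩
      n * n * k * 2                                      ≤⟨ *-monoˡ-≤ 2 n²k≤ ⟩
      q * 256 * (X + n * k) * 2                          ≡⟨ expand q 256 X n k ⟩
      q * (256 * 2) * X + q * (256 * 2) * n * k          ≤⟨ +-monoʳ-≤ (q * 512 * X) (*-monoˡ-≤ k (*-monoˡ-≤ n q512≤n)) ⟩
      q * 512 * X + n * n * k                            ∎)
      where
      double : ∀ a → a + a ≡ a * 2
      double = solve-∀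
      expand : ∀ q c X n k → q * c * (X + n * k) * 2 ≡ q * (c * 2) * X + q * (c * 2) * n * k
      expand = solve-∀
    q³k≤ : q * (q * q) * k ≤ X * 32768
    q³k≤ = *-cancelˡ-≤ q (begin
      q * (q * (q * q) * k)         ≡⟨ fourth q k ⟩
      q * q * (q * q) * k           ≤⟨ *-monoˡ-≤ k (*-mono-≤ q²≤ q²≤) ⟩
      8 * n * (8 * n) * k           ≡⟨ gather 8 n k ⟩
      n * n * k * (8 * 8)           ≤⟨ *-monoˡ-≤ 64 n²k≤X ⟩
      q * 512 * X * 64              ≡⟨ reorder q 512 X 64 ⟩
      q * (X * (512 * 64))          ∎)
      where
      fourth : ∀ q k → q * (q * (q * q) * k) ≡ q * q * (q * q) * k
      fourth = solve-∀
      gather : ∀ c n k → c * n * (c * n) * k ≡ n * n * k * (c * c)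
      gather = solve-∀
      reorder : ∀ q c X d → q * c * X * d ≡ q * (X * (c * d))
      reorder = solve-∀

  -- If the incidences I between n ≤ q² lines and a set of s points, each on at
  -- least 2q of the lines, satisfy I² ≤ n (I + s²), then I ≤ 2n.
  high-incidences : ∀ {n q s I} → n ≤ q * q → s * (2 * q) ≤ I → I * I ≤ n * (I + s * s) → I ≤ 2 * n
  high-incidences {n} {q} {s} {zero} _ _ _ = z≤n
  high-incidences {n} {q} {s} {I@(suc _)} n≤ s≤ cs = *-cancelˡ-≤ 2 (*-cancelʳ-≤ (2 * I) (2 * (2 * n)) I (begin
    2 * I * I                ≤⟨ *-monoˡ-≤ I (*-monoˡ-≤ I {2} {3} (n≤1+n 2)) ⟩
    3 * I * I                ≤⟨ +-cancelʳ-≤ (I * I) _ _ main ⟩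
    2 * (2 * n) * I          ∎))
    where
    open ≤-Reasoning
    -- The threshold 2q and n ≤ q² give 4ns² ≤ (2qs)² ≤ I², so that four times the assumed
    -- inequality leaves 3I² ≤ 4nI.
    main : 3 * I * I + I * I ≤ 2 * (2 * n) * I + I * I
    main = begin
      3 * I * I + I * I                    ≡⟨ four I ⟩
      4 * (I * I)                          ≤⟨ *-monoʳ-≤ 4 cs ⟩
      4 * (n * (I + s * s))                ≡⟨ expand n I s ⟩
      2 * (2 * n) * I + n * (4 * (s * s))  ≤⟨ +-monoʳ-≤ (2 * (2 * n) * I) (≤-trans (*-monoˡ-≤ (4 * (s * s)) n≤)
                                                (≤-trans (≤-reflexive (square q s)) (*-mono-≤ s≤ s≤))) ⟩
      2 * (2 * n) * I + I * I              ∎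
      where
      four : ∀ I → 3 * I * I + I * I ≡ 4 * (I * I)
      four = solve-∀
      expand : ∀ n I s → 4 * (n * (I + s * s)) ≡ 2 * (2 * n) * I + n * (4 * (s * s))
      expand = solve-∀
      square : ∀ q s → q * q * (4 * (s * s)) ≡ s * (2 * q) * (s * (2 * q))
      square = solve-∀

  -- The case of many rich lines

  module ManyRichLines
    {q : ℕ} (F : FiniteField q) (U : AffineSpace.PointSet F 3) (k : ℕ) (1≤k : 1 ≤ k) (4096≤q : 4096 ≤ q)
    (N≥ : 128 * (q * k) ≤ ∣ U ∣) (N≤ : ∣ U ∣ ≤ 256 * (q * k))
    where

    open AffineSpace F 3
    open Geometry F
    open Counting F
    open Cases F U k 1≤k 4096≤q N≥

    module _ (many-rich : q * q ≤ 4 * length richLines) where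

      -- The cap q² is what `high-incidences` requires; at least q²/4 lines remain.
      someLines : List Line
      someLines = take (q * q) richLines

      someLines-unique : Unique someLines
      someLines-unique = Unique.take⁺ (q * q) richLines-unique

      n₀ : ℕ
      n₀ = length someLines

      n₀≡ : n₀ ≡ (q * q) ⊓ length richLines
      n₀≡ = length-take (q * q) richLines

      n₀≤q² : n₀ ≤ q * q
      n₀≤q² = subst (_≤ q * q) (sym n₀≡) (m⊓n≤m (q * q) _)

      q²≤4n₀ : q * q ≤ 4 * n₀
      q²≤4n₀ = subst (λ m → q * q ≤ 4 * m) (sym n₀≡) (case (⊓-sel (q * q) (length richLines)))
        where
        case : (q * q) ⊓ length richLines ≡ q * q ⊎ (q * q) ⊓ length richLines ≡ length richLines →
               q * q ≤ 4 * ((q * q) ⊓ length richLines)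
        case (inj₁ eq) rewrite eq = m≤n*m (q * q) 4
        case (inj₂ eq) rewrite eq = many-rich

      someLines-rich : ∀ {ℓ} → ℓ ∈ someLines → Rich ℓ
      someLines-rich ℓ∈ = proj₂ (∈-filter⁻ rich? {xs = lines} (All.lookup (All.take⁺ (q * q) (All.tabulate (λ m → m))) ℓ∈))

      multiplicity : V → ℕ
      multiplicity y = count (y ∈ᴸ?_) someLines

      -- The threshold is the r of `CrossingBlocks`. It has to be O(q) for the degrees, and its
      -- factor 2 lets `high-incidences` absorb the pairs of distinct high points.
      High : V → Set
      High y = 2 * q ≤ multiplicity y

      high? : ∀ y → Dec (High y)
      high? y = 2 * q ≤? multiplicity y

      high low : List V
      high = filter high? pts
      low  = filter (λ y → ¬? (high? y)) pts

      highOn : Line → ℕ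
      highOn ℓ = count (_∈ᴸ? ℓ) high

      ∑-highOn : ∑ someLines highOn ≡ ∑ high multiplicity
      ∑-highOn = begin-equality
        ∑ someLines highOn                                  ≡⟨ ∑-cong someLines (λ ℓ _ → count≡∑ (_∈ᴸ? ℓ) high) ⟩
        ∑ someLines (λ ℓ → ∑ high (λ y → 𝟙 (y ∈ᴸ? ℓ)))      ≡⟨ ∑-swap someLines high (λ ℓ y → 𝟙 (y ∈ᴸ? ℓ)) ⟩
        ∑ high (λ y → ∑ someLines (λ ℓ → 𝟙 (y ∈ᴸ? ℓ)))      ≡⟨ ∑-cong high (λ y _ → count≡∑ (y ∈ᴸ?_) someLines) ⟨
        ∑ high multiplicity                                 ∎
        where open ≤-Reasoning

      -- Two distinct points share at most one line, so the pairs off the diagonal contribute at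
      -- most the square of the number of high points; the diagonal returns the incidences
      -- themselves.
      ∑-highOn² : ∑ someLines (λ ℓ → highOn ℓ * highOn ℓ) ≤ ∑ someLines highOn + length high * length high
      ∑-highOn² = begin
        ∑ someLines (λ ℓ → highOn ℓ * highOn ℓ)
          ≡⟨ ∑-cong someLines (λ ℓ _ → trans (cong₂ _*_ (count≡∑ (_∈ᴸ? ℓ) high) (count≡∑ (_∈ᴸ? ℓ) high)) (∑-* high high _ _)) ⟩
        ∑ someLines (λ ℓ → ∑ high (λ y → ∑ high (λ z → 𝟙 (y ∈ᴸ? ℓ) * 𝟙 (z ∈ᴸ? ℓ))))
          ≡⟨ ∑-swap someLines high (λ ℓ y → ∑ high (λ z → 𝟙 (y ∈ᴸ? ℓ) * 𝟙 (z ∈ᴸ? ℓ))) ⟩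
        ∑ high (λ y → ∑ someLines (λ ℓ → ∑ high (λ z → 𝟙 (y ∈ᴸ? ℓ) * 𝟙 (z ∈ᴸ? ℓ))))
          ≡⟨ ∑-cong high (λ y _ → ∑-swap someLines high (λ ℓ z → 𝟙 (y ∈ᴸ? ℓ) * 𝟙 (z ∈ᴸ? ℓ))) ⟩
        ∑ high (λ y → ∑ high (λ z → ∑ someLines (λ ℓ → 𝟙 (y ∈ᴸ? ℓ) * 𝟙 (z ∈ᴸ? ℓ))))
          ≤⟨ ∑-mono high (λ y _ → ∑-mono high (λ z _ → joint y z)) ⟩
        ∑ high (λ y → ∑ high (λ z → 𝟙 (y Fin.≟ z) * multiplicity y + 1))
          ≡⟨ ∑-cong high (λ y _ → trans (∑-+ high _ _) (cong₂ _+_ (∑-*ʳ high _ (multiplicity y)) (trans (∑-const high 1) (*-identityʳ _)))) ⟩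
        ∑ high (λ y → ∑ high (λ z → 𝟙 (y Fin.≟ z)) * multiplicity y + length high)
          ≤⟨ ∑-mono high (λ y _ → +-monoˡ-≤ (length high) (≤-trans
               (*-monoˡ-≤ (multiplicity y) (∑𝟙≟≤1 Fin._≟_ high y (Unique.filter⁺ high? pts-unique))) (≤-reflexive (*-identityˡ _)))) ⟩
        ∑ high (λ y → multiplicity y + length high)
          ≡⟨ trans (∑-+ high _ _) (cong₂ _+_ (sym ∑-highOn) (∑-const high (length high))) ⟩
        ∑ someLines highOn + length high * length high ∎
        where
        open ≤-Reasoning
        joint : ∀ y z → ∑ someLines (λ ℓ → 𝟙 (y ∈ᴸ? ℓ) * 𝟙 (z ∈ᴸ? ℓ)) ≤ 𝟙 (y Fin.≟ z) * multiplicity y + 1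
        joint y z with y Fin.≟ z
        ... | yes refl = ≤-trans (≤-trans (∑-mono someLines (λ ℓ _ → idem (y ∈ᴸ? ℓ)))
                  (≤-reflexive (trans (sym (count≡∑ (y ∈ᴸ?_) someLines)) (sym (+-identityʳ _))))) (m≤m+n _ 1)
          where
          idem : ∀ {P : Set} (P? : Dec P) → 𝟙 P? * 𝟙 P? ≤ 𝟙 P?
          idem (yes _) = ≤-refl
          idem (no _)  = ≤-refl
        ... | no y≢z = subst (_≤ 1)
          (trans (count≡∑ (λ ℓ → (y ∈ᴸ? ℓ) ×-dec (z ∈ᴸ? ℓ)) someLines) (∑-cong someLines (λ ℓ _ → 𝟙-× (y ∈ᴸ? ℓ) (z ∈ᴸ? ℓ))))
          (AtMost⇒count≤ (λ ℓ → (y ∈ᴸ? ℓ) ×-dec (z ∈ᴸ? ℓ)) someLines-unique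
            (AtMost-one (λ ℓ ℓ′ (_ , y∈ , z∈) (_ , y∈′ , z∈′) → line-unique ℓ ℓ′ y≢z y∈ z∈ y∈′ z∈′)))

      ∑-highOn≤ : ∑ someLines highOn ≤ 2 * n₀
      ∑-highOn≤ = high-incidences {n₀} {q} {length high} n₀≤q²
        (≤-trans (≤-trans (≤-reflexive (sym (∑-const high (2 * q))))
          (∑-mono high (λ y y∈ → proj₂ (∈-filter⁻ high? {xs = pts} y∈)))) (≤-reflexive (sym ∑-highOn)))
        (≤-trans (cauchy-schwarz someLines highOn) (*-monoʳ-≤ n₀ ∑-highOn²))

      lowOn : Line → List V
      lowOn ℓ = filter (_∈ᴸ? ℓ) low

      good? : ∀ ℓ → Dec (4 * k ≤ length (lowOn ℓ))
      good? ℓ = 4 * k ≤? length (lowOn ℓ)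

      Bs : List Line
      Bs = filter good? someLines

      Bs-unique : Unique Bs
      Bs-unique = Unique.filter⁺ good? someLines-unique

      8k≤ : ∀ {ℓ} → ℓ ∈ someLines → 8 * k ≤ length (lowOn ℓ) + highOn ℓ
      8k≤ {ℓ} ℓ∈ = begin
        8 * k
          ≤⟨ someLines-rich ℓ∈ ⟩
        length (filter (_∈ᴸ? ℓ) pts)
          ≤⟨ length≤count+count (λ y → ¬? (high? y)) high? (filter (_∈ᴸ? ℓ) pts) (λ y _ ¬low → decidable-stable (high? y) ¬low) ⟩
        count (λ y → ¬? (high? y)) (filter (_∈ᴸ? ℓ) pts) + count high? (filter (_∈ᴸ? ℓ) pts)
          ≡⟨ cong₂ _+_ (filter-comm (λ y → ¬? (high? y)) (_∈ᴸ? ℓ) pts) (filter-comm high? (_∈ᴸ? ℓ) pts) ⟩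
        length (lowOn ℓ) + highOn ℓ ∎
        where
        open ≤-Reasoning
        filter-comm : ∀ {P Q : Pred V 0ℓ} (P? : Decidable P) (Q? : Decidable Q) xs →
                      count P? (filter Q? xs) ≡ count Q? (filter P? xs)
        filter-comm P? Q? xs = trans (count-filter P? Q? xs) (trans (≤-antisym
          (count-mono (λ x → P? x ×-dec Q? x) (λ x → Q? x ×-dec P? x) xs (λ x _ (p , q) → q , p))
          (count-mono (λ x → Q? x ×-dec P? x) (λ x → P? x ×-dec Q? x) xs (λ x _ (q , p) → p , q)))
          (sym (count-filter Q? P? xs)))

      -- A rich line with fewer than 4k low points has at least 4k ≥ 4 high ones. The incidences
      -- with high points number at most 2n₀, so at most half of the lines are lost.
      n₀≤2n : n₀ ≤ 2 * length Bs
      n₀≤2n = *-cancelˡ-≤ 2 (+-cancelʳ-≤ (2 * n₀) _ _ (begin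
        2 * n₀ + 2 * n₀
          ≡⟨ *-distribʳ-+ n₀ 2 2 ⟨
        4 * n₀
          ≤⟨ *-monoʳ-≤ 4 (length≤count+count good? (λ ℓ → ¬? (good? ℓ)) someLines (λ _ _ ¬g → ¬g)) ⟩
        4 * (length Bs + count (λ ℓ → ¬? (good? ℓ)) someLines)
          ≡⟨ expand (length Bs) (count (λ ℓ → ¬? (good? ℓ)) someLines) ⟩
        2 * (2 * length Bs) + count (λ ℓ → ¬? (good? ℓ)) someLines * 4
          ≤⟨ +-monoʳ-≤ (2 * (2 * length Bs)) (≤-trans (count-*≤∑ (λ ℓ → ¬? (good? ℓ)) someLines highOn 4 (λ ℓ → spoiled)) ∑-highOn≤) ⟩
        2 * (2 * length Bs) + 2 * n₀ ∎))
        where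
        open ≤-Reasoning
        expand : ∀ g b → 4 * (g + b) ≡ 2 * (2 * g) + b * 4
        expand = solve-∀
        spoiled : ∀ {ℓ} → ℓ ∈ someLines → ¬ (4 * k ≤ length (lowOn ℓ)) → 4 ≤ highOn ℓ
        spoiled {ℓ} ℓ∈ ¬g = +-cancelˡ-≤ (4 * k) _ _ (begin
          4 * k + 4                        ≤⟨ +-monoʳ-≤ (4 * k) (m≤m*n 4 k) ⟩
          4 * k + 4 * k                    ≡⟨ *-distribʳ-+ k 4 4 ⟨
          8 * k                            ≤⟨ 8k≤ ℓ∈ ⟩
          length (lowOn ℓ) + highOn ℓ      ≤⟨ +-monoˡ-≤ (highOn ℓ) (<⇒≤ (≰⇒> ¬g)) ⟩
          4 * k + highOn ℓ                 ∎)

      p : Line → ℕ → V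
      p ℓ s = nth origin₀ (lowOn ℓ) s

      low-unique : Unique low
      low-unique = Unique.filter⁺ (λ y → ¬? (high? y)) pts-unique

      module R = Rank _≟ᴸ_

      -- The place of ℓ among the selected lines through y. It is below 2q because the points kept
      -- on the lines are low.
      label : Line → V → ℕ
      label ℓ y = R.rank (filter (y ∈ᴸ?_) someLines) ℓ

      module _ {ℓ} (ℓ∈ : ℓ ∈ Bs) where

        ℓ∈some : ℓ ∈ someLines
        ℓ∈some = proj₁ (∈-filter⁻ good? {xs = someLines} ℓ∈)

        4k≤ : 4 * k ≤ length (lowOn ℓ)
        4k≤ = proj₂ (∈-filter⁻ good? {xs = someLines} ℓ∈)

        p∈lowOn : ∀ {s} → s < 4 * k → p ℓ s ∈ lowOn ℓ
        p∈lowOn s< = nth-∈ origin₀ (lowOn ℓ) (<-≤-trans s< 4k≤)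

        p∈ℓ : ∀ {s} → s < 4 * k → p ℓ s ∈ᴸ ℓ
        p∈ℓ s< = proj₂ (∈-filter⁻ (_∈ᴸ? ℓ) {xs = low} (p∈lowOn s<))

        p∈low : ∀ {s} → s < 4 * k → p ℓ s ∈ low
        p∈low s< = proj₁ (∈-filter⁻ (_∈ᴸ? ℓ) {xs = low} (p∈lowOn s<))

        p∈pts : ∀ {s} → s < 4 * k → p ℓ s ∈ pts
        p∈pts s< = proj₁ (∈-filter⁻ (λ y → ¬? (high? y)) {xs = pts} (p∈low s<))

        p-injective : ∀ {s t} → s < 4 * k → t < 4 * k → p ℓ s ≡ p ℓ t → s ≡ t
        p-injective s< t< = nth-injective origin₀ (Unique.filter⁺ (_∈ᴸ? ℓ) low-unique) (<-≤-trans s< 4k≤) (<-≤-trans t< 4k≤)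

        ℓ∈pencil : ∀ {s} → s < 4 * k → ℓ ∈ filter (p ℓ s ∈ᴸ?_) someLines
        ℓ∈pencil s< = ∈-filter⁺ (p ℓ _ ∈ᴸ?_) ℓ∈some (p∈ℓ s<)

        label< : ∀ {s} → s < 4 * k → label ℓ (p ℓ s) < 2 * q
        label< s< = <-trans (R.rank<length _ (ℓ∈pencil s<))
          (≰⇒> (proj₂ (∈-filter⁻ (λ y → ¬? (high? y)) {xs = pts} (p∈low s<))))

      transport : ∀ {a b ℓ} → a ≡ b → b ∈ᴸ ℓ → a ∈ᴸ ℓ
      transport refl h = h

      label-injective : ∀ {ℓ ℓ′ s s′} → ℓ ∈ Bs → ℓ′ ∈ Bs → s < 4 * k → s′ < 4 * k → p ℓ s ≡ p ℓ′ s′ →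
                        label ℓ (p ℓ s) ≡ label ℓ′ (p ℓ′ s′) → ℓ ≡ ℓ′
      label-injective {ℓ} {ℓ′} {s} {s′} ℓ∈ ℓ′∈ s< s′< eq lab≡ = R.rank-injective (filter (p ℓ s ∈ᴸ?_) someLines)
        (ℓ∈pencil ℓ∈ s<)
        (subst (λ y → ℓ′ ∈ filter (y ∈ᴸ?_) someLines) (sym eq) (ℓ∈pencil ℓ′∈ s′<))
        (trans lab≡ (cong (label ℓ′) (sym eq)))

      module G = CrossingBlocks _≟ᴸ_ Bs Bs-unique p k
        (λ ℓ∈ → p-injective ℓ∈)
        (λ {ℓ} {ℓ′} ℓ∈ ℓ′∈ s< t< s′< t′< s≢t eq eq′ → line-unique ℓ ℓ′ (λ h → s≢t (p-injective ℓ∈ s< t< h))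
          (p∈ℓ ℓ∈ s<) (p∈ℓ ℓ∈ t<) (transport {ℓ = ℓ′} eq (p∈ℓ ℓ′∈ s′<)) (transport {ℓ = ℓ′} eq′ (p∈ℓ ℓ′∈ t′<)))
        (2 * q) label (λ ℓ∈ → label< ℓ∈) label-injective

      edge-valid : ∀ {e} → e ∈ G.I → 𝒮₄ U (G.edge e)
      edge-valid {e} e∈ =
        G.edge-vertices {_∈ˢ U} e (λ m → ∈-elements⁻ (vertex∈ m)) ,
        G.∣edge∣ e∈ ,
        spanFlat (G.B₁ e) (G.B₂ e) B₁≢B₂ x∈₁ x∈₂ ,
        G.edge-vertices {λ a → point a ∈ᶠ spanFlat (G.B₁ e) (G.B₂ e) B₁≢B₂ x∈₁ x∈₂} e
          (λ m → ∈-spanFlat (G.B₁ e) (G.B₂ e) B₁≢B₂ x∈₁ x∈₂ (on-line m))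
        where
        open G.Valid (G.∈I⇒Valid e∈)
        x∈₁ : p (G.B₁ e) (G.x e) ∈ᴸ G.B₁ e
        x∈₁ = p∈ℓ B₁∈ x<4k
        x∈₂ : p (G.B₁ e) (G.x e) ∈ᴸ G.B₂ e
        x∈₂ = transport {ℓ = G.B₂ e} meet (p∈ℓ B₂∈ x′<4k)
        vertex∈ : ∀ m → G.v m e ∈ pts
        vertex∈ 0F = p∈pts B₁∈ a<4k
        vertex∈ 1F = p∈pts B₁∈ b<4k
        vertex∈ 2F = p∈pts B₂∈ c<4k
        vertex∈ 3F = p∈pts B₂∈ d<4k
        on-line : ∀ m → G.v m e ∈ᴸ G.B₁ e ⊎ G.v m e ∈ᴸ G.B₂ e
        on-line 0F = inj₁ (p∈ℓ B₁∈ a<4k)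
        on-line 1F = inj₁ (p∈ℓ B₁∈ b<4k)
        on-line 2F = inj₂ (p∈ℓ B₂∈ c<4k)
        on-line 3F = inj₂ (p∈ℓ B₂∈ d<4k)

      q8k≤N : q * (8 * k) ≤ N
      q8k≤N = ≤-trans (≤-reflexive (rearrange 8 q k)) (qk≤N 8 (≤ᵇ⇒≤ 8 128 _))
        where
        rearrange : ∀ c q k → q * (c * k) ≡ c * (q * k)
        rearrange = solve-∀

      degrees : ∀ i → 1 ≤ i → i ≤ 3 → Δ U i G.edges * q ≤ N ^ (4 ∸ i) * 256
      degrees i 1≤i i≤3 = scale-degree {D = G.D i} (G.Δ≤ U i≤3 (G.patterns i 1≤i i≤3)) (bound i 1≤i i≤3)
        where
        M = 8 * k
        k≤M : k ≤ M
        k≤M = m≤n*m k 8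
        2qk≤ : 2 * q * k ≤ q * M
        2qk≤ = ≤-trans (*-monoˡ-≤ k (≤-reflexive (*-comm 2 q))) (≤-trans (≤-reflexive (*-assoc q 2 k))
          (*-monoʳ-≤ q (*-monoˡ-≤ k (≤ᵇ⇒≤ 2 8 _))))
        2qk≤N : 2 * q * k ≤ N
        2qk≤N = ≤-trans 2qk≤ q8k≤N
        kq≤N : k * q ≤ N
        kq≤N = ≤-trans (≤-reflexive (*-comm k q)) (≤-trans (*-monoʳ-≤ q k≤M) q8k≤N)
        bound : ∀ i → 1 ≤ i → i ≤ 3 → G.D i * q ≤ N ^ (4 ∸ i)
        bound 1 _ _ = ≤-trans (≤-reflexive (regroup (2 * q) k q)) (*-mono-≤ 2qk≤N (*-mono-≤ 2qk≤N (*-monoˡ-≤ 1 kq≤N)))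
          where
          regroup : ∀ r k q → r * (k * (r * (k * (k * 1)))) * q ≡ r * k * (r * k * (k * q * 1))
          regroup = solve-∀
        bound 2 _ _ = ≤-trans (≤-reflexive (regroup (2 * q) k q)) (*-mono-≤ 2qk≤N (*-monoˡ-≤ 1 kq≤N))
          where
          regroup : ∀ r k q → r * (k * (k * 1)) * q ≡ r * k * (k * q * 1)
          regroup = solve-∀
        bound 3 _ _ = ≤-trans (≤-reflexive (regroup k q)) (*-monoˡ-≤ 1 kq≤N)
          where
          regroup : ∀ k q → k * 1 * q ≡ k * q * 1
          regroup = solve-∀
        bound (suc (suc (suc (suc _)))) _ (s≤s (s≤s (s≤s ())))

      q²≤8n : q * q ≤ 8 * length Bs
      q²≤8n = ≤-trans q²≤4n₀ (≤-trans (*-monoʳ-≤ 4 n₀≤2n) (≤-reflexive (sym (*-assoc 4 2 (length Bs)))))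

      collide : length Bs * k * (length Bs * k) ≤ N * (length G.crossings + length Bs * k)
      collide = subst₂ (λ m N → m * m ≤ N * (length G.crossings + m)) G.length-middles length-pts
        (G.crossings-bound pts pts-unique (λ ℓ∈ → p∈pts ℓ∈))

      balanced : Balanced
      balanced = G.edges , G.edges-unique , G.edges-All edge-valid ,
        cross-size {n = length Bs} {N = N} {X = length G.crossings} {i = length G.I} {e = length G.edges}
          q²≤8n 4096≤q N≤ 1≤k collide G.length-I G.length-I≤ , degrees

open Supersaturation using (module Cases; module ManyRichLines)
open import Data.Fin.Subset using (Subset; ∣_∣)
open import Data.List.Base using (List; length)
open import Data.List.Relation.Unary.All using (All)
open import Data.List.Relation.Unary.Unique.Propositional using (Unique)
open import Data.Nat.Base using (ℕ; _∸_; _^_) renaming (_≤_ to _≤ℕ_)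
open import Data.Product.Base using (∃-syntax; Σ-syntax; _×_)
open import Data.Rational.Base using (ℚ; 0ℚ; _*_; _≤_; _<_)
import Data.Integer.Base as ℤ
import Data.Integer.Properties as ℤ
open import Data.Nat.Base as ℕ using (zero; suc; z≤n; s≤s; NonZero; >-nonZero)
open import Data.Nat.Coprimality using (1-coprimeTo) renaming (sym to coprime-sym)
open import Data.Nat.DivMod using (m≡m%n+[m/n]*n; m%n<n; m/n*n≤m)
import Data.Nat.Properties as ℕ
open import Data.Nat.Tactic.RingSolver using (solve-∀)
open import Data.Product.Base using (_,_)
import Data.Rational.Base as ℚ
open import Data.Rational.Base using (*≤*)
import Data.Rational.Properties as ℚ
open import Data.Sum.Base using (inj₁; inj₂)
open import Relation.Binary.PropositionalEquality using (_≡_; refl; sym; trans; cong; subst; subst₂)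
open import Relation.Nullary.Negation using (contradiction)

-- From natural numbers to the rational statement

fromℕ-mkℚ : ∀ n → fromℕ n ≡ ℚ.mkℚ (ℤ.+ n) 0 (coprime-sym (1-coprimeTo n))
fromℕ-mkℚ n = ℚ.normalize-coprime (coprime-sym (1-coprimeTo n))

fromℕ-mono-≤ : ∀ {m n} → m ≤ℕ n → fromℕ m ≤ fromℕ n
fromℕ-mono-≤ {m} {n} m≤n rewrite fromℕ-mkℚ m | fromℕ-mkℚ n =
  *≤* (subst₂ ℤ._≤_ (sym (ℤ.*-identityʳ (ℤ.+ m))) (sym (ℤ.*-identityʳ (ℤ.+ n))) (ℤ.+≤+ m≤n))

fromℕ-cancel-≤ : ∀ {m n} → fromℕ m ≤ fromℕ n → m ≤ℕ n
fromℕ-cancel-≤ {m} {n} m≤n rewrite fromℕ-mkℚ m | fromℕ-mkℚ n with m≤n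
... | *≤* h = ℤ.drop‿+≤+ (subst₂ ℤ._≤_ (ℤ.*-identityʳ (ℤ.+ m)) (ℤ.*-identityʳ (ℤ.+ n)) h)

fromℕ-* : ∀ m n → fromℕ (m ℕ.* n) ≡ fromℕ m * fromℕ n
fromℕ-* m n rewrite fromℕ-mkℚ m | fromℕ-mkℚ n = cong (ℚ._/ 1) (ℤ.pos-* m n)

fromℕ-^ : ∀ m n → fromℕ (m ^ n) ≡ fromℕ m ^ℚ n
fromℕ-^ m zero    = refl
fromℕ-^ m (suc n) = trans (fromℕ-* m (m ^ n)) (cong (fromℕ m *_) (fromℕ-^ m n))

fromℕ-positive : ∀ n → 1 ≤ℕ n → ℚ.Positive (fromℕ n)
fromℕ-positive (suc n) _ rewrite fromℕ-mkℚ (suc n) = _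

0<fromℕ : ∀ n → 1 ≤ℕ n → 0ℚ < fromℕ n
0<fromℕ n 1≤n = ℚ.positive⁻¹ (fromℕ n) {{fromℕ-positive n 1≤n}}

reciprocal : ∀ n → 1 ≤ℕ n → ℚ
reciprocal n 1≤n = ℚ.1/_ (fromℕ n) {{ℚ.pos⇒nonZero (fromℕ n) {{fromℕ-positive n 1≤n}}}}

0<reciprocal : ∀ n 1≤n → 0ℚ < reciprocal n 1≤n
0<reciprocal n 1≤n = ℚ.positive⁻¹ (reciprocal n 1≤n) {{ℚ.1/pos⇒pos (fromℕ n) {{fromℕ-positive n 1≤n}}}}

reciprocal-*-≤ : ∀ {n x y} 1≤n → x ≤ℕ n ℕ.* y → reciprocal n 1≤n * fromℕ x ≤ fromℕ y
reciprocal-*-≤ {n} {x} {y} 1≤n x≤ny = begin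
  r * fromℕ x                    ≤⟨ ℚ.*-monoˡ-≤-nonNeg r {{nonNeg}} (fromℕ-mono-≤ x≤ny) ⟩
  r * fromℕ (n ℕ.* y)            ≡⟨ cong (r *_) (fromℕ-* n y) ⟩
  r * (fromℕ n * fromℕ y)        ≡⟨ ℚ.*-assoc r (fromℕ n) (fromℕ y) ⟨
  r * fromℕ n * fromℕ y          ≡⟨ cong (_* fromℕ y) (ℚ.*-inverseˡ (fromℕ n) {{nonZero}}) ⟩
  ℚ.1ℚ * fromℕ y                 ≡⟨ ℚ.*-identityˡ (fromℕ y) ⟩
  fromℕ y                        ∎
  where
  open ℚ.≤-Reasoning
  r = reciprocal n 1≤n
  nonZero = ℚ.pos⇒nonZero (fromℕ n) {{fromℕ-positive n 1≤n}}
  nonNeg : ℚ.NonNegative r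
  nonNeg = ℚ.nonNegative (ℚ.<⇒≤ (0<reciprocal n 1≤n))

-- The natural-number bound has the full factor q; cubed it gives q³, which dominates each q^j with
-- j ≤ 3. At this point the stronger degree bounds for i = 2 and 3 are relaxed to the stated ones.
cube-root-≤ : ∀ {δ q X C} j → j ≤ℕ 3 → 1 ≤ℕ q → δ ℕ.* q ≤ℕ X ℕ.* C →
              fromℕ δ ≤ fromℕ C * fromℕ X /∛ (q ^ j)
cube-root-≤ {δ} {q} {X} {C} j j≤3 1≤q h = subst₂ _≤_
  (trans (fromℕ-* (δ ^ 3) (q ^ j)) (cong (_* fromℕ (q ^ j)) (fromℕ-^ δ 3)))
  (trans (fromℕ-^ (C ℕ.* X) 3) (cong (_^ℚ 3) (fromℕ-* C X)))
  (fromℕ-mono-≤ (begin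
    δ ^ 3 ℕ.* q ^ j       ≤⟨ ℕ.*-monoʳ-≤ (δ ^ 3) (ℕ.^-monoʳ-≤ q {{>-nonZero 1≤q}} j≤3) ⟩
    δ ^ 3 ℕ.* q ^ 3       ≡⟨ cubes δ q ⟩
    (δ ℕ.* q) ^ 3         ≤⟨ ℕ.^-monoˡ-≤ 3 h ⟩
    (X ℕ.* C) ^ 3         ≡⟨ cong (_^ 3) (ℕ.*-comm X C) ⟩
    (C ℕ.* X) ^ 3         ∎))
  where
  open ℕ.≤-Reasoning
  cubes : ∀ a b → a ℕ.* (a ℕ.* (a ℕ.* 1)) ℕ.* (b ℕ.* (b ℕ.* (b ℕ.* 1))) ≡
          a ℕ.* b ℕ.* (a ℕ.* b ℕ.* (a ℕ.* b ℕ.* 1))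
  cubes = solve-∀

-- The theorem with natural constants, C standing for 1/c, and with the factor q in all three degree
-- bounds, so that neither fractions nor cube roots occur.
BalancedFamilies : ℕ → ℕ → ℕ → ℕ → Set₁
BalancedFamilies T q₀ C D = ∀ (q : ℕ) → q₀ ≤ℕ q → ∀ (F : FiniteField q) → let open AffineSpace F 3 in
  ∀ (U : PointSet) → T ℕ.* q ≤ℕ ∣ U ∣ →
  Σ[ H ∈ List PointSet ] (Unique H × All (𝒮₄ U) H × ∣ U ∣ ^ 4 ≤ℕ length H ℕ.* q ℕ.* C ×
    (∀ i → 1 ≤ℕ i → i ≤ℕ 3 → Δ U i H ℕ.* q ≤ℕ ∣ U ∣ ^ (4 ∸ i) ℕ.* D))

rational-bounds : ∀ T q₀ C D → 1 ≤ℕ T → 1 ≤ℕ q₀ → 1 ≤ℕ C → 1 ≤ℕ D → BalancedFamilies T q₀ C D →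
  ∃[ T ] ∃[ c ] ∃[ C′ ] ∃[ q₀ ]
    (0ℚ < T × 0ℚ < c × 0ℚ < C′ × 0ℚ < q₀ ×
    (∀ (q : ℕ) → PrimePower q → q₀ ≤ fromℕ q →
    ∀ (F : FiniteField q) →
    let open AffineSpace F 3 in
    ∀ (U : PointSet) → T * fromℕ q ≤ fromℕ ∣ U ∣ →
    Σ[ H ∈ List PointSet ]
    (Unique H × All (𝒮₄ U) H ×
    c * fromℕ (∣ U ∣ ^ 4) ≤ fromℕ (length H) * fromℕ q ×
    (∀ (i : ℕ) → 1 ≤ℕ i → i ≤ℕ 3 →
    fromℕ (Δ U i H) ≤ C′ * fromℕ (∣ U ∣ ^ (4 ∸ i)) /∛ (q ^ (3 ∸ (i ∸ 1)))))))
rational-bounds T q₀ C D 1≤T 1≤q₀ 1≤C 1≤D families =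
  fromℕ T , reciprocal C 1≤C , fromℕ D , fromℕ q₀ ,
  0<fromℕ T 1≤T , 0<reciprocal C 1≤C , 0<fromℕ D 1≤D , 0<fromℕ q₀ 1≤q₀ ,
  λ q _ q₀≤q F U U-large →
    let q₀≤q′ = fromℕ-cancel-≤ q₀≤q
        (H , unique , valid , size , degrees) =
          families q q₀≤q′ F U (fromℕ-cancel-≤ (subst (_≤ fromℕ ∣ U ∣) (sym (fromℕ-* T q)) U-large))
    in H , unique , valid ,
       subst (reciprocal C 1≤C * fromℕ (∣ U ∣ ^ 4) ≤_) (fromℕ-* (length H) q)
         (reciprocal-*-≤ {C} {∣ U ∣ ^ 4} 1≤C (subst (∣ U ∣ ^ 4 ≤ℕ_) (ℕ.*-comm (length H ℕ.* q) C) size)) ,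
       λ i 1≤i i≤3 → cube-root-≤ {Δ U i H} {q} {∣ U ∣ ^ (4 ∸ i)} {D} (3 ∸ (i ∸ 1)) (ℕ.m∸n≤m 3 (i ∸ 1)) (ℕ.≤-trans 1≤q₀ q₀≤q′) (degrees i 1≤i i≤3)

-- (c q k)⁴ is the size bound q³k⁴ times q c⁴; the extra q is the one in N⁴/q.
fourth-power-≤ : ∀ {N q k L} c d → N ≤ℕ c ℕ.* (q ℕ.* k) →
                 q ℕ.* (q ℕ.* q) ℕ.* (k ℕ.* (k ℕ.* (k ℕ.* k))) ≤ℕ L ℕ.* d →
                 N ^ 4 ≤ℕ L ℕ.* q ℕ.* (d ℕ.* c ^ 4)
fourth-power-≤ {N} {q} {k} {L} c d N≤ h = begin
  N ^ 4                                                                             ≤⟨ ℕ.^-monoˡ-≤ 4 N≤ ⟩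
  (c ℕ.* (q ℕ.* k)) ^ 4                                                             ≡⟨ expand c q k ⟩
  q ℕ.* (q ℕ.* q) ℕ.* (k ℕ.* (k ℕ.* (k ℕ.* k))) ℕ.* (q ℕ.* c ^ 4)                   ≤⟨ ℕ.*-monoˡ-≤ (q ℕ.* c ^ 4) h ⟩
  L ℕ.* d ℕ.* (q ℕ.* c ^ 4)                                                         ≡⟨ collect L d q (c ^ 4) ⟩
  L ℕ.* q ℕ.* (d ℕ.* c ^ 4)                                                         ∎
  where
  open ℕ.≤-Reasoning
  expand : ∀ c q k → c ℕ.* (q ℕ.* k) ℕ.* (c ℕ.* (q ℕ.* k) ℕ.* (c ℕ.* (q ℕ.* k) ℕ.* (c ℕ.* (q ℕ.* k) ℕ.* 1))) ≡
           q ℕ.* (q ℕ.* q) ℕ.* (k ℕ.* (k ℕ.* (k ℕ.* k))) ℕ.* (q ℕ.* (c ℕ.* (c ℕ.* (c ℕ.* (c ℕ.* 1)))))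
  expand = solve-∀
  collect : ∀ L d q e → L ℕ.* d ℕ.* (q ℕ.* e) ≡ L ℕ.* q ℕ.* (d ℕ.* e)
  collect = solve-∀

-- k is the quotient of N by 128q, which is at least 1 by hypothesis. Then N < 128q (k + 1) ≤ 256qk,
-- and this costs the factor 2 between the two bounds.
scale : ∀ {q N} → 1 ≤ℕ q → 128 ℕ.* q ≤ℕ N →
        ∃[ k ] (1 ≤ℕ k × 128 ℕ.* (q ℕ.* k) ≤ℕ N × N ≤ℕ 256 ℕ.* (q ℕ.* k))
scale {q} {N} 1≤q 128q≤N = bracket (N ℕ./ (128 ℕ.* q)) (m/n*n≤m N (128 ℕ.* q))
  (subst (ℕ._< 128 ℕ.* q ℕ.+ N ℕ./ (128 ℕ.* q) ℕ.* (128 ℕ.* q)) (sym (m≡m%n+[m/n]*n N (128 ℕ.* q)))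
    (ℕ.+-monoˡ-< (N ℕ./ (128 ℕ.* q) ℕ.* (128 ℕ.* q)) (m%n<n N (128 ℕ.* q))))
  where
  instance
    128q≢0 : NonZero (128 ℕ.* q)
    128q≢0 = ℕ.m*n≢0 128 q {{_}} {{>-nonZero 1≤q}}
  bracket : ∀ k → k ℕ.* (128 ℕ.* q) ≤ℕ N → N ℕ.< 128 ℕ.* q ℕ.+ k ℕ.* (128 ℕ.* q) →
            ∃[ k ] (1 ≤ℕ k × 128 ℕ.* (q ℕ.* k) ≤ℕ N × N ≤ℕ 256 ℕ.* (q ℕ.* k))
  bracket zero    _  N< = contradiction 128q≤N (ℕ.<⇒≱ (subst (N ℕ.<_) (ℕ.+-identityʳ (128 ℕ.* q)) N<))
  bracket (suc k) N≥ N< = suc k , s≤s z≤n ,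
    subst (_≤ℕ N) (reassociate 128 q (suc k)) N≥ ,
    ℕ.≤-trans (ℕ.<⇒≤ N<) (ℕ.≤-trans (ℕ.+-monoˡ-≤ (suc k ℕ.* (128 ℕ.* q)) (ℕ.m≤n*m (128 ℕ.* q) (suc k)))
      (ℕ.≤-reflexive (double 128 q (suc k))))
    where
    reassociate : ∀ c q k → k ℕ.* (c ℕ.* q) ≡ c ℕ.* (q ℕ.* k)
    reassociate = solve-∀
    double : ∀ c q k → k ℕ.* (c ℕ.* q) ℕ.+ k ℕ.* (c ℕ.* q) ≡ (c ℕ.+ c) ℕ.* (q ℕ.* k)
    double = solve-∀

module _ {q} (F : FiniteField q) (U : AffineSpace.PointSet F 3) (k : ℕ) (1≤k : 1 ≤ℕ k) (4096≤q : 4096 ≤ℕ q)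
         (N≥ : 128 ℕ.* (q ℕ.* k) ≤ℕ ∣ U ∣) (N≤ : ∣ U ∣ ≤ℕ 256 ℕ.* (q ℕ.* k)) where

  open Cases F U k 1≤k 4096≤q N≥ using (Balanced; richLines; module FewRichLines)

  balanced : Balanced
  balanced with ℕ.≤-total (4 ℕ.* length richLines) (q ℕ.* q)
  ... | inj₁ few  = FewRichLines.balanced few
  ... | inj₂ many = ManyRichLines.balanced F U k 1≤k 4096≤q N≥ N≤ many

-- 128 makes k at least 1 and gives the average plane twice the 64k points that are chosen from it;
-- 4096 is what lets `cross-size` absorb the diagonal; 256 ^ 4 comes from replacing N by 256qk in
-- the fourth power.
balanced-families : BalancedFamilies 128 4096 (8388608 ℕ.* 256 ^ 4) 256
balanced-families q 4096≤q F U 128q≤N =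
  let (k , 1≤k , N≥ , N≤) = scale (ℕ.≤-trans (s≤s z≤n) 4096≤q) 128q≤N
      (H , unique , valid , size , degrees) = balanced F U k 1≤k 4096≤q N≥ N≤
  in H , unique , valid , fourth-power-≤ {∣ U ∣} {q} {k} {length H} 256 8388608 N≤ size , degrees

theorem4 : ∃[ T ] ∃[ c ] ∃[ C′ ] ∃[ q₀ ]
    (0ℚ < T × 0ℚ < c × 0ℚ < C′ × 0ℚ < q₀ ×
    (∀ (q : ℕ) → PrimePower q → q₀ ≤ fromℕ q →
    ∀ (F : FiniteField q) →
    let open AffineSpace F 3 in
    ∀ (U : PointSet) → T * fromℕ q ≤ fromℕ ∣ U ∣ →
    Σ[ H ∈ List PointSet ]
    (Unique H × All (𝒮₄ U) H ×
    c * fromℕ (∣ U ∣ ^ 4) ≤ fromℕ (length H) * fromℕ q ×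
    (∀ (i : ℕ) → 1 ≤ℕ i → i ≤ℕ 3 →
    fromℕ (Δ U i H) ≤ C′ * fromℕ (∣ U ∣ ^ (4 ∸ i)) /∛ (q ^ (3 ∸ (i ∸ 1)))))))
theorem4 = rational-bounds 128 4096 (8388608 ℕ.* 256 ^ 4) 256
  (s≤s z≤n) (s≤s z≤n) (s≤s z≤n) (s≤s z≤n) balanced-families
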